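{- Let $T_I$ be an index theory. For every pair $A^0,B^0$ of quantifier-free formulae such that $A^0\wedge B^0$ is $\mathcal{CARD}(T_I)$-unsatisfiable, the three-step algorithm described in the context (Preprocessing, Steps 1--3) computes a quantifier-free interpolant of the pair, i.e. a quantifier-free formula $C$ such that (i) $\mathcal{CARD}(T_I)\models A^0\to C$; (ii) $\mathcal{CARD}(T_I)\models C\wedge B^0\to\bot$ (falsum); (iii) $C$ contains only variables (of sorts INDEX, ARRAY, ELEM) which occur both in $A^0$ and in $B^0$.
   Context: Index theory. An index theory $T_I$ is a mono-sorted first-order theory with equality (its sort is called INDEX) such that: (a) $T_I$ is universal, stably infinite (every $T_I$-satisfiable quantifier-free formula is satisfiable in an infinite model of $T_I$) and has the general quantifier-free interpolation property, equivalently strong amalgamation (any two models with a common submodel $\mathcal A$ embed into a third one, with the embeddings agreeing on $\mathcal A$ and their images meeting only in the image of $\mathcal A$); (b) $T_I$-satisfiability of quantifier-free formulae is decidable; (c) $T_I$ extends the theory of linear (total) orders $\le$ with a distinguished constant $0$. We write $i<j$ for $i\le j\wedge i\ne j$. The theory $\mathcal{CARD}(T_I)$. Sorts: ARRAY, ELEM, INDEX. Symbols: those of $T_I$ (on INDEX); $rd:\mathrm{ARRAY}\times\mathrm{INDEX}\to\mathrm{ELEM}$; $wr:\mathrm{ARRAY}\times\mathrm{INDEX}\times\mathrm{ELEM}\to\mathrm{ARRAY}$; $\mathtt{diff}:\mathrm{ARRAY}\times\mathrm{ARRAY}\to\mathrm{INDEX}$; $|-|:\mathrm{ARRAY}\to\mathrm{INDEX}$;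 constants $\bot, el$ of sort ELEM. Axioms: those of $T_I$ and the universal closures of: (1) $|wr(y,i,e)|=|y|$; (2) $wr(y,i,\bot)=y$; (3) $(e\ne\bot\wedge 0\le i\le|y|)\to rd(wr(y,i,e),i)=e$; (4) $i\ne j\to rd(wr(y,i,e),j)=rd(y,j)$; (5) $rd(y,i)\ne\bot\leftrightarrow 0\le i\le|y|$; (6) $|y|\ge 0$; (7) $\mathtt{diff}(y,y)=0$; (8) $x\ne y\to rd(x,\mathtt{diff}(x,y))\ne rd(y,\mathtt{diff}(x,y))$; (9) $\mathtt{diff}(x,y)<i\to rd(x,i)=rd(y,i)$; (10) $\bot\ne el$. Iterated diff. For array terms $a,b$: $b_1:=b$, $\mathtt{diff}_1(a,b):=\mathtt{diff}(a,b_1)$, $b_{k+1}:=wr(b_k,\mathtt{diff}_k(a,b),rd(a,\mathtt{diff}_k(a,b)))$, $\mathtt{diff}_{k+1}(a,b):=\mathtt{diff}(a,b_{k+1})$. Separated pairs. Free variables are treated as free constants. A separated pair is a pair $\Phi=(\Phi_1,\Phi_2)$ of sets of quantifier-free formulae where: $\Phi_1$ consists of equalities of the forms $|a|=i$, $\mathtt{diff}_k(a,b)=i$, $a=wr(b,i,e)$; if $\Phi_1$ contains $\mathtt{diff}_k(a,b)=i$ then for every $l<k$ it contains some equality $\mathtt{diff}_l(a,b)=j$; for every array variable $a$ occurring in $\Phi_1\cup\Phi_2$, $\Phi_1$ contains an equality $|a|=l_a$; and $\Phi_2$ consists of Boolean combinations of $T_I$-atoms and atoms $rd(a,i)=rd(b,j)$,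 $rd(a,i)=e$, $e_1=e_2$. Here $a,b,i,j,e,e_1,e_2$ are variables or constants. Its logical reading is $\bigwedge\Phi_1\wedge\bigwedge\Phi_2$. Replacing each $rd(a,i)$ by $f_a(i)$, with $f_a:\mathrm{INDEX}\to\mathrm{ELEM}$ a free unary function symbol for each array constant $a$, formulae in $\Phi_2$ become formulae of $T_I\cup\mathcal{EUF}$ ($\mathcal{EUF}$ = theory of equality with uninterpreted symbols; the ground axiom $\bot\neq el$ is assumed too). $T_I\cup\mathcal{EUF}$ has general quantifier-free interpolation, and an interpolation algorithm for it is used as a black box (so the interpolant contains only free constants and symbols $f_a$ common to both formulae). Instantiation. For a set $\mathcal I$ of index terms, an $\mathcal I$-instance of $\forall h\,\phi$ is $\phi(t/h)$ with $t\in\mathcal I$. $\Phi(\mathcal I)=(\Phi_1(\mathcal I),\Phi_2(\mathcal I))$ is the smallest separated pair with $\Phi_1(\mathcal I)=\Phi_1$, $\Phi_2(\mathcal I)\supseteq\Phi_2$ and such that $\Phi_2(\mathcal I)$ contains all the $\mathcal I$-instances of the following formulae (with $|a|,|b|$ replaced by the index constants equated to them in $\Phi_1$): - if $a=wr(b,i,e)\in\Phi_1$: $(e\neq\bot\wedge 0\le i\le|b|)\to rd(a,i)=e$; $(i<0\vee i>|b|\vee e=\bot)\to rd(a,i)=rd(b,i)$; $\forall h\,(h\ne i\to rd(a,h)=rd(b,h))$; - if $|a|=i\in\Phi_1$: $i\ge0$; $\forall h\,(rd(a,h)\neq\bot\leftrightarrow 0\le h\le i)$; - if $\mathtt{diff}_n(a,b)=k_n\in\Phi_1$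 for $n=1,\dots,l$: $k_1\ge k_2\wedge\cdots\wedge k_{l-1}\ge k_l\wedge k_l\ge0$; $\bigwedge_{j<l}(k_j>k_{j+1}\to rd(a,k_j)\ne rd(b,k_j))$; $\bigwedge_{j<l}((|a|=|b|\wedge k_j=k_{j+1})\to k_j=0)$; $\bigwedge_{j\le l}(rd(a,k_j)=rd(b,k_j)\to k_j=0)$; $\forall h\,(h>k_l\to rd(a,h)=rd(b,h)\vee h=k_1\vee\cdots\vee h=k_{l-1})$; $|a|>|b|\to(k_1=k_l\wedge k_l=|a|)$; $|b|>|a|\to(k_1=k_l\wedge k_l=|b|)$. Colors. A term or formula is $A$-local (resp. $B$-local) if it uses only the symbols of the theory and free constants of $A$ (resp. $B$), and $AB$-common if it is both; it is $A$-strict (resp. $B$-strict) if it is $A$-local (resp. $B$-local) but not $AB$-common. The algorithm. Preprocessing: transform $A^0$ and $B^0$ into finite separated pairs $(A^0_1,A^0_2)$, $(B^0_1,B^0_2)$ as follows: flatten atoms by naming subterms with fresh constants; replace array equalities $a=b$ by $\mathtt{diff}(a,b)=0\wedge rd(a,0)=rd(b,0)$; name all terms $wr(b,i,e)$, $\mathtt{diff}(a,b)$, $|a|$ so that these symbols occur only in conjuncts $a=wr(b,i,e)$, $i=\mathtt{diff}(a,b)$, $i=|a|$, which form the first component; add the missing atoms $|a|=l_a$. A fresh constant gets the color of the term it names; equations naming $AB$-common terms are added to both sides. Let $N_A$ (resp. $N_B$) be the number of $A$-local (resp. $B$-local) index constants occurring within a $wr$ symbol in the preprocessed $A^0$ (resp.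 $B^0$), and $N:=1+\max(N_A,N_B)$. Step 1: for every pair of distinct $AB$-common array constants $c_1,c_2$, pick fresh $AB$-common index constants $k_1,\dots,k_N$ and add the atoms $\mathtt{diff}_n(c_1,c_2)=k_n$ ($n=1,\dots,N$) to both $A_1$ and $B_1$. Step 2: replace $A$ by $A(\mathcal I_A)$ and $B$ by $B(\mathcal I_B)$, where $\mathcal I_A$ (resp. $\mathcal I_B$) is the set of $A$-local (resp. $B$-local) index constants occurring in the current $A\cup B$ (constants of the signature of $T_I$, such as $0$, included). Call $(A_1,A_2)$, $(B_1,B_2)$ the resulting separated pairs. Step 3: (applicable when $A_2\wedge B_2$ is $T_I\cup\mathcal{EUF}$-unsatisfiable) compute a $T_I\cup\mathcal{EUF}$-interpolant $\theta$ of the pair $A_2,B_2$, read $f_c(t)$ back as $rd(c,t)$, and replace back the fresh $AB$-common constants introduced by the previous transformations by the $AB$-common terms they name; output the result as $C$. -}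

module Defs where

open import Level using (0ℓ)
open import Data.Empty using (⊥)
open import Data.List.Base using (List; []; _∷_; [_]; _++_; map; concatMap; mapMaybe; filter; foldr; length; upTo; deduplicate; cartesianProduct)
open import Data.List.Membership.Propositional using (_∈_)
open import Data.List.Membership.DecPropositional using () renaming (_∈?_ to member?)
open import Data.List.Relation.Unary.All using (All; all?)
open import Data.List.Relation.Unary.Enumerates.Setoid using (IsEnumeration)
open import Data.Maybe.Base using (Maybe; just; nothing)
open import Data.Nat.Base using (ℕ; zero; suc; _⊔_; NonZero)
open import Data.Nat.Properties using () renaming (_≟_ to _≟ℕ_)
open import Data.Product.Base using (Σ; ∃; _×_; _,_; proj₁; proj₂)
open import Data.Product.Properties using () renaming (≡-dec to ×-≡-dec)
open import Data.Sum.Base using (_⊎_)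
open import Data.Vec.Base as Vec using (Vec; []; _∷_; _∷ʳ_)
open import Data.Vec.Relation.Binary.Pointwise.Inductive using (Pointwise)
open import Relation.Binary.Bundles using (Setoid)
open import Relation.Binary.Definitions using (DecidableEquality)
open import Relation.Binary.PropositionalEquality.Core using (_≡_; refl)
open import Relation.Binary.Structures using (IsTotalOrder)
open import Relation.Nullary using (¬_; Dec; yes; no; ¬?; _×-dec_)

infixr 7 _∧̇_
infixr 6 _∨̇_
infixr 5 _⇒̇_
infix  4 _⇔̇_

data QF (A : Set) : Set where
  atom           : A → QF A
  ⊥̇              : QF A
  _∧̇_ _∨̇_ _⇒̇_ : QF A → QF A → QF A

¬̇_ : {A : Set} → QF A → QF A
¬̇ φ = φ ⇒̇ ⊥̇

_⇔̇_ : {A : Set} → QF A → QF A → QF A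
φ ⇔̇ ψ = (φ ⇒̇ ψ) ∧̇ (ψ ⇒̇ φ)

⋀ ⋁ : {A : Set} → List (QF A) → QF A
⋀ = foldr _∧̇_ (¬̇ ⊥̇)
⋁ = foldr _∨̇_ ⊥̇

atoms : {A : Set} → QF A → List A
atoms (atom a) = [ a ]
atoms ⊥̇        = []
atoms (φ ∧̇ ψ)  = atoms φ ++ atoms ψ
atoms (φ ∨̇ ψ)  = atoms φ ++ atoms ψ
atoms (φ ⇒̇ ψ)  = atoms φ ++ atoms ψ

bind : {A B : Set} → (A → QF B) → QF A → QF B
bind f (atom a) = f a
bind f ⊥̇        = ⊥̇
bind f (φ ∧̇ ψ)  = bind f φ ∧̇ bind f ψ
bind f (φ ∨̇ ψ)  = bind f φ ∨̇ bind f ψ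
bind f (φ ⇒̇ ψ)  = bind f φ ⇒̇ bind f ψ

Holds : {A : Set} → (A → Set) → QF A → Set
Holds V (atom a) = V a
Holds V ⊥̇        = ⊥
Holds V (φ ∧̇ ψ)  = Holds V φ × Holds V ψ
Holds V (φ ∨̇ ψ)  = Holds V φ ⊎ Holds V ψ
Holds V (φ ⇒̇ ψ)  = Holds V φ → Holds V ψ

-- The binary predicate ≤ is not listed in Rel: it is built into the
-- atoms below.  Symbols of arity 0 are listed in Con only.  Equality of
-- symbols is decidable, since algorithms manipulate formulae.
record Signature : Set₁ where
  field
    Con Fun Rel : Set
    zeroᶜ       : Con
    arityᶠ      : Fun → ℕ
    arityᴿ      : Rel → ℕ
    arityᶠ≢0    : ∀ f → NonZero (arityᶠ f)
    _≟ᶜ_        : DecidableEquality Con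
    _≟ᶠ_        : DecidableEquality Fun

module Syntax (S : Signature) where
  open Signature S

  data Tm (X : Set) : Set where
    var : X → Tm X
    con : Con → Tm X
    fn  : (f : Fun) → Vec (Tm X) (arityᶠ f) → Tm X

  infix 8 _≐_ _≼_

  -- The atoms built from a set A of terms.
  data IAtom (A : Set) : Set where
    _≐_ _≼_ : A → A → IAtom A
    rel     : (R : Rel) → Vec A (arityᴿ R) → IAtom A

  mapᴬ : {A B : Set} → (A → B) → IAtom A → IAtom B
  mapᴬ f (s ≐ t)    = f s ≐ f t
  mapᴬ f (s ≼ t)    = f s ≼ f t
  mapᴬ f (rel R ts) = rel R (Vec.map f ts)

  termsᴬ : {A : Set} → IAtom A → List A
  termsᴬ (s ≐ t)    = s ∷ t ∷ []
  termsᴬ (s ≼ t)    = s ∷ t ∷ []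
  termsᴬ (rel R ts) = Vec.toList ts

-- Equality is interpreted by an equivalence relation that all symbols
-- respect; the first-order structure meant is the quotient.
record Structure (S : Signature) : Set₁ where
  open Signature S
  field
    setoid : Setoid 0ℓ 0ℓ
  open Setoid setoid public
  infix 4 _≤_ _<_
  field
    conᴹ     : Con → Carrier
    fnᴹ      : (f : Fun) → Vec Carrier (arityᶠ f) → Carrier
    fn-cong  : ∀ f {xs ys} → Pointwise _≈_ xs ys → fnᴹ f xs ≈ fnᴹ f ys
    _≤_      : Carrier → Carrier → Set
    ≤-resp   : ∀ {x x′ y y′} → x ≈ x′ → y ≈ y′ → x ≤ y → x′ ≤ y′
    relᴹ     : (R : Rel) → Vec Carrier (arityᴿ R) → Set
    rel-resp : ∀ R {xs ys} → Pointwise _≈_ xs ys → relᴹ R xs → relᴹ R ys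

  _<_ : Carrier → Carrier → Set
  x < y = x ≤ y × ¬ (x ≈ y)

  0ᴹ : Carrier
  0ᴹ = conᴹ zeroᶜ

  open Syntax S

  mutual
    ⟦_⟧ : {X : Set} → Tm X → (X → Carrier) → Carrier
    ⟦ var x ⟧   ρ = ρ x
    ⟦ con c ⟧   ρ = conᴹ c
    ⟦ fn f ts ⟧ ρ = fnᴹ f (⟦ ts ⟧* ρ)

    ⟦_⟧* : {X : Set} {n : ℕ} → Vec (Tm X) n → (X → Carrier) → Vec Carrier n
    ⟦ [] ⟧*     ρ = []
    ⟦ t ∷ ts ⟧* ρ = ⟦ t ⟧ ρ ∷ ⟦ ts ⟧* ρ

  Holdsᴬ : {A : Set} → (A → Carrier) → IAtom A → Set
  Holdsᴬ ev (s ≐ t)    = ev s ≈ ev t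
  Holdsᴬ ev (s ≼ t)    = ev s ≤ ev t
  Holdsᴬ ev (rel R ts) = relᴹ R (Vec.map ev ts)

record Embedding {S : Signature} (M N : Structure S) : Set where
  open Signature S
  private
    module M = Structure M
    module N = Structure N
  field
    to         : M.Carrier → N.Carrier
    cong       : ∀ {x y} → x M.≈ y → to x N.≈ to y
    injective  : ∀ {x y} → to x N.≈ to y → x M.≈ y
    con-homo   : ∀ c → to (M.conᴹ c) N.≈ N.conᴹ c
    fn-homo    : ∀ f xs → to (M.fnᴹ f xs) N.≈ N.fnᴹ f (Vec.map to xs)
    ≤-mono     : ∀ {x y} → x M.≤ y → to x N.≤ to y
    ≤-reflect  : ∀ {x y} → to x N.≤ to y → x M.≤ y
    rel-mono   : ∀ R {xs} → M.relᴹ R xs → N.relᴹ R (Vec.map to xs)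
    rel-reflect : ∀ R {xs} → N.relᴹ R (Vec.map to xs) → M.relᴹ R xs

-- The axioms are the universal closures of the formulae in Axiom.
record UniversalTheory : Set₁ where
  field
    signature : Signature
  open Signature signature public
  open Syntax signature public
  field
    Axiom : QF (IAtom (Tm ℕ)) → Set

  _,_⊨ᴵ_ : (M : Structure signature) → (ℕ → Structure.Carrier M) → QF (IAtom (Tm ℕ)) → Set
  M , ρ ⊨ᴵ φ = Holds (Structure.Holdsᴬ M λ t → Structure.⟦_⟧ M t ρ) φ

  record Model : Set₁ where
    field
      structure : Structure signature
    open Structure structure public
    field
      axioms : ∀ φ → Axiom φ → ∀ ρ → structure , ρ ⊨ᴵ φ

  Satisfiableᴵ : QF (IAtom (Tm ℕ)) → Set₁
  Satisfiableᴵ φ = Σ Model λ M → ∃ λ ρ → Model.structure M , ρ ⊨ᴵ φ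

  Infinite : Model → Set
  Infinite M = ∀ xs → ¬ IsEnumeration (Model.setoid M) xs

  StablyInfinite : Set₁
  StablyInfinite = ∀ φ → Satisfiableᴵ φ →
    Σ Model λ M → Infinite M × ∃ λ ρ → Model.structure M , ρ ⊨ᴵ φ

  record StrongAmalgam {A M₁ M₂ : Model}
    (ι₁ : Embedding (Model.structure A) (Model.structure M₁))
    (ι₂ : Embedding (Model.structure A) (Model.structure M₂)) : Set₁ where
    open Embedding using (to)
    field
      amalgam : Model
      μ₁      : Embedding (Model.structure M₁) (Model.structure amalgam)
      μ₂      : Embedding (Model.structure M₂) (Model.structure amalgam)
      agree   : ∀ a → Model._≈_ amalgam (to μ₁ (to ι₁ a)) (to μ₂ (to ι₂ a))
      strong  : ∀ x y → Model._≈_ amalgam (to μ₁ x) (to μ₂ y) →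
                ∃ λ a → Model._≈_ M₁ x (to ι₁ a) × Model._≈_ M₂ y (to ι₂ a)

  StrongAmalgamation : Set₁
  StrongAmalgamation = ∀ {A M₁ M₂ : Model}
    (ι₁ : Embedding (Model.structure A) (Model.structure M₁))
    (ι₂ : Embedding (Model.structure A) (Model.structure M₂)) →
    StrongAmalgam {A} {M₁} {M₂} ι₁ ι₂

record IndexTheory : Set₁ where
  field
    theory             : UniversalTheory
  open UniversalTheory theory public
  field
    stablyInfinite     : StablyInfinite
    strongAmalgamation : StrongAmalgamation
    satisfiable?       : ∀ φ → Dec (Satisfiableᴵ φ)
    isTotalOrder       : ∀ (M : Model) → IsTotalOrder (Model._≈_ M) (Model._≤_ M)

data Sort : Set where
  INDEX ARRAY ELEM : Sort

_≟ˢ_ : DecidableEquality Sort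
INDEX ≟ˢ INDEX = yes refl
INDEX ≟ˢ ARRAY = no λ ()
INDEX ≟ˢ ELEM  = no λ ()
ARRAY ≟ˢ INDEX = no λ ()
ARRAY ≟ˢ ARRAY = yes refl
ARRAY ≟ˢ ELEM  = no λ ()
ELEM  ≟ˢ INDEX = no λ ()
ELEM  ≟ˢ ARRAY = no λ ()
ELEM  ≟ˢ ELEM  = yes refl

Variable : Set
Variable = Sort × ℕ

_≟ⱽ_ : DecidableEquality Variable
_≟ⱽ_ = ×-≡-dec _≟ˢ_ _≟ℕ_

module CardSyntax (S : Signature) where
  open Signature S
  open Syntax S

  data Term : Sort → Set where
    var  : ∀ {s} → ℕ → Term s
    con  : Con → Term INDEX
    fn   : (f : Fun) → Vec (Term INDEX) (arityᶠ f) → Term INDEX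
    len  : Term ARRAY → Term INDEX
    diff : Term ARRAY → Term ARRAY → Term INDEX
    wr   : Term ARRAY → Term INDEX → Term ELEM → Term ARRAY
    rd   : Term ARRAY → Term INDEX → Term ELEM
    bot  : Term ELEM
    el   : Term ELEM

  data CardAtom : Set where
    index  : IAtom (Term INDEX) → CardAtom
    array≐ : Term ARRAY → Term ARRAY → CardAtom
    elem≐  : Term ELEM → Term ELEM → CardAtom

  Formula : Set
  Formula = QF CardAtom

  mutual
    varsᵗ : ∀ {s} → Term s → List Variable
    varsᵗ {s} (var x)  = [ s , x ]
    varsᵗ (con c)      = []
    varsᵗ (fn f ts)    = varsᵗ* ts
    varsᵗ (len a)      = varsᵗ a
    varsᵗ (diff a b)   = varsᵗ a ++ varsᵗ b
    varsᵗ (wr a i e)   = varsᵗ a ++ varsᵗ i ++ varsᵗ e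
    varsᵗ (rd a i)     = varsᵗ a ++ varsᵗ i
    varsᵗ bot          = []
    varsᵗ el           = []

    varsᵗ* : ∀ {s n} → Vec (Term s) n → List Variable
    varsᵗ* []       = []
    varsᵗ* (t ∷ ts) = varsᵗ t ++ varsᵗ* ts

  varsᵃ : CardAtom → List Variable
  varsᵃ (index α)    = concatMap varsᵗ (termsᴬ α)
  varsᵃ (array≐ a b) = varsᵗ a ++ varsᵗ b
  varsᵃ (elem≐ d e)  = varsᵗ d ++ varsᵗ e

  vars : Formula → List Variable
  vars φ = concatMap varsᵃ (atoms φ)

  -- iterate a b n is b_{n+1} and diffᵗ a b n is diff_{n+1}(a,b).
  iterate : Term ARRAY → Term ARRAY → ℕ → Term ARRAY
  iterate a b zero    = b
  iterate a b (suc n) = wr bₙ (diff a bₙ) (rd a (diff a bₙ))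
    where bₙ = iterate a b n

  diffᵗ : Term ARRAY → Term ARRAY → ℕ → Term INDEX
  diffᵗ a b n = diff a (iterate a b n)

  mutual
    infix 4 _≟ᵗ_ _≟ᵗ*_

    _≟ᵗ_ : ∀ {s} → DecidableEquality (Term s)
    var x    ≟ᵗ var y    with x ≟ℕ y
    ... | yes refl = yes refl
    ... | no x≢y   = no λ { refl → x≢y refl }
    con c    ≟ᵗ con d    with c ≟ᶜ d
    ... | yes refl = yes refl
    ... | no c≢d   = no λ { refl → c≢d refl }
    fn f ts  ≟ᵗ fn g us  with f ≟ᶠ g
    ... | no f≢g   = no λ { refl → f≢g refl }
    ... | yes refl with ts ≟ᵗ* us
    ...   | yes refl = yes refl
    ...   | no ts≢us = no λ { refl → ts≢us refl }
    len a    ≟ᵗ len b    with a ≟ᵗ b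
    ... | yes refl = yes refl
    ... | no a≢b   = no λ { refl → a≢b refl }
    diff a b ≟ᵗ diff c d with a ≟ᵗ c | b ≟ᵗ d
    ... | yes refl | yes refl = yes refl
    ... | no a≢c   | _        = no λ { refl → a≢c refl }
    ... | _        | no b≢d   = no λ { refl → b≢d refl }
    wr a i d ≟ᵗ wr b j e with a ≟ᵗ b | i ≟ᵗ j | d ≟ᵗ e
    ... | yes refl | yes refl | yes refl = yes refl
    ... | no a≢b   | _        | _        = no λ { refl → a≢b refl }
    ... | _        | no i≢j   | _        = no λ { refl → i≢j refl }
    ... | _        | _        | no d≢e   = no λ { refl → d≢e refl }
    rd a i   ≟ᵗ rd b j   with a ≟ᵗ b | i ≟ᵗ j
    ... | yes refl | yes refl = yes refl
    ... | no a≢b   | _        = no λ { refl → a≢b refl }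
    ... | _        | no i≢j   = no λ { refl → i≢j refl }
    bot      ≟ᵗ bot      = yes refl
    el       ≟ᵗ el       = yes refl
    var _    ≟ᵗ con _    = no λ ()
    var _    ≟ᵗ fn _ _   = no λ ()
    var _    ≟ᵗ len _    = no λ ()
    var _    ≟ᵗ diff _ _ = no λ ()
    var _    ≟ᵗ wr _ _ _ = no λ ()
    var _    ≟ᵗ rd _ _   = no λ ()
    var _    ≟ᵗ bot      = no λ ()
    var _    ≟ᵗ el       = no λ ()
    con _    ≟ᵗ var _    = no λ ()
    con _    ≟ᵗ fn _ _   = no λ ()
    con _    ≟ᵗ len _    = no λ ()
    con _    ≟ᵗ diff _ _ = no λ ()
    fn _ _   ≟ᵗ var _    = no λ ()
    fn _ _   ≟ᵗ con _    = no λ ()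
    fn _ _   ≟ᵗ len _    = no λ ()
    fn _ _   ≟ᵗ diff _ _ = no λ ()
    len _    ≟ᵗ var _    = no λ ()
    len _    ≟ᵗ con _    = no λ ()
    len _    ≟ᵗ fn _ _   = no λ ()
    len _    ≟ᵗ diff _ _ = no λ ()
    diff _ _ ≟ᵗ var _    = no λ ()
    diff _ _ ≟ᵗ con _    = no λ ()
    diff _ _ ≟ᵗ fn _ _   = no λ ()
    diff _ _ ≟ᵗ len _    = no λ ()
    wr _ _ _ ≟ᵗ var _    = no λ ()
    rd _ _   ≟ᵗ var _    = no λ ()
    rd _ _   ≟ᵗ bot      = no λ ()
    rd _ _   ≟ᵗ el       = no λ ()
    bot      ≟ᵗ var _    = no λ ()
    bot      ≟ᵗ rd _ _   = no λ ()
    bot      ≟ᵗ el       = no λ ()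
    el       ≟ᵗ var _    = no λ ()
    el       ≟ᵗ rd _ _   = no λ ()
    el       ≟ᵗ bot      = no λ ()

    _≟ᵗ*_ : ∀ {s n} → DecidableEquality (Vec (Term s) n)
    []       ≟ᵗ* []       = yes refl
    (t ∷ ts) ≟ᵗ* (u ∷ us) with t ≟ᵗ u | ts ≟ᵗ* us
    ... | yes refl | yes refl = yes refl
    ... | no t≢u   | _        = no λ { refl → t≢u refl }
    ... | _        | no ts≢us = no λ { refl → ts≢us refl }

module Card (T : UniversalTheory) where
  open UniversalTheory T using (signature; Con; Fun; Model)
  open CardSyntax signature

  record CardModel : Set₁ where
    field
      indexModel  : Model
      arraySetoid : Setoid 0ℓ 0ℓ
      elemSetoid  : Setoid 0ℓ 0ℓ

    module I = Model indexModel
    module A = Setoid arraySetoid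
    module E = Setoid elemSetoid

    field
      rdᴹ   : A.Carrier → I.Carrier → E.Carrier
      wrᴹ   : A.Carrier → I.Carrier → E.Carrier → A.Carrier
      diffᴹ : A.Carrier → A.Carrier → I.Carrier
      ∣_∣   : A.Carrier → I.Carrier
      botᴹ  : E.Carrier
      elᴹ   : E.Carrier

      rd-cong   : ∀ {x y i j} → x A.≈ y → i I.≈ j → rdᴹ x i E.≈ rdᴹ y j
      wr-cong   : ∀ {x y i j d e} → x A.≈ y → i I.≈ j → d E.≈ e → wrᴹ x i d A.≈ wrᴹ y j e
      diff-cong : ∀ {x x′ y y′} → x A.≈ x′ → y A.≈ y′ → diffᴹ x y I.≈ diffᴹ x′ y′
      len-cong  : ∀ {x y} → x A.≈ y → ∣ x ∣ I.≈ ∣ y ∣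

      len-wr     : ∀ y i e → ∣ wrᴹ y i e ∣ I.≈ ∣ y ∣
      wr-bot     : ∀ y i → wrᴹ y i botᴹ A.≈ y
      rd-wr-same : ∀ y i e → ¬ (e E.≈ botᴹ) × I.0ᴹ I.≤ i × i I.≤ ∣ y ∣ → rdᴹ (wrᴹ y i e) i E.≈ e
      rd-wr-diff : ∀ y i j e → ¬ (i I.≈ j) → rdᴹ (wrᴹ y i e) j E.≈ rdᴹ y j
      rd-defined : ∀ y i → ¬ (rdᴹ y i E.≈ botᴹ) → I.0ᴹ I.≤ i × i I.≤ ∣ y ∣
      defined-rd : ∀ y i → I.0ᴹ I.≤ i × i I.≤ ∣ y ∣ → ¬ (rdᴹ y i E.≈ botᴹ)
      len-nonneg : ∀ y → I.0ᴹ I.≤ ∣ y ∣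
      diff-refl  : ∀ y → diffᴹ y y I.≈ I.0ᴹ
      rd-diff    : ∀ x y → ¬ (x A.≈ y) → ¬ (rdᴹ x (diffᴹ x y) E.≈ rdᴹ y (diffᴹ x y))
      diff-max   : ∀ x y i → diffᴹ x y I.< i → rdᴹ x i E.≈ rdᴹ y i
      bot≉el     : ¬ (botᴹ E.≈ elᴹ)

    Carrier : Sort → Set
    Carrier INDEX = I.Carrier
    Carrier ARRAY = A.Carrier
    Carrier ELEM  = E.Carrier

    Assignment : Set
    Assignment = ∀ s → ℕ → Carrier s

    mutual
      ⟦_⟧ : ∀ {s} → Term s → Assignment → Carrier s
      ⟦ var {s} x ⟧ ρ = ρ s x
      ⟦ con c ⟧     ρ = I.conᴹ c
      ⟦ fn f ts ⟧   ρ = I.fnᴹ f (⟦ ts ⟧* ρ)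
      ⟦ len a ⟧     ρ = ∣ ⟦ a ⟧ ρ ∣
      ⟦ diff a b ⟧  ρ = diffᴹ (⟦ a ⟧ ρ) (⟦ b ⟧ ρ)
      ⟦ wr a i e ⟧  ρ = wrᴹ (⟦ a ⟧ ρ) (⟦ i ⟧ ρ) (⟦ e ⟧ ρ)
      ⟦ rd a i ⟧    ρ = rdᴹ (⟦ a ⟧ ρ) (⟦ i ⟧ ρ)
      ⟦ bot ⟧       ρ = botᴹ
      ⟦ el ⟧        ρ = elᴹ

      ⟦_⟧* : ∀ {s n} → Vec (Term s) n → Assignment → Vec (Carrier s) n
      ⟦ [] ⟧*     ρ = []
      ⟦ t ∷ ts ⟧* ρ = ⟦ t ⟧ ρ ∷ ⟦ ts ⟧* ρ

    Holdsᶜ : Assignment → CardAtom → Set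
    Holdsᶜ ρ (index α)    = I.Holdsᴬ (λ t → ⟦ t ⟧ ρ) α
    Holdsᶜ ρ (array≐ a b) = ⟦ a ⟧ ρ A.≈ ⟦ b ⟧ ρ
    Holdsᶜ ρ (elem≐ d e)  = ⟦ d ⟧ ρ E.≈ ⟦ e ⟧ ρ

    _⊨_ : Assignment → Formula → Set
    ρ ⊨ φ = Holds (Holdsᶜ ρ) φ

  Valid : Formula → Set₁
  Valid φ = ∀ (M : CardModel) (ρ : CardModel.Assignment M) → CardModel._⊨_ M ρ φ

  Unsatisfiable : Formula → Set₁
  Unsatisfiable φ = ∀ (M : CardModel) (ρ : CardModel.Assignment M) → ¬ CardModel._⊨_ M ρ φ

  record IsInterpolant (A B C : Formula) : Set₁ where
    field
      left   : Valid (A ⇒̇ C)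
      right  : Valid (C ∧̇ B ⇒̇ ⊥̇)
      common : ∀ v → v ∈ vars C → v ∈ vars A × v ∈ vars B

-- V INDEX and V ELEM are the free constants; each a : V ARRAY provides a
-- free unary function symbol f_a from INDEX to ELEM.
module EUFSyntax (S : Signature) (V : Sort → Set) where
  open Signature S
  open Syntax S

  data ETm : Set where
    var    : V ELEM → ETm
    bot el : ETm
    _·_    : V ARRAY → Tm (V INDEX) → ETm

  data EUFAtom : Set where
    index : IAtom (Tm (V INDEX)) → EUFAtom
    _≐ᴱ_  : ETm → ETm → EUFAtom

  EUFFormula : Set
  EUFFormula = QF EUFAtom

  data Symbol : Set where
    free  : ∀ {s} → V s → Symbol
    const : Con → Symbol

  mutual
    symbolsᵗ : Tm (V INDEX) → List Symbol
    symbolsᵗ (var x)   = [ free x ]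
    symbolsᵗ (con c)   = [ const c ]
    symbolsᵗ (fn f ts) = symbolsᵗ* ts

    symbolsᵗ* : ∀ {n} → Vec (Tm (V INDEX)) n → List Symbol
    symbolsᵗ* []       = []
    symbolsᵗ* (t ∷ ts) = symbolsᵗ t ++ symbolsᵗ* ts

  symbolsᵉ : ETm → List Symbol
  symbolsᵉ (var x) = [ free x ]
  symbolsᵉ bot     = []
  symbolsᵉ el      = []
  symbolsᵉ (a · t) = free a ∷ symbolsᵗ t

  symbolsᵃ : EUFAtom → List Symbol
  symbolsᵃ (index α) = concatMap symbolsᵗ (termsᴬ α)
  symbolsᵃ (d ≐ᴱ e)  = symbolsᵉ d ++ symbolsᵉ e

  symbols : EUFFormula → List Symbol
  symbols φ = concatMap symbolsᵃ (atoms φ)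

module EUF (T : UniversalTheory) (V : Sort → Set) where
  open UniversalTheory T using (signature; Model)
  open EUFSyntax signature V

  record EUFModel : Set₁ where
    field
      indexModel : Model
      elemSetoid : Setoid 0ℓ 0ℓ

    module I = Model indexModel
    module E = Setoid elemSetoid

    field
      botᴹ   : E.Carrier
      elᴹ    : E.Carrier
      bot≉el : ¬ (botᴹ E.≈ elᴹ)
      indexᴹ : V INDEX → I.Carrier
      elemᴹ  : V ELEM → E.Carrier
      funᴹ   : V ARRAY → I.Carrier → E.Carrier
      fun-cong : ∀ a {i j} → i I.≈ j → funᴹ a i E.≈ funᴹ a j

    ⟦_⟧ᵉ : ETm → E.Carrier
    ⟦ var x ⟧ᵉ = elemᴹ x
    ⟦ bot ⟧ᵉ   = botᴹ
    ⟦ el ⟧ᵉ    = elᴹ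
    ⟦ a · t ⟧ᵉ = funᴹ a (I.⟦ t ⟧ indexᴹ)

    Holdsᵉ : EUFAtom → Set
    Holdsᵉ (index α) = I.Holdsᴬ (λ t → I.⟦ t ⟧ indexᴹ) α
    Holdsᵉ (d ≐ᴱ e)  = ⟦ d ⟧ᵉ E.≈ ⟦ e ⟧ᵉ

    ⊨_ : EUFFormula → Set
    ⊨ φ = Holds Holdsᵉ φ

  Validᴱ : EUFFormula → Set₁
  Validᴱ φ = ∀ (M : EUFModel) → EUFModel.⊨_ M φ

  Unsatisfiableᴱ : EUFFormula → Set₁
  Unsatisfiableᴱ φ = ∀ (M : EUFModel) → ¬ EUFModel.⊨_ M φ

  record IsInterpolantᴱ (A B C : EUFFormula) : Set₁ where
    field
      left   : Validᴱ (A ⇒̇ C)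
      right  : Validᴱ (C ∧̇ B ⇒̇ ⊥̇)
      common : ∀ {s} (v : V s) → free v ∈ symbols C → free v ∈ symbols A × free v ∈ symbols B

  record InterpolationAlgorithm : Set₁ where
    field
      interpolate : EUFFormula → EUFFormula → EUFFormula
      correct     : ∀ A B → Unsatisfiableᴱ (A ∧̇ B) → IsInterpolantᴱ A B (interpolate A B)

module Separated (S : Signature) where
  open Signature S
  open Syntax S
  open CardSyntax S using (Term; diffᵗ; _≟ᵗ_)

  -- The constants of the preprocessed language carry the term they name:
  -- the original variable x is ⌜ var x ⌝, whereas for any other t the
  -- constant ⌜ t ⌝ is fresh.  diffₖ n c₁ c₂ is the fresh constant for
  -- diff_{n+1}(c₁,c₂) picked for the pair of common arrays c₁, c₂.
  data Name : Sort → Set where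
    ⌜_⌝   : ∀ {s} → Term s → Name s
    diffₖ : ℕ → Name ARRAY → Name ARRAY → Name INDEX

  term : ∀ {s} → Name s → Term s
  term ⌜ t ⌝           = t
  term (diffₖ n c₁ c₂) = diffᵗ (term c₁) (term c₂) n

  open EUFSyntax S Name public

  data ICst : Set where
    name : Name INDEX → ICst
    con  : Con → ICst

  data ECst : Set where
    name   : Name ELEM → ECst
    bot el : ECst

  ⟨_⟩ : ICst → Tm (Name INDEX)
  ⟨ name x ⟩ = var x
  ⟨ con c ⟩  = con c

  ⟨_⟩ᴱ : ECst → ETm
  ⟨ name x ⟩ᴱ = var x
  ⟨ bot ⟩ᴱ    = bot
  ⟨ el ⟩ᴱ     = el

  𝟘 : ICst
  𝟘 = con zeroᶜ

  infix 4 _≟ᴺ_ _≟ᴵ_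

  _≟ᴺ_ : ∀ {s} → DecidableEquality (Name s)
  ⌜ t ⌝       ≟ᴺ ⌜ u ⌝       with t ≟ᵗ u
  ... | yes refl = yes refl
  ... | no t≢u   = no λ { refl → t≢u refl }
  ⌜ _ ⌝       ≟ᴺ diffₖ _ _ _ = no λ ()
  diffₖ _ _ _ ≟ᴺ ⌜ _ ⌝       = no λ ()
  diffₖ m a b ≟ᴺ diffₖ n c d with m ≟ℕ n | a ≟ᴺ c | b ≟ᴺ d
  ... | yes refl | yes refl | yes refl = yes refl
  ... | no m≢n   | _        | _        = no λ { refl → m≢n refl }
  ... | _        | no a≢c   | _        = no λ { refl → a≢c refl }
  ... | _        | _        | no b≢d   = no λ { refl → b≢d refl }

  _≟ᴵ_ : DecidableEquality ICst
  name x ≟ᴵ name y with x ≟ᴺ y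
  ... | yes refl = yes refl
  ... | no x≢y   = no λ { refl → x≢y refl }
  name _ ≟ᴵ con _  = no λ ()
  con _  ≟ᴵ name _ = no λ ()
  con c  ≟ᴵ con d  with c ≟ᶜ d
  ... | yes refl = yes refl
  ... | no c≢d   = no λ { refl → c≢d refl }

  -- Respectively |a| = i, diff_{n+1}(a,b) = i and a = wr(b,i,e).
  data Atom₁ : Set where
    len≡  : Name ARRAY → ICst → Atom₁
    diff≡ : ℕ → Name ARRAY → Name ARRAY → ICst → Atom₁
    wr≡   : Name ARRAY → Name ARRAY → ICst → ECst → Atom₁

  record SepPair : Set where
    constructor _∣_
    field
      Φ₁ : List Atom₁
      Φ₂ : List EUFFormula
  open SepPair public

  infixr 5 _∪_

  _∪_ : SepPair → SepPair → SepPair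
  (Φ₁ ∣ Φ₂) ∪ (Ψ₁ ∣ Ψ₂) = (Φ₁ ++ Ψ₁) ∣ (Φ₂ ++ Ψ₂)

  ⋃ : List SepPair → SepPair
  ⋃ = foldr _∪_ ([] ∣ [])

  infix 8 _≡ᴵ_ _≤ᴵ_ _<ᴵ_

  _≡ᴵ_ _≤ᴵ_ _<ᴵ_ : ICst → ICst → EUFFormula
  i ≡ᴵ j = atom (index (⟨ i ⟩ ≐ ⟨ j ⟩))
  i ≤ᴵ j = atom (index (⟨ i ⟩ ≼ ⟨ j ⟩))
  i <ᴵ j = i ≤ᴵ j ∧̇ ¬̇ (i ≡ᴵ j)

  infix 8 _≡ᴱ_

  _≡ᴱ_ : ETm → ETm → EUFFormula
  d ≡ᴱ e = atom (d ≐ᴱ e)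

  infix 9 _‼_

  _‼_ : Name ARRAY → ICst → ETm
  a ‼ i = a · ⟨ i ⟩

  -- lb is the index constant equated to |b|.
  wrInstances : List ICst → (a b : Name ARRAY) → ICst → ECst → (lb : ICst) → List EUFFormula
  wrInstances 𝓘 a b i e lb =
      (¬̇ (⟨ e ⟩ᴱ ≡ᴱ bot) ∧̇ 𝟘 ≤ᴵ i ∧̇ i ≤ᴵ lb ⇒̇ a ‼ i ≡ᴱ ⟨ e ⟩ᴱ)
    ∷ (i <ᴵ 𝟘 ∨̇ lb <ᴵ i ∨̇ ⟨ e ⟩ᴱ ≡ᴱ bot ⇒̇ a ‼ i ≡ᴱ b ‼ i)
    ∷ map (λ h → ¬̇ (h ≡ᴵ i) ⇒̇ a ‼ h ≡ᴱ b ‼ h) 𝓘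

  lenInstances : List ICst → Name ARRAY → ICst → List EUFFormula
  lenInstances 𝓘 a i =
      𝟘 ≤ᴵ i
    ∷ map (λ h → ¬̇ (a ‼ h ≡ᴱ bot) ⇔̇ 𝟘 ≤ᴵ h ∧̇ h ≤ᴵ i) 𝓘

  -- The pairs (k_j , k_{j+1}) with j < l.
  consecutive : ∀ {A : Set} {n} → Vec A (suc n) → List (A × A)
  consecutive ks = Vec.toList (Vec.zip (Vec.init ks) (Vec.tail ks))

  -- The vector ks is k₁,…,k_l, where l = suc n.
  diffInstances : List ICst → (a b : Name ARRAY) → ∀ {n} → Vec ICst (suc n) → (la lb : ICst) → List EUFFormula
  diffInstances 𝓘 a b ks la lb =
      ⋀ (map (λ (k , k′) → k′ ≤ᴵ k) steps) ∧̇ 𝟘 ≤ᴵ kₗ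
    ∷ ⋀ (map (λ (k , k′) → k′ <ᴵ k ⇒̇ ¬̇ (a ‼ k ≡ᴱ b ‼ k)) steps)
    ∷ ⋀ (map (λ (k , k′) → la ≡ᴵ lb ∧̇ k ≡ᴵ k′ ⇒̇ k ≡ᴵ 𝟘) steps)
    ∷ ⋀ (map (λ k → a ‼ k ≡ᴱ b ‼ k ⇒̇ k ≡ᴵ 𝟘) (Vec.toList ks))
    ∷ (lb <ᴵ la ⇒̇ k₁ ≡ᴵ kₗ ∧̇ kₗ ≡ᴵ la)
    ∷ (la <ᴵ lb ⇒̇ k₁ ≡ᴵ kₗ ∧̇ kₗ ≡ᴵ lb)
    ∷ map (λ h → kₗ <ᴵ h ⇒̇ a ‼ h ≡ᴱ b ‼ h ∨̇ ⋁ (map (h ≡ᴵ_) (Vec.toList (Vec.init ks)))) 𝓘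
    where
    k₁ = Vec.head ks
    kₗ = Vec.last ks
    steps = consecutive ks

  lengthIn : Name ARRAY → Atom₁ → Maybe ICst
  lengthIn a (len≡ a′ i) with a ≟ᴺ a′
  ... | yes _ = just i
  ... | no  _ = nothing
  lengthIn _ _ = nothing

  diffIn : ℕ → Name ARRAY → Name ARRAY → Atom₁ → Maybe ICst
  diffIn n a b (diff≡ n′ a′ b′ i) with (n ≟ℕ n′) ×-dec (a ≟ᴺ a′) ×-dec (b ≟ᴺ b′)
  ... | yes _ = just i
  ... | no  _ = nothing
  diffIn _ _ _ _ = nothing

  -- All i such that |a| = i, resp. diff_{n+1}(a,b) = i, belongs to Φ₁.
  lengths : List Atom₁ → Name ARRAY → List ICst
  lengths Φ₁ a = mapMaybe (lengthIn a) Φ₁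

  diffs : List Atom₁ → ℕ → Name ARRAY → Name ARRAY → List ICst
  diffs Φ₁ n a b = mapMaybe (diffIn n a b) Φ₁

  -- All k₁,…,k_l such that diff_n(a,b) = k_n belongs to Φ₁ for n = 1,…,l.
  chains : List Atom₁ → Name ARRAY → Name ARRAY → (l : ℕ) → List (Vec ICst l)
  chains Φ₁ a b zero    = [ [] ]
  chains Φ₁ a b (suc l) =
    concatMap (λ ks → map (ks ∷ʳ_) (diffs Φ₁ l a b)) (chains Φ₁ a b l)

  instances : List ICst → List Atom₁ → Atom₁ → List EUFFormula
  instances 𝓘 Φ₁ (len≡ a i)      = lenInstances 𝓘 a i
  instances 𝓘 Φ₁ (wr≡ a b i e)   = concatMap (wrInstances 𝓘 a b i e) (lengths Φ₁ b)
  instances 𝓘 Φ₁ (diff≡ n a b _) =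
    concatMap (λ ks → concatMap (λ la → concatMap (diffInstances 𝓘 a b ks la)
      (lengths Φ₁ b)) (lengths Φ₁ a)) (chains Φ₁ a b (suc n))

  instantiate : List ICst → SepPair → SepPair
  instantiate 𝓘 (Φ₁ ∣ Φ₂) = Φ₁ ∣ (Φ₂ ++ concatMap (instances 𝓘 Φ₁) Φ₁)

  symbolsᵢ : ICst → List Symbol
  symbolsᵢ i = symbolsᵗ ⟨ i ⟩

  symbols₁ : Atom₁ → List Symbol
  symbols₁ (len≡ a i)      = free a ∷ symbolsᵢ i
  symbols₁ (diff≡ _ a b i) = free a ∷ free b ∷ symbolsᵢ i
  symbols₁ (wr≡ a b i e)   = free a ∷ free b ∷ symbolsᵢ i ++ symbolsᵉ ⟨ e ⟩ᴱ

  symbolsˢ : SepPair → List Symbol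
  symbolsˢ (Φ₁ ∣ Φ₂) = concatMap symbols₁ Φ₁ ++ concatMap symbols Φ₂

  asArray : Symbol → Maybe (Name ARRAY)
  asArray (free {ARRAY} a) = just a
  asArray _                = nothing

  asIndex : Symbol → Maybe ICst
  asIndex (free {INDEX} x) = just (name x)
  asIndex (const c)        = just (con c)
  asIndex _                = nothing

  arrayConstants : SepPair → List (Name ARRAY)
  arrayConstants Φ = mapMaybe asArray (symbolsˢ Φ)

  indexConstants : SepPair → List ICst
  indexConstants Φ = mapMaybe asIndex (symbolsˢ Φ)

module Algorithm (S : Signature) where
  open Signature S
  open Syntax S
  open CardSyntax S
  open Separated S

  Local : ∀ {s} → Formula → Term s → Set
  Local X t = All (_∈ vars X) (varsᵗ t)

  local? : ∀ {s} X (t : Term s) → Dec (Local X t)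
  local? X t = all? (λ v → member? _≟ⱽ_ v (vars X)) (varsᵗ t)

  -- Reading a constant back: a name has the color of the term it names.
  termᴵ : ICst → Term INDEX
  termᴵ (name x) = term x
  termᴵ (con c)  = con c

  mutual
    subterms : ∀ {s} → Term s → List (∃ Term)
    subterms {s} t = (s , t) ∷ properSubterms t

    properSubterms : ∀ {s} → Term s → List (∃ Term)
    properSubterms (var x)    = []
    properSubterms (con c)    = []
    properSubterms (fn f ts)  = subterms* ts
    properSubterms (len a)    = subterms a
    properSubterms (diff a b) = subterms a ++ subterms b
    properSubterms (wr a i e) = subterms a ++ subterms i ++ subterms e
    properSubterms (rd a i)   = subterms a ++ subterms i
    properSubterms bot        = []
    properSubterms el         = []

    subterms* : ∀ {s n} → Vec (Term s) n → List (∃ Term)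
    subterms* []       = []
    subterms* (t ∷ ts) = subterms t ++ subterms* ts

  -- For a = b, also diff(a,b), which occurs in the replacement of a = b.
  subtermsᵃ : CardAtom → List (∃ Term)
  subtermsᵃ (index α)    = concatMap subterms (termsᴬ α)
  subtermsᵃ (array≐ a b) = subterms (diff a b)
  subtermsᵃ (elem≐ d e)  = subterms d ++ subterms e

  addLength : ∃ Term → List (∃ Term)
  addLength (ARRAY , a) = (ARRAY , a) ∷ (INDEX , len a) ∷ []
  addLength t           = [ t ]

  -- The terms to be named, including |a| for every array term a.
  terms : Formula → List (∃ Term)
  terms X = concatMap addLength (concatMap subtermsᵃ (atoms X))

  cstᴵ : Term INDEX → ICst
  cstᴵ (con c) = con c
  cstᴵ t       = name ⌜ t ⌝

  cstᴱ : Term ELEM → ECst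
  cstᴱ bot = bot
  cstᴱ el  = el
  cstᴱ t   = name ⌜ t ⌝

  -- The equation by which ⌜ t ⌝ names t, whose arguments are flattened.
  naming : ∃ Term → SepPair
  naming (INDEX , fn f ts)  = [] ∣ [ atom (index (var ⌜ fn f ts ⌝ ≐ fn f (Vec.map (λ t → ⟨ cstᴵ t ⟩) ts))) ]
  naming (INDEX , len a)    = [ len≡ ⌜ a ⌝ (name ⌜ len a ⌝) ] ∣ []
  naming (INDEX , diff a b) = [ diff≡ 0 ⌜ a ⌝ ⌜ b ⌝ (name ⌜ diff a b ⌝) ] ∣ []
  naming (ARRAY , wr b i e) = [ wr≡ ⌜ wr b i e ⌝ ⌜ b ⌝ (cstᴵ i) (cstᴱ e) ] ∣ []
  naming (ELEM  , rd a i)   = [] ∣ [ ⌜ a ⌝ ‼ cstᴵ i ≡ᴱ var ⌜ rd a i ⌝ ]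
  naming _                  = [] ∣ []

  flattenᵃ : CardAtom → EUFFormula
  flattenᵃ (index α)    = atom (index (mapᴬ (λ t → ⟨ cstᴵ t ⟩) α))
  flattenᵃ (array≐ a b) = name ⌜ diff a b ⌝ ≡ᴵ 𝟘 ∧̇ ⌜ a ⌝ ‼ 𝟘 ≡ᴱ ⌜ b ⌝ ‼ 𝟘
  flattenᵃ (elem≐ d e)  = ⟨ cstᴱ d ⟩ᴱ ≡ᴱ ⟨ cstᴱ e ⟩ᴱ

  flatten : Formula → EUFFormula
  flatten = bind flattenᵃ

  -- The side of X in the preprocessing of the pair X, Y (in either order):
  -- the terms of Y that are X-local are common, so their equations are
  -- added to both sides.
  preprocess : (X Y : Formula) → SepPair
  preprocess X Y =
    ([] ∣ [ flatten X ]) ∪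
    ⋃ (map naming (terms X ++ filter (λ t → local? X (proj₂ t)) (terms Y)))

  writeIndex : Atom₁ → Maybe ICst
  writeIndex (wr≡ _ _ i _) = just i
  writeIndex _             = nothing

  writeIndices : SepPair → List ICst
  writeIndices Φ = mapMaybe writeIndex (Φ₁ Φ)

  writeCount : (X Y : Formula) → ℕ
  writeCount X Y = length (deduplicate _≟ᴵ_ (filter (λ i → local? X (termᴵ i)) (writeIndices (preprocess X Y))))

  module _ (A⁰ B⁰ : Formula) where

    N : ℕ
    N = suc (writeCount A⁰ B⁰ ⊔ writeCount B⁰ A⁰)

    commonArrays : List (Name ARRAY)
    commonArrays = filter (λ c → local? A⁰ (term c) ×-dec local? B⁰ (term c))
      (arrayConstants (preprocess A⁰ B⁰ ∪ preprocess B⁰ A⁰))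

    distinctPairs : List (Name ARRAY × Name ARRAY)
    distinctPairs = filter (λ (c₁ , c₂) → ¬? (c₁ ≟ᴺ c₂)) (cartesianProduct commonArrays commonArrays)

    iteratedDiffs : SepPair
    iteratedDiffs =
      concatMap (λ (c₁ , c₂) → map (λ n → diff≡ n c₁ c₂ (name (diffₖ n c₁ c₂))) (upTo N)) distinctPairs ∣ []

    step1A step1B : SepPair
    step1A = preprocess A⁰ B⁰ ∪ iteratedDiffs
    step1B = preprocess B⁰ A⁰ ∪ iteratedDiffs

    𝓘 : Formula → List ICst
    𝓘 X = 𝟘 ∷ filter (λ i → local? X (termᴵ i)) (indexConstants (step1A ∪ step1B))

    step2A step2B : SepPair
    step2A = instantiate (𝓘 A⁰) step1A
    step2B = instantiate (𝓘 B⁰) step1B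

    A₂ B₂ : EUFFormula
    A₂ = ⋀ (Φ₂ step2A)
    B₂ = ⋀ (Φ₂ step2B)

  mutual
    readTm : Tm (Name INDEX) → Term INDEX
    readTm (var x)   = term x
    readTm (con c)   = con c
    readTm (fn f ts) = fn f (readTm* ts)

    readTm* : ∀ {n} → Vec (Tm (Name INDEX)) n → Vec (Term INDEX) n
    readTm* []       = []
    readTm* (t ∷ ts) = readTm t ∷ readTm* ts

  readETm : ETm → Term ELEM
  readETm (var x) = term x
  readETm bot     = bot
  readETm el      = el
  readETm (a · t) = rd (term a) (readTm t)

  readAtom : EUFAtom → CardAtom
  readAtom (index α) = index (mapᴬ readTm α)
  readAtom (d ≐ᴱ e)  = elem≐ (readETm d) (readETm e)

  readBack : EUFFormula → Formula
  readBack = bind (λ α → atom (readAtom α))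

  -- θ is the interpolation algorithm used as a black box.
  cardInterpolant : (θ : EUFFormula → EUFFormula → EUFFormula) → Formula → Formula → Formula
  cardInterpolant θ A⁰ B⁰ = readBack (θ (A₂ A⁰ B⁰) (B₂ A⁰ B⁰))

module CARD (T : IndexTheory) where
  open IndexTheory T using (theory; signature)
  open CardSyntax signature public using (Formula)
  open Card theory public using (Unsatisfiable; IsInterpolant)
  open Separated signature using (Name)
  open EUF theory Name public using (Unsatisfiableᴱ; InterpolationAlgorithm)
  open Algorithm signature public using (A₂; B₂; cardInterpolant)

{-# OPTIONS --safe #-}
module Submission where

-- The interpolant conditions are routine: every formula added in Steps 1 and 2
-- holds in all models of CARD(T_I) once its constants are read back, and it
-- mentions local symbols only.  The point is that A₂ ∧ B₂ is unsatisfiable.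
-- From a model M of A₂ ∧ B₂ one builds a model of A⁰ ∧ B⁰ with the same indices
-- and elements, whose arrays are the functions that equal el at all but finitely
-- many indices of their range (so that maximal differences exist).  At an index
-- covered by one side, M prescribes the values of the arrays named on that side.
-- At an index h that a side does not cover, the constraints of that side only
-- force some arrays to agree at h: a and wr(a,i,e), and a and b when
-- diff(a,b) < h.  Such equalities could clash only if two common arrays c₁, c₂,
-- linked by them on side A, were prescribed different values at h by side B.
-- Then h lies below all diff_n(c₁,c₂), n = 1,…,N.  These are N distinct indices
-- covered by A at which c₁ and c₂ differ, but arrays that are linked at h can
-- differ above h only at the fewer than N write indices of A.

-- The counting needs care with lengths. Only arrays of equal length have distinct iterated
-- differences, because otherwise a write may be refused and the sequence stalls; for unequal
-- lengths it is in fact constant and equal to the greater length. Links at `h` do permit unequal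
-- lengths, but only if both lie below `h`, and then `h` cannot lie below the iterated differences.
-- Why the differences lie above `h` at all: the side that covers `h` has an instance of its
-- constraints at `h`, and the common constants for the differences are covered by the other side,
-- so none of them can be `h`. A clash is conceivable only where exactly one side covers the index.
-- Where both do, there are no links; where neither does, nothing is prescribed, and each array
-- takes the value el or bottom according to its range, which links preserve. Arbitrary functions
-- would not do as arrays: the order of the indices need not have greatest elements of subsets,
-- whereas finite deviation reduces the search for a difference to a finite list.

open import Defs
open import Axiom.ExcludedMiddle using (ExcludedMiddle)
open import Data.Fin.Base using (Fin; toℕ)
import Data.Fin.Properties as Fin
open import Data.List.Base using (List; []; _∷_; [_]; _++_; map; concatMap; mapMaybe; filter; deduplicate; length; lookup; upTo; cartesianProduct)
open import Data.List.Membership.Propositional using (_∈_; find; lose)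
open import Data.List.Membership.Propositional.Properties
import Data.List.Properties as List
open import Data.List.Relation.Unary.All as All using (All; []; _∷_)
import Data.List.Relation.Unary.All.Properties as All
open import Data.List.Relation.Unary.Any as Any using (Any; here; there)
import Data.List.Relation.Unary.Any.Properties as Any
open import Data.Maybe.Base using (Maybe; just; nothing)
open import Data.Nat.Base as ℕ using (ℕ; zero; suc; z≤n; s≤s; _⊔_)
import Data.Nat.Properties as ℕ
open import Data.Product.Base using (∃; ∃₂; _×_; _,_; proj₁; proj₂)
open import Data.Sum.Base as Sum using (_⊎_; inj₁; inj₂; [_,_]′)
open import Data.Unit.Base using (⊤; tt)
open import Data.Vec.Base as Vec using (Vec; []; _∷_; _∷ʳ_)
import Data.Vec.Membership.Propositional as Vec
open import Data.Vec.Relation.Binary.Pointwise.Inductive using (Pointwise; []; _∷_)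
import Data.Vec.Relation.Unary.Any as VecAny
open import Function.Base using (_∘_; id)
open import Function.Bundles using (_⇔_; mk⇔; Equivalence)
open import Level using (0ℓ)
open import Relation.Binary.Bundles using (Setoid)
open import Relation.Binary.Construct.Closure.Equivalence as EqC using (EqClosure)
import Relation.Binary.Construct.NonStrictToStrict as ToStrict
open import Relation.Binary.PropositionalEquality as ≡ using (_≡_; refl; sym; cong; cong₂; subst)
open import Relation.Binary.Structures using (IsEquivalence; IsTotalOrder)
open import Relation.Nullary using (¬_; Dec; yes; no; contradiction; ¬?; _×-dec_)
open import Relation.Nullary.Decidable using (decidable-stable)

open Equivalence using (to; from)

-- Formulae and lists

module _ {A B : Set} where

  ∈-concatMap⁺′ : (f : A → List B) {x : A} {xs : List A} {y : B} → x ∈ xs → y ∈ f x → y ∈ concatMap f xs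
  ∈-concatMap⁺′ f x∈xs y∈fx = ∈-concatMap⁺ f (lose x∈xs y∈fx)

  ∈-concatMap⁻′ : (f : A → List B) (xs : List A) {y : B} → y ∈ concatMap f xs → ∃ λ x → x ∈ xs × y ∈ f x
  ∈-concatMap⁻′ f xs p = find (∈-concatMap⁻ f {xs = xs} p)

  ∈-mapMaybe⁺ : (f : A → Maybe B) {x : A} {xs : List A} {y : B} → x ∈ xs → f x ≡ just y → y ∈ mapMaybe f xs
  ∈-mapMaybe⁺ f {xs = x ∷ xs} (here refl) eq with f x
  ∈-mapMaybe⁺ f {xs = x ∷ xs} (here refl) refl | just _ = here refl
  ∈-mapMaybe⁺ f {xs = x ∷ xs} (there p) eq with f x
  ... | just _  = there (∈-mapMaybe⁺ f p eq)
  ... | nothing = ∈-mapMaybe⁺ f p eq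

  ∈-mapMaybe⁻ : (f : A → Maybe B) (xs : List A) {y : B} → y ∈ mapMaybe f xs → ∃ λ x → x ∈ xs × f x ≡ just y
  ∈-mapMaybe⁻ f (x ∷ xs) p with f x in eq
  ... | nothing with y , y∈xs , q ← ∈-mapMaybe⁻ f xs p = y , there y∈xs , q
  ∈-mapMaybe⁻ f (x ∷ xs) (here refl) | just _ = x , here refl , eq
  ∈-mapMaybe⁻ f (x ∷ xs) (there p)   | just _ with y , y∈xs , q ← ∈-mapMaybe⁻ f xs p = y , there y∈xs , q

module _ {A : Set} {V : A → Set} where

  ⋀⁺ : {φs : List (QF A)} → All (Holds V) φs → Holds V (⋀ φs)
  ⋀⁺ []       = id
  ⋀⁺ (p ∷ ps) = p , ⋀⁺ ps

  ⋀⁻ : (φs : List (QF A)) → Holds V (⋀ φs) → All (Holds V) φs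
  ⋀⁻ []       _        = []
  ⋀⁻ (φ ∷ φs) (p , ps) = p ∷ ⋀⁻ φs ps

  ⋀-map⁺ : {B : Set} (f : B → QF A) (xs : List B) → All (λ x → Holds V (f x)) xs → Holds V (⋀ (map f xs))
  ⋀-map⁺ f xs = ⋀⁺ ∘ All.map⁺

  ⋁⁺ : {φs : List (QF A)} → Any (Holds V) φs → Holds V (⋁ φs)
  ⋁⁺ (here p)  = inj₁ p
  ⋁⁺ (there p) = inj₂ (⋁⁺ p)

  ⋁⁻ : (φs : List (QF A)) → Holds V (⋁ φs) → Any (Holds V) φs
  ⋁⁻ (φ ∷ φs) (inj₁ p) = here p
  ⋁⁻ (φ ∷ φs) (inj₂ p) = there (⋁⁻ φs p)

-- An equivalence at the atoms is required because the premise of `⇒̇` is passed in the opposite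
-- direction. It is asked for atoms of `φ` only, since the glued model provides it only there.
Holds-bind : {A B : Set} {V : A → Set} {W : B → Set} (f : A → QF B) (φ : QF A) →
  (∀ {a} → a ∈ atoms φ → V a ⇔ Holds W (f a)) → Holds V φ ⇔ Holds W (bind f φ)
Holds-bind f (atom a) eq = eq (here refl)
Holds-bind f ⊥̇        eq = mk⇔ id id
Holds-bind f (φ ∧̇ ψ)  eq
  with l ← Holds-bind f φ (eq ∘ ∈-++⁺ˡ) | r ← Holds-bind f ψ (eq ∘ ∈-++⁺ʳ (atoms φ)) =
  mk⇔ (λ (p , q) → to l p , to r q) (λ (p , q) → from l p , from r q)
Holds-bind f (φ ∨̇ ψ)  eq
  with l ← Holds-bind f φ (eq ∘ ∈-++⁺ˡ) | r ← Holds-bind f ψ (eq ∘ ∈-++⁺ʳ (atoms φ)) =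
  mk⇔ [ inj₁ ∘ to l , inj₂ ∘ to r ]′ [ inj₁ ∘ from l , inj₂ ∘ from r ]′
Holds-bind f (φ ⇒̇ ψ)  eq
  with l ← Holds-bind f φ (eq ∘ ∈-++⁺ˡ) | r ← Holds-bind f ψ (eq ∘ ∈-++⁺ʳ (atoms φ)) =
  mk⇔ (λ p → to r ∘ p ∘ from l) (λ p → from r ∘ p ∘ to l)

-- Recursive on the formula, unlike `All P (atoms φ)`: for a concrete instance it unfolds to nested
-- pairs, so locality is proved by a tuple of the same shape.
EveryAtom : {A : Set} → (A → Set) → QF A → Set
EveryAtom P (atom a) = P a
EveryAtom P ⊥̇        = ⊤
EveryAtom P (φ ∧̇ ψ)  = EveryAtom P φ × EveryAtom P ψ
EveryAtom P (φ ∨̇ ψ)  = EveryAtom P φ × EveryAtom P ψ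
EveryAtom P (φ ⇒̇ ψ)  = EveryAtom P φ × EveryAtom P ψ

module _ {A : Set} {P : A → Set} where

  EveryAtom⁺ : (φ : QF A) → (∀ {a} → a ∈ atoms φ → P a) → EveryAtom P φ
  EveryAtom⁺ (atom a) p = p (here refl)
  EveryAtom⁺ ⊥̇        p = tt
  EveryAtom⁺ (φ ∧̇ ψ)  p = EveryAtom⁺ φ (p ∘ ∈-++⁺ˡ) , EveryAtom⁺ ψ (p ∘ ∈-++⁺ʳ (atoms φ))
  EveryAtom⁺ (φ ∨̇ ψ)  p = EveryAtom⁺ φ (p ∘ ∈-++⁺ˡ) , EveryAtom⁺ ψ (p ∘ ∈-++⁺ʳ (atoms φ))
  EveryAtom⁺ (φ ⇒̇ ψ)  p = EveryAtom⁺ φ (p ∘ ∈-++⁺ˡ) , EveryAtom⁺ ψ (p ∘ ∈-++⁺ʳ (atoms φ))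

  EveryAtom⁻ : (φ : QF A) → EveryAtom P φ → All P (atoms φ)
  EveryAtom⁻ (atom a) p       = p ∷ []
  EveryAtom⁻ ⊥̇        p       = []
  EveryAtom⁻ (φ ∧̇ ψ)  (p , q) = All.++⁺ (EveryAtom⁻ φ p) (EveryAtom⁻ ψ q)
  EveryAtom⁻ (φ ∨̇ ψ)  (p , q) = All.++⁺ (EveryAtom⁻ φ p) (EveryAtom⁻ ψ q)
  EveryAtom⁻ (φ ⇒̇ ψ)  (p , q) = All.++⁺ (EveryAtom⁻ φ p) (EveryAtom⁻ ψ q)

  ⋀-EveryAtom : {φs : List (QF A)} → All (EveryAtom P) φs → EveryAtom P (⋀ φs)
  ⋀-EveryAtom []       = tt , tt
  ⋀-EveryAtom (p ∷ ps) = p , ⋀-EveryAtom ps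

  ⋁-EveryAtom : {φs : List (QF A)} → All (EveryAtom P) φs → EveryAtom P (⋁ φs)
  ⋁-EveryAtom []       = tt
  ⋁-EveryAtom (p ∷ ps) = p , ⋁-EveryAtom ps

bind-EveryAtom : {A B : Set} {P : A → Set} {Q : B → Set} {f : A → QF B} (φ : QF A) →
  (∀ {a} → P a → EveryAtom Q (f a)) → EveryAtom P φ → EveryAtom Q (bind f φ)
bind-EveryAtom (atom a) imp p       = imp p
bind-EveryAtom ⊥̇        imp p       = tt
bind-EveryAtom (φ ∧̇ ψ)  imp (p , q) = bind-EveryAtom φ imp p , bind-EveryAtom ψ imp q
bind-EveryAtom (φ ∨̇ ψ)  imp (p , q) = bind-EveryAtom φ imp p , bind-EveryAtom ψ imp q
bind-EveryAtom (φ ⇒̇ ψ)  imp (p , q) = bind-EveryAtom φ imp p , bind-EveryAtom ψ imp q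

module _ {S : Signature} (M : Structure S) where
  open Structure M renaming (refl to ≈-refl; sym to ≈-sym; trans to ≈-trans)
  open Syntax S

  Holdsᴬ-map : {A B : Set} {ev : A → Carrier} {ev′ : B → Carrier} (g : A → B) (α : IAtom A) →
    (∀ {t} → t ∈ termsᴬ α → ev t ≈ ev′ (g t)) → Holdsᴬ ev α ⇔ Holdsᴬ ev′ (mapᴬ g α)
  Holdsᴬ-map g (s ≐ t) eq with p ← eq (here refl) | q ← eq (there (here refl)) =
    mk⇔ (λ r → ≈-trans (≈-sym p) (≈-trans r q)) (λ r → ≈-trans p (≈-trans r (≈-sym q)))
  Holdsᴬ-map g (s ≼ t) eq with p ← eq (here refl) | q ← eq (there (here refl)) =
    mk⇔ (≤-resp p q) (≤-resp (≈-sym p) (≈-sym q))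
  Holdsᴬ-map {A} {B} {ev} {ev′} g (rel R ts) eq =
    mk⇔ (rel-resp R (pw ts eq)) (rel-resp R (pw˘ ts eq))
    where
    pw : ∀ {n} (ts : Vec A n) → (∀ {t} → t ∈ Vec.toList ts → ev t ≈ ev′ (g t)) →
      Pointwise _≈_ (Vec.map ev ts) (Vec.map ev′ (Vec.map g ts))
    pw []       eq = []
    pw (t ∷ ts) eq = eq (here refl) ∷ pw ts (eq ∘ there)

    pw˘ : ∀ {n} (ts : Vec A n) → (∀ {t} → t ∈ Vec.toList ts → ev t ≈ ev′ (g t)) →
      Pointwise _≈_ (Vec.map ev′ (Vec.map g ts)) (Vec.map ev ts)
    pw˘ []       eq = []
    pw˘ (t ∷ ts) eq = ≈-sym (eq (here refl)) ∷ pw˘ ts (eq ∘ there)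

module _ (S : Signature) where
  open Syntax S

  termsᴬ-map : {A B : Set} (g : A → B) (α : IAtom A) {u : B} →
    u ∈ termsᴬ (mapᴬ g α) → ∃ λ t → t ∈ termsᴬ α × u ≡ g t
  termsᴬ-map g (s ≐ t) (here refl)         = s , here refl , refl
  termsᴬ-map g (s ≐ t) (there (here refl)) = t , there (here refl) , refl
  termsᴬ-map g (s ≼ t) (here refl)         = s , here refl , refl
  termsᴬ-map g (s ≼ t) (there (here refl)) = t , there (here refl) , refl
  termsᴬ-map {A} {B} g (rel R ts) p = go ts p
    where
    go : ∀ {n} (ts : Vec A n) {u : B} → u ∈ Vec.toList (Vec.map g ts) → ∃ λ t → t ∈ Vec.toList ts × u ≡ g t
    go (t ∷ ts) (here refl) = t , here refl , refl
    go (t ∷ ts) (there q) with u , u∈ , eq ← go ts q = u , there u∈ , eq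

-- Named terms and their closure under subterms

module Naming (S : Signature) where
  open Signature S
  open Syntax S
  open CardSyntax S
  open Separated S
  open Algorithm S

  infix 4 _◁_

  data _◁_ : ∃ Term → ∃ Term → Set where
    fn-arg     : ∀ {f ts t} → t Vec.∈ ts → (INDEX , t) ◁ (INDEX , fn f ts)
    len-array  : ∀ {a} → (ARRAY , a) ◁ (INDEX , len a)
    diff-left  : ∀ {a b} → (ARRAY , a) ◁ (INDEX , diff a b)
    diff-right : ∀ {a b} → (ARRAY , b) ◁ (INDEX , diff a b)
    wr-array   : ∀ {b i e} → (ARRAY , b) ◁ (ARRAY , wr b i e)
    wr-index   : ∀ {b i e} → (INDEX , i) ◁ (ARRAY , wr b i e)
    wr-value   : ∀ {b i e} → (ELEM , e) ◁ (ARRAY , wr b i e)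
    rd-array   : ∀ {a i} → (ARRAY , a) ◁ (ELEM , rd a i)
    rd-index   : ∀ {a i} → (INDEX , i) ◁ (ELEM , rd a i)

  ∈-subterms* : ∀ {s n} {t : Term s} {ts : Vec (Term s) n} → t Vec.∈ ts → (s , t) ∈ subterms* ts
  ∈-subterms* (VecAny.here refl) = here refl
  ∈-subterms* {ts = t ∷ ts} (VecAny.there p) = ∈-++⁺ʳ (subterms t) (∈-subterms* p)

  ◁⇒proper : ∀ {s} {t : Term s} {c} → c ◁ (s , t) → c ∈ properSubterms t
  ◁⇒proper (fn-arg p)            = ∈-subterms* p
  ◁⇒proper len-array             = here refl
  ◁⇒proper diff-left             = here refl
  ◁⇒proper (diff-right {a})      = ∈-++⁺ʳ (subterms a) (here refl)
  ◁⇒proper wr-array              = here refl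
  ◁⇒proper (wr-index {b})        = ∈-++⁺ʳ (subterms b) (here refl)
  ◁⇒proper (wr-value {b} {i})    = ∈-++⁺ʳ (subterms b) (∈-++⁺ʳ (subterms i) (here refl))
  ◁⇒proper rd-array              = here refl
  ◁⇒proper (rd-index {a})        = ∈-++⁺ʳ (subterms a) (here refl)

  mutual
    subterms-closed : ∀ {s} (u : Term s) {c t} → c ◁ t → t ∈ subterms u → c ∈ subterms u
    subterms-closed u          c◁t (here refl) = there (◁⇒proper c◁t)
    subterms-closed (fn f ts)  c◁t (there p) = there (subterms*-closed ts c◁t p)
    subterms-closed (len a)    c◁t (there p) = there (subterms-closed a c◁t p)
    subterms-closed (diff a b) c◁t (there p) with ∈-++⁻ (subterms a) p
    ... | inj₁ q = there (∈-++⁺ˡ (subterms-closed a c◁t q))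
    ... | inj₂ q = there (∈-++⁺ʳ (subterms a) (subterms-closed b c◁t q))
    subterms-closed (wr b i e) c◁t (there p) with ∈-++⁻ (subterms b) p
    ... | inj₁ q = there (∈-++⁺ˡ (subterms-closed b c◁t q))
    ... | inj₂ q with ∈-++⁻ (subterms i) q
    ...   | inj₁ r = there (∈-++⁺ʳ (subterms b) (∈-++⁺ˡ (subterms-closed i c◁t r)))
    ...   | inj₂ r = there (∈-++⁺ʳ (subterms b) (∈-++⁺ʳ (subterms i) (subterms-closed e c◁t r)))
    subterms-closed (rd a i)   c◁t (there p) with ∈-++⁻ (subterms a) p
    ... | inj₁ q = there (∈-++⁺ˡ (subterms-closed a c◁t q))
    ... | inj₂ q = there (∈-++⁺ʳ (subterms a) (subterms-closed i c◁t q))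

    subterms*-closed : ∀ {s n} (us : Vec (Term s) n) {c t} → c ◁ t → t ∈ subterms* us → c ∈ subterms* us
    subterms*-closed (u ∷ us) c◁t p with ∈-++⁻ (subterms u) p
    ... | inj₁ q = ∈-++⁺ˡ (subterms-closed u c◁t q)
    ... | inj₂ q = ∈-++⁺ʳ (subterms u) (subterms*-closed us c◁t q)

  module _ {X : Formula} where

    Local* : ∀ {s n} → Vec (Term s) n → Set
    Local* ts = All (_∈ vars X) (varsᵗ* ts)

    Local*-lookup : ∀ {s n} {t : Term s} {ts : Vec (Term s) n} → t Vec.∈ ts → Local* ts → Local X t
    Local*-lookup {ts = t ∷ ts} (VecAny.here refl) l = All.++⁻ˡ (varsᵗ t) l
    Local*-lookup {ts = t ∷ ts} (VecAny.there p)   l = Local*-lookup p (All.++⁻ʳ (varsᵗ t) l)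

    ◁-local : ∀ {c t} → c ◁ t → Local X (proj₂ t) → Local X (proj₂ c)
    ◁-local (fn-arg p)         l = Local*-lookup p l
    ◁-local len-array          l = l
    ◁-local (diff-left {a})    l = All.++⁻ˡ (varsᵗ a) l
    ◁-local (diff-right {a})   l = All.++⁻ʳ (varsᵗ a) l
    ◁-local (wr-array {b})     l = All.++⁻ˡ (varsᵗ b) l
    ◁-local (wr-index {b} {i}) l = All.++⁻ˡ (varsᵗ i) (All.++⁻ʳ (varsᵗ b) l)
    ◁-local (wr-value {b} {i}) l = All.++⁻ʳ (varsᵗ i) (All.++⁻ʳ (varsᵗ b) l)
    ◁-local (rd-array {a})     l = All.++⁻ˡ (varsᵗ a) l
    ◁-local (rd-index {a})     l = All.++⁻ʳ (varsᵗ a) l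

    mutual
      subterms-local : ∀ {s} (u : Term s) {t} → Local X u → t ∈ subterms u → Local X (proj₂ t)
      subterms-local u          l (here refl) = l
      subterms-local (fn f ts)  l (there p) = subterms*-local ts l p
      subterms-local (len a)    l (there p) = subterms-local a l p
      subterms-local (diff a b) l (there p) with ∈-++⁻ (subterms a) p
      ... | inj₁ q = subterms-local a (All.++⁻ˡ (varsᵗ a) l) q
      ... | inj₂ q = subterms-local b (All.++⁻ʳ (varsᵗ a) l) q
      subterms-local (wr b i e) l (there p) with ∈-++⁻ (subterms b) p
      ... | inj₁ q = subterms-local b (All.++⁻ˡ (varsᵗ b) l) q
      ... | inj₂ q with ∈-++⁻ (subterms i) q
      ...   | inj₁ r = subterms-local i (All.++⁻ˡ (varsᵗ i) (All.++⁻ʳ (varsᵗ b) l)) r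
      ...   | inj₂ r = subterms-local e (All.++⁻ʳ (varsᵗ i) (All.++⁻ʳ (varsᵗ b) l)) r
      subterms-local (rd a i)   l (there p) with ∈-++⁻ (subterms a) p
      ... | inj₁ q = subterms-local a (All.++⁻ˡ (varsᵗ a) l) q
      ... | inj₂ q = subterms-local i (All.++⁻ʳ (varsᵗ a) l) q

      subterms*-local : ∀ {s n} (us : Vec (Term s) n) {t} → Local* us → t ∈ subterms* us → Local X (proj₂ t)
      subterms*-local (u ∷ us) l p with ∈-++⁻ (subterms u) p
      ... | inj₁ q = subterms-local u (All.++⁻ˡ (varsᵗ u) l) q
      ... | inj₂ q = subterms*-local us (All.++⁻ʳ (varsᵗ u) l) q

    atom-vars : ∀ {α} → α ∈ atoms X → All (_∈ vars X) (varsᵃ α)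
    atom-vars α∈X = All.tabulate (∈-concatMap⁺′ varsᵃ α∈X)

    subtermsᵃ-local : ∀ {α t} → α ∈ atoms X → t ∈ subtermsᵃ α → Local X (proj₂ t)
    subtermsᵃ-local {index α} α∈X t∈α with u , u∈α , t∈u ← ∈-concatMap⁻′ subterms (termsᴬ α) t∈α =
      subterms-local u (All.tabulate (λ v∈u → All.lookup (atom-vars α∈X) (∈-concatMap⁺′ varsᵗ u∈α v∈u))) t∈u
    subtermsᵃ-local {array≐ a b} α∈X t∈α = subterms-local (diff a b) (atom-vars α∈X) t∈α
    subtermsᵃ-local {elem≐ d e} α∈X t∈α with ∈-++⁻ (subterms d) t∈α
    ... | inj₁ p = subterms-local d (All.++⁻ˡ (varsᵗ d) (atom-vars α∈X)) p
    ... | inj₂ p = subterms-local e (All.++⁻ʳ (varsᵗ d) (atom-vars α∈X)) p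

  subtermsᵃ-closed : ∀ α {c t} → c ◁ t → t ∈ subtermsᵃ α → c ∈ subtermsᵃ α
  subtermsᵃ-closed (index α) c◁t t∈α with u , u∈α , t∈u ← ∈-concatMap⁻′ subterms (termsᴬ α) t∈α =
    ∈-concatMap⁺′ subterms u∈α (subterms-closed u c◁t t∈u)
  subtermsᵃ-closed (array≐ a b) c◁t t∈α = subterms-closed (diff a b) c◁t t∈α
  subtermsᵃ-closed (elem≐ d e) c◁t t∈α with ∈-++⁻ (subterms d) t∈α
  ... | inj₁ p = ∈-++⁺ˡ (subterms-closed d c◁t p)
  ... | inj₂ p = ∈-++⁺ʳ (subterms d) (subterms-closed e c◁t p)

  addLength-self : ∀ t → t ∈ addLength t
  addLength-self (INDEX , _) = here refl
  addLength-self (ARRAY , _) = here refl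
  addLength-self (ELEM  , _) = here refl

  addLength⁻ : ∀ {u t} → t ∈ addLength u → t ≡ u ⊎ (∃ λ a → u ≡ (ARRAY , a) × t ≡ (INDEX , len a))
  addLength⁻ {INDEX , _} (here eq)         = inj₁ eq
  addLength⁻ {ARRAY , a} (here eq)         = inj₁ eq
  addLength⁻ {ARRAY , a} (there (here eq)) = inj₂ (a , refl , eq)
  addLength⁻ {ELEM  , _} (here eq)         = inj₁ eq

  ∈-terms : ∀ X {α t} → α ∈ atoms X → t ∈ subtermsᵃ α → t ∈ terms X
  ∈-terms X α∈X t∈α = ∈-concatMap⁺′ addLength (∈-concatMap⁺′ subtermsᵃ α∈X t∈α) (addLength-self _)

  ∈-terms⁻ : ∀ X {t} → t ∈ terms X → ∃ λ α → α ∈ atoms X ×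
    (t ∈ subtermsᵃ α ⊎ (∃ λ a → (ARRAY , a) ∈ subtermsᵃ α × t ≡ (INDEX , len a)))
  ∈-terms⁻ X t∈X with u , u∈X , t∈u ← ∈-concatMap⁻′ addLength (concatMap subtermsᵃ (atoms X)) t∈X | addLength⁻ t∈u
  ... | inj₁ refl with α , α∈X , p ← ∈-concatMap⁻′ subtermsᵃ (atoms X) u∈X = α , α∈X , inj₁ p
  ... | inj₂ (a , refl , eq) with α , α∈X , p ← ∈-concatMap⁻′ subtermsᵃ (atoms X) u∈X = α , α∈X , inj₂ (a , p , eq)

  -- The added terms `len a` spoil nothing: the only immediate subterm `a` was there before.
  terms-closed : ∀ X {c t} → c ◁ t → t ∈ terms X → c ∈ terms X
  terms-closed X c◁t t∈X with ∈-terms⁻ X t∈X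
  ... | α , α∈X , inj₁ p = ∈-terms X α∈X (subtermsᵃ-closed α c◁t p)
  terms-closed X len-array t∈X | α , α∈X , inj₂ (a , p , refl) = ∈-terms X α∈X p

  terms-len : ∀ X {a} → (ARRAY , a) ∈ terms X → (INDEX , len a) ∈ terms X
  terms-len X a∈X with ∈-terms⁻ X a∈X
  ... | α , α∈X , inj₁ p = ∈-concatMap⁺′ addLength (∈-concatMap⁺′ subtermsᵃ α∈X p) (there (here refl))

  terms-local : ∀ X {t} → t ∈ terms X → Local X (proj₂ t)
  terms-local X t∈X with ∈-terms⁻ X t∈X
  ... | α , α∈X , inj₁ p              = subtermsᵃ-local {X} {α} α∈X p
  ... | α , α∈X , inj₂ (a , p , refl) = subtermsᵃ-local {X} {α} α∈X p

  index-terms : ∀ X {α t} → index α ∈ atoms X → t ∈ termsᴬ α → (INDEX , t) ∈ terms X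
  index-terms X α∈X t∈α = ∈-terms X α∈X (∈-concatMap⁺′ subterms t∈α (here refl))

  array-terms : ∀ X {a b} → array≐ a b ∈ atoms X → (INDEX , diff a b) ∈ terms X
  array-terms X α∈X = ∈-terms X α∈X (here refl)

  elem-terms : ∀ X {d e} → elem≐ d e ∈ atoms X → (ELEM , d) ∈ terms X × (ELEM , e) ∈ terms X
  elem-terms X {d} α∈X = ∈-terms X α∈X (here refl) , ∈-terms X α∈X (∈-++⁺ʳ (subterms d) (here refl))

  -- This is the list over which `preprocess X Y` maps `naming`, so that membership in it yields the
  -- naming equation, if there is one, on the side of `X`.
  namedTerms : (X Y : Formula) → List (∃ Term)
  namedTerms X Y = terms X ++ filter (λ t → local? X (proj₂ t)) (terms Y)

  named-local : ∀ X Y {t} → t ∈ namedTerms X Y → Local X (proj₂ t)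
  named-local X Y t∈ with ∈-++⁻ (terms X) t∈
  ... | inj₁ p = terms-local X p
  ... | inj₂ p = proj₂ (∈-filter⁻ (λ t → local? X (proj₂ t)) {xs = terms Y} p)

  -- The part filtered from `Y` is closed too, since immediate subterms of `X`-local terms are
  -- `X`-local. The evaluation of terms in the glued model recurses along this closure.
  named-closed : ∀ X Y {c t} → c ◁ t → t ∈ namedTerms X Y → c ∈ namedTerms X Y
  named-closed X Y c◁t t∈ with ∈-++⁻ (terms X) t∈
  ... | inj₁ p = ∈-++⁺ˡ (terms-closed X c◁t p)
  ... | inj₂ p with q , l ← ∈-filter⁻ (λ t → local? X (proj₂ t)) {xs = terms Y} p =
    ∈-++⁺ʳ (terms X) (∈-filter⁺ (λ t → local? X (proj₂ t)) (terms-closed Y c◁t q) (◁-local {X} c◁t l))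

  named-len : ∀ X Y {a} → (ARRAY , a) ∈ namedTerms X Y → (INDEX , len a) ∈ namedTerms X Y
  named-len X Y t∈ with ∈-++⁻ (terms X) t∈
  ... | inj₁ p = ∈-++⁺ˡ (terms-len X p)
  ... | inj₂ p with q , l ← ∈-filter⁻ (λ t → local? X (proj₂ t)) {xs = terms Y} p =
    ∈-++⁺ʳ (terms X) (∈-filter⁺ (λ t → local? X (proj₂ t)) (terms-len Y q) l)

  module _ (f : ∃ Term → SepPair) where

    Φ₁-⋃⁺ : ∀ {t ts α} → t ∈ ts → α ∈ Φ₁ (f t) → α ∈ Φ₁ (⋃ (map f ts))
    Φ₁-⋃⁺ (here refl) α∈ = ∈-++⁺ˡ α∈
    Φ₁-⋃⁺ {ts = u ∷ ts} (there p) α∈ = ∈-++⁺ʳ (Φ₁ (f u)) (Φ₁-⋃⁺ p α∈)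

    Φ₂-⋃⁺ : ∀ {t ts φ} → t ∈ ts → φ ∈ Φ₂ (f t) → φ ∈ Φ₂ (⋃ (map f ts))
    Φ₂-⋃⁺ (here refl) φ∈ = ∈-++⁺ˡ φ∈
    Φ₂-⋃⁺ {ts = u ∷ ts} (there p) φ∈ = ∈-++⁺ʳ (Φ₂ (f u)) (Φ₂-⋃⁺ p φ∈)

    Φ₁-⋃⁻ : ∀ ts {α} → α ∈ Φ₁ (⋃ (map f ts)) → ∃ λ t → t ∈ ts × α ∈ Φ₁ (f t)
    Φ₁-⋃⁻ (u ∷ ts) α∈ with ∈-++⁻ (Φ₁ (f u)) α∈
    ... | inj₁ p = u , here refl , p
    ... | inj₂ p with t , t∈ , q ← Φ₁-⋃⁻ ts p = t , there t∈ , q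

    Φ₂-⋃⁻ : ∀ ts {φ} → φ ∈ Φ₂ (⋃ (map f ts)) → ∃ λ t → t ∈ ts × φ ∈ Φ₂ (f t)
    Φ₂-⋃⁻ (u ∷ ts) φ∈ with ∈-++⁻ (Φ₂ (f u)) φ∈
    ... | inj₁ p = u , here refl , p
    ... | inj₂ p with t , t∈ , q ← Φ₂-⋃⁻ ts p = t , there t∈ , q

  termᴵ-cstᴵ : ∀ t → termᴵ (cstᴵ t) ≡ t
  termᴵ-cstᴵ (var x)    = refl
  termᴵ-cstᴵ (con c)    = refl
  termᴵ-cstᴵ (fn f ts)  = refl
  termᴵ-cstᴵ (len a)    = refl
  termᴵ-cstᴵ (diff a b) = refl

-- Models of CARD(T_I)

module IndexOrder (em : ExcludedMiddle 0ℓ) (T : IndexTheory) (M : IndexTheory.Model T) where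
  open IndexTheory T using (isTotalOrder; module Model)
  open Model M using (Carrier; _≈_; _≤_; _<_)
  open IsTotalOrder (isTotalOrder M) public
    using (≤-resp-≈) renaming (refl to ≤-refl; reflexive to ≤-reflexive; trans to ≤-trans; antisym to ≤-antisym; total to ≤-total)
  open IsTotalOrder (isTotalOrder M) using (isEquivalence; module Eq)
  private module Strict = ToStrict _≈_ _≤_

  <-≤-trans : ∀ {x y z} → x < y → y ≤ z → x < z
  <-≤-trans = Strict.<-≤-trans Eq.sym ≤-trans ≤-antisym (proj₁ ≤-resp-≈)

  ≤-<-trans : ∀ {x y z} → x ≤ y → y < z → x < z
  ≤-<-trans = Strict.≤-<-trans ≤-trans ≤-antisym (proj₂ ≤-resp-≈)

  <⇒≱ : ∀ {x y} → x < y → ¬ (y ≤ x)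
  <⇒≱ = Strict.<⇒≱ ≤-antisym

  ≰⇒> : ∀ {x y} → ¬ (x ≤ y) → y < x
  ≰⇒> = Strict.≰⇒> Eq.sym ≤-reflexive ≤-total

  ≮⇒≥ : ∀ {x y} → ¬ (x < y) → y ≤ x
  ≮⇒≥ x≮y = decidable-stable em (x≮y ∘ ≰⇒>)

  ≉⇒<> : ∀ {x y} → ¬ (x ≈ y) → x < y ⊎ y < x
  ≉⇒<> {x} {y} x≉y with ≤-total x y
  ... | inj₁ x≤y = inj₁ (x≤y , x≉y)
  ... | inj₂ y≤x = inj₂ (y≤x , x≉y ∘ Eq.sym)

-- Iterated differences in an arbitrary model

module IteratedDiff (em : ExcludedMiddle 0ℓ) (T : IndexTheory) (M : Card.CardModel (IndexTheory.theory T)) where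
  open Card.CardModel M
  open CardSyntax (IndexTheory.signature T) using (Term; iterate; diffᵗ)
  open IndexOrder em T indexModel

  rd-out : ∀ {y i} → ¬ (I.0ᴹ I.≤ i × i I.≤ ∣ y ∣) → rdᴹ y i E.≈ botᴹ
  rd-out {y} {i} out = decidable-stable em (out ∘ rd-defined y i)

  rd-above-length : ∀ {y i} → ∣ y ∣ I.< i → rdᴹ y i E.≈ botᴹ
  rd-above-length l<i = rd-out (<⇒≱ l<i ∘ proj₂)

  rd-length : ∀ y → ¬ (rdᴹ y ∣ y ∣ E.≈ botᴹ)
  rd-length y = defined-rd y ∣ y ∣ (len-nonneg y , ≤-refl)

  rd-wr-other : ∀ {y i e h} → ¬ (h I.≈ i) → rdᴹ (wrᴹ y i e) h E.≈ rdᴹ y h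
  rd-wr-other {y} {i} {e} {h} h≉i = rd-wr-diff y i h e (h≉i ∘ I.sym)

  -- No axiom speaks directly of a write out of range. If `e` is bottom, `wr-bot` applies; otherwise
  -- the length is unchanged, so both entries are out of range and hence bottom.
  rd-wr-out : ∀ {y i e} → ¬ (¬ (e E.≈ botᴹ) × I.0ᴹ I.≤ i × i I.≤ ∣ y ∣) → rdᴹ (wrᴹ y i e) i E.≈ rdᴹ y i
  rd-wr-out {y} {i} {e} out with em {e E.≈ botᴹ}
  ... | yes e≈⊥ = rd-cong (A.trans (wr-cong A.refl I.refl e≈⊥) (wr-bot y i)) I.refl
  ... | no e≉⊥ = E.trans
    (rd-out (λ (0≤i , i≤l) → out (e≉⊥ , 0≤i , ≤-trans i≤l (≤-reflexive (len-wr y i e)))))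
    (E.sym (rd-out (λ p → out (e≉⊥ , p))))

  rd-wr-at : ∀ y i e → rdᴹ (wrᴹ y i e) i E.≈ e ⊎ rdᴹ (wrᴹ y i e) i E.≈ rdᴹ y i
  rd-wr-at y i e with em {¬ (e E.≈ botᴹ) × I.0ᴹ I.≤ i × i I.≤ ∣ y ∣}
  ... | yes p = inj₁ (rd-wr-same y i e p)
  ... | no ¬p = inj₂ (rd-wr-out ¬p)

  diff-≈ : ∀ {x y} → x A.≈ y → diffᴹ x y I.≈ I.0ᴹ
  diff-≈ {x} x≈y = I.trans (diff-cong A.refl (A.sym x≈y)) (diff-refl x)

  diff-zero : ∀ {x y} → rdᴹ x (diffᴹ x y) E.≈ rdᴹ y (diffᴹ x y) → diffᴹ x y I.≈ I.0ᴹ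
  diff-zero {x} {y} eq = diff-≈ (decidable-stable em (λ x≉y → rd-diff x y x≉y eq))

  -- If an entry at the difference is not bottom, the index is in the range of that array. If both
  -- are bottom, the arrays agree at their difference, so the difference is 0.
  diff-nonneg : ∀ x y → I.0ᴹ I.≤ diffᴹ x y
  diff-nonneg x y with em {rdᴹ x (diffᴹ x y) E.≈ botᴹ} | em {rdᴹ y (diffᴹ x y) E.≈ botᴹ}
  ... | no p  | _     = proj₁ (rd-defined x _ p)
  ... | yes _ | no q  = proj₁ (rd-defined y _ q)
  ... | yes p | yes q = ≤-reflexive (I.sym (diff-zero (E.trans p (E.sym q))))

  diff-unique : ∀ {x y d} → ¬ (rdᴹ x d E.≈ rdᴹ y d) → (∀ {h} → d I.< h → rdᴹ x h E.≈ rdᴹ y h) → diffᴹ x y I.≈ d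
  diff-unique {x} {y} {d} neq above = ≤-antisym
    (≮⇒≥ (λ d<D → rd-diff x y (λ x≈y → neq (rd-cong x≈y I.refl)) (above d<D)))
    (≮⇒≥ (λ D<d → neq (diff-max x y d D<d)))

  iterateᴹ : A.Carrier → A.Carrier → ℕ → A.Carrier
  iterateᴹ a b zero    = b
  iterateᴹ a b (suc n) = wrᴹ (iterateᴹ a b n) (diffᴹ a (iterateᴹ a b n)) (rdᴹ a (diffᴹ a (iterateᴹ a b n)))

  ⟦iterate⟧ : ∀ a b n ρ → ⟦ iterate a b n ⟧ ρ ≡ iterateᴹ (⟦ a ⟧ ρ) (⟦ b ⟧ ρ) n
  ⟦iterate⟧ a b zero    ρ = refl
  ⟦iterate⟧ a b (suc n) ρ =
    cong (λ y → wrᴹ y (diffᴹ (⟦ a ⟧ ρ) y) (rdᴹ (⟦ a ⟧ ρ) (diffᴹ (⟦ a ⟧ ρ) y))) (⟦iterate⟧ a b n ρ)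

  module _ (a b : A.Carrier) where

    κ : ℕ → I.Carrier
    κ n = diffᴹ a (iterateᴹ a b n)

    len-iterate : ∀ n → ∣ iterateᴹ a b n ∣ I.≈ ∣ b ∣
    len-iterate zero    = I.refl
    len-iterate (suc n) = I.trans (len-wr _ _ _) (len-iterate n)

    -- Iterates have no new entries, so comparing `a` with an iterate reduces to comparing `a` with
    -- `b`. A write at some `κ j` may be refused, hence the alternatives do not depend on whether
    -- `h` is a `κ j`.
    rd-iterate : ∀ n h → rdᴹ (iterateᴹ a b n) h E.≈ rdᴹ b h ⊎ rdᴹ (iterateᴹ a b n) h E.≈ rdᴹ a h
    rd-iterate zero    h = inj₁ E.refl
    rd-iterate (suc n) h with em {h I.≈ κ n}
    ... | no h≉κ = [ inj₁ ∘ E.trans (rd-wr-other h≉κ) , inj₂ ∘ E.trans (rd-wr-other h≉κ) ]′ (rd-iterate n h)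
    ... | yes h≈κ with rd-wr-at (iterateᴹ a b n) (κ n) (rdᴹ a (κ n))
    ...   | inj₁ eq = inj₂ (E.trans (rd-cong A.refl h≈κ) (E.trans eq (rd-cong A.refl (I.sym h≈κ))))
    ...   | inj₂ eq with eq′ ← E.trans (rd-cong A.refl h≈κ) (E.trans eq (rd-cong A.refl (I.sym h≈κ))) =
      [ inj₁ ∘ E.trans eq′ , inj₂ ∘ E.trans eq′ ]′ (rd-iterate n h)

    rd-iterate-other : ∀ n {h} → ¬ (∃ λ j → j ℕ.< n × h I.≈ κ j) → rdᴹ (iterateᴹ a b n) h E.≈ rdᴹ b h
    rd-iterate-other zero    other = E.refl
    rd-iterate-other (suc n) other = E.trans
      (rd-wr-other (λ h≈κ → other (n , ℕ.≤-refl , h≈κ)))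
      (rd-iterate-other n (λ (j , j<n , eq) → other (j , ℕ.m<n⇒m<1+n j<n , eq)))

    κ-nonneg : ∀ n → I.0ᴹ I.≤ κ n
    κ-nonneg n = diff-nonneg a (iterateᴹ a b n)

    -- By `rd-iterate` the iterate has at `κ n` the entry of `b` or that of `a`. In both cases it
    -- agrees with `a` there, and agreement at a difference makes the difference 0.
    κ-zero : ∀ n → rdᴹ a (κ n) E.≈ rdᴹ b (κ n) → κ n I.≈ I.0ᴹ
    κ-zero n eq with rd-iterate n (κ n)
    ... | inj₁ p = diff-zero (E.trans eq (E.sym p))
    ... | inj₂ p = diff-zero (E.sym p)

    -- Suppose `κ n < κ (suc n)`. At the latter index the new write has no effect and `a` agrees
    -- with the old iterate, hence with the new one. So `κ (suc n)` is 0 and cannot exceed the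
    -- nonnegative `κ n`.
    κ-mono : ∀ n → κ (suc n) I.≤ κ n
    κ-mono n = ≮⇒≥ λ lt → <⇒≱ lt (≤-trans
      (≤-reflexive (diff-zero (E.trans (diff-max a (iterateᴹ a b n) _ lt) (E.sym (rd-wr-other (proj₂ lt ∘ I.sym))))))
      (κ-nonneg n))

    κ-step : ∀ n → κ (suc n) I.< κ n → ¬ (rdᴹ a (κ n) E.≈ rdᴹ b (κ n))
    κ-step n lt eq = <⇒≱ lt (≤-trans (≤-reflexive (κ-zero n eq)) (κ-nonneg (suc n)))

    -- Equal lengths ensure that the write at `κ n` is carried out if `a` is defined there; the next
    -- iterate then agrees with `a` at its own difference. If `a` is bottom at `κ n`, so is the
    -- iterate. Either way the difference is 0.
    κ-stable : ∀ n → ∣ a ∣ I.≈ ∣ b ∣ → κ n I.≈ κ (suc n) → κ n I.≈ I.0ᴹ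
    κ-stable n la≈lb eq with em {rdᴹ a (κ n) E.≈ botᴹ}
    ... | yes a≈⊥ = diff-zero (E.trans a≈⊥ (E.sym (rd-out λ (0≤κ , κ≤l) →
      defined-rd a (κ n) (0≤κ , ≤-trans κ≤l (≤-reflexive (I.trans (len-iterate n) (I.sym la≈lb)))) a≈⊥)))
    ... | no a≉⊥ with 0≤κ , κ≤l ← rd-defined a (κ n) a≉⊥ =
      I.trans eq (diff-zero (E.trans (rd-cong A.refl (I.sym eq)) (E.trans
        (E.sym (rd-wr-same _ _ _ (a≉⊥ , 0≤κ , ≤-trans κ≤l (≤-reflexive (I.trans la≈lb (I.sym (len-iterate n)))))))
        (rd-cong A.refl eq))))

    κ-above : ∀ n {h} → κ n I.< h → rdᴹ a h E.≈ rdᴹ b h ⊎ (∃ λ j → j ℕ.< n × h I.≈ κ j)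
    κ-above n {h} lt with em {∃ λ j → j ℕ.< n × h I.≈ κ j}
    ... | yes p = inj₂ p
    ... | no ¬p = inj₁ (E.trans (diff-max a _ h lt) (rd-iterate-other n ¬p))

    -- Writes keep the length, so every iterate is still bottom at the length of `a`, where `a` is
    -- not, and above it both are bottom.
    κ-length-left : ∀ n → ∣ b ∣ I.< ∣ a ∣ → κ n I.≈ ∣ a ∣
    κ-length-left n lb<la with lt ← ≤-<-trans (≤-reflexive (len-iterate n)) lb<la = diff-unique
      (λ eq → rd-length a (E.trans eq (rd-above-length lt)))
      (λ la<h → E.trans (rd-above-length la<h) (E.sym (rd-above-length (<-≤-trans lt (proj₁ la<h)))))

    κ-length-right : ∀ n → ∣ a ∣ I.< ∣ b ∣ → κ n I.≈ ∣ b ∣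
    κ-length-right n la<lb with eqₗ ← len-iterate n = diff-unique
      (λ eq → defined-rd _ _ (len-nonneg b , ≤-reflexive (I.sym eqₗ)) (E.trans (E.sym eq) (rd-above-length la<lb)))
      (λ lb<h → E.trans (rd-above-length (<-≤-trans la<lb (proj₁ lb<h)))
                        (E.sym (rd-above-length (≤-<-trans (≤-reflexive eqₗ) lb<h))))

-- Chains of differences and the equations of the first component

concatMap-All : {A B : Set} {P : B → Set} {f : A → List B} {xs : List A} →
  (∀ {x} → x ∈ xs → All P (f x)) → All P (concatMap f xs)
concatMap-All p = All.concat⁺ (All.map⁺ (All.tabulate p))

-- Shifting `R` in the tail keeps track of the position in the whole vector. In this form head,
-- last, init and consecutive entries are all reached by recursion.
Chain : {A : Set} → (A → ℕ → Set) → ∀ {n} → Vec A n → Set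
Chain R []       = ⊤
Chain R (k ∷ ks) = R k 0 × Chain (λ k j → R k (suc j)) ks

module _ {A : Set} where

  Chain-∷ʳ : ∀ {n} {R : A → ℕ → Set} (ks : Vec A n) {k} → Chain R ks → R k n → Chain R (ks ∷ʳ k)
  Chain-∷ʳ []       _       r = r , tt
  Chain-∷ʳ (_ ∷ ks) (p , c) r = p , Chain-∷ʳ ks c r

  Chain-head : ∀ {n} (R : A → ℕ → Set) (ks : Vec A (suc n)) → Chain R ks → R (Vec.head ks) 0
  Chain-head R (_ ∷ _) (p , _) = p

  Chain-last : ∀ {n} (R : A → ℕ → Set) (ks : Vec A (suc n)) → Chain R ks → R (Vec.last ks) n
  Chain-last R (_ ∷ [])     (p , _) = p
  Chain-last R (_ ∷ k ∷ ks) (_ , c) = Chain-last (λ k j → R k (suc j)) (k ∷ ks) c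

  Chain-∈⁻ : ∀ {n} (R : A → ℕ → Set) (ks : Vec A n) {k} → Chain R ks → k ∈ Vec.toList ks →
    ∃ λ j → j ℕ.< n × R k j
  Chain-∈⁻ R (_ ∷ ks) (p , c) (here refl) = 0 , s≤s z≤n , p
  Chain-∈⁻ R (_ ∷ ks) (p , c) (there k∈) with j , j<n , r ← Chain-∈⁻ (λ k j → R k (suc j)) ks c k∈ = suc j , s≤s j<n , r

  Chain-∈⁺ : ∀ {n} (R : A → ℕ → Set) (ks : Vec A n) {j} → Chain R ks → j ℕ.< n →
    ∃ λ k → k ∈ Vec.toList ks × R k j
  Chain-∈⁺ R (k ∷ ks) {zero}  (p , c) _         = k , here refl , p
  Chain-∈⁺ R (k ∷ ks) {suc j} (p , c) (s≤s j<n) with k , k∈ , r ← Chain-∈⁺ (λ k j → R k (suc j)) ks c j<n = k , there k∈ , r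

  Chain-init : ∀ {n} (R : A → ℕ → Set) (ks : Vec A (suc n)) → Chain R ks → Chain R (Vec.init ks)
  Chain-init R (_ ∷ [])     _       = tt
  Chain-init R (_ ∷ k ∷ ks) (p , c) = p , Chain-init (λ k j → R k (suc j)) (k ∷ ks) c

module Instances (S : Signature) where
  open Signature S
  open Syntax S
  open CardSyntax S
  open Separated S
  open Algorithm S
  open Naming S

  consecutive-Chain⁻ : ∀ {A : Set} {n} (R : A → ℕ → Set) (ks : Vec A (suc n)) {k k′} → Chain R ks →
    (k , k′) ∈ consecutive ks → ∃ λ j → R k j × R k′ (suc j)
  consecutive-Chain⁻ R (_ ∷ k ∷ ks) (p , q , _) (here refl) = 0 , p , q
  consecutive-Chain⁻ R (_ ∷ k ∷ ks) (_ , c) (there s∈) with j , r ← consecutive-Chain⁻ (λ k j → R k (suc j)) (k ∷ ks) c s∈ = suc j , r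

  consecutive-Chain⁺ : ∀ {A : Set} {n} (R : A → ℕ → Set) (ks : Vec A (suc n)) {j} → Chain R ks → j ℕ.< n →
    ∃₂ λ k k′ → (k , k′) ∈ consecutive ks × R k j × R k′ (suc j)
  consecutive-Chain⁺ R (k ∷ k′ ∷ ks) {zero}  (p , q , _) _         = k , k′ , here refl , p , q
  consecutive-Chain⁺ R (_ ∷ k  ∷ ks) {suc j} (_ , c)     (s≤s j<n)
    with k , k′ , s∈ , r ← consecutive-Chain⁺ (λ k j → R k (suc j)) (k ∷ ks) c j<n = k , k′ , there s∈ , r

  lengthIn⁻ : ∀ a α {i} → lengthIn a α ≡ just i → α ≡ len≡ a i
  lengthIn⁻ a (len≡ a′ i) eq with a ≟ᴺ a′
  lengthIn⁻ a (len≡ a′ i) refl | yes refl = refl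

  lengthIn⁺ : ∀ a i → lengthIn a (len≡ a i) ≡ just i
  lengthIn⁺ a i with a ≟ᴺ a
  ... | yes _  = refl
  ... | no a≢a = contradiction refl a≢a

  diffIn⁻ : ∀ n a b α {i} → diffIn n a b α ≡ just i → α ≡ diff≡ n a b i
  diffIn⁻ n a b (diff≡ n′ a′ b′ i) eq with (n ℕ.≟ n′) ×-dec (a ≟ᴺ a′) ×-dec (b ≟ᴺ b′)
  diffIn⁻ n a b (diff≡ n′ a′ b′ i) refl | yes (refl , refl , refl) = refl

  diffIn⁺ : ∀ n a b i → diffIn n a b (diff≡ n a b i) ≡ just i
  diffIn⁺ n a b i with (n ℕ.≟ n) ×-dec (a ≟ᴺ a) ×-dec (b ≟ᴺ b)
  ... | yes _ = refl
  ... | no ¬p = contradiction (refl , refl , refl) ¬p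

  module _ {Φ : List Atom₁} where

    lengths⁻ : ∀ a {i} → i ∈ lengths Φ a → len≡ a i ∈ Φ
    lengths⁻ a i∈ with α , α∈ , eq ← ∈-mapMaybe⁻ (lengthIn a) Φ i∈ with refl ← lengthIn⁻ a α eq = α∈

    lengths⁺ : ∀ a {i} → len≡ a i ∈ Φ → i ∈ lengths Φ a
    lengths⁺ a α∈ = ∈-mapMaybe⁺ (lengthIn a) α∈ (lengthIn⁺ a _)

    diffs⁻ : ∀ n a b {i} → i ∈ diffs Φ n a b → diff≡ n a b i ∈ Φ
    diffs⁻ n a b i∈ with α , α∈ , eq ← ∈-mapMaybe⁻ (diffIn n a b) Φ i∈ with refl ← diffIn⁻ n a b α eq = α∈

    diffs⁺ : ∀ n a b {i} → diff≡ n a b i ∈ Φ → i ∈ diffs Φ n a b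
    diffs⁺ n a b α∈ = ∈-mapMaybe⁺ (diffIn n a b) α∈ (diffIn⁺ n a b _)

    chains⁻ : ∀ {R : ICst → ℕ → Set} a b l {ks} → (∀ {n i} → diff≡ n a b i ∈ Φ → R i n) →
      ks ∈ chains Φ a b l → Chain R ks
    chains⁻ a b zero    p (here refl) = tt
    chains⁻ a b (suc l) p ks∈
      with ks , ks∈′ , q ← ∈-concatMap⁻′ (λ ks → map (ks ∷ʳ_) (diffs Φ l a b)) (chains Φ a b l) ks∈
      with k , k∈ , refl ← ∈-map⁻ (ks ∷ʳ_) q =
      Chain-∷ʳ ks (chains⁻ a b l p ks∈′) (p (diffs⁻ l a b k∈))

    -- One iterated difference may be equated to several constants: for common arrays the first can
    -- be both `diffₖ 0` and the name of the term `diff a b`. All combinations are enumerated; this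
    -- finds the one that follows the choice `k`.
    chains⁺ : ∀ (k : ℕ → ICst) a b l → (∀ {n} → n ℕ.< l → diff≡ n a b (k n) ∈ Φ) →
      ∃ λ ks → ks ∈ chains Φ a b l × Chain (λ i n → i ≡ k n) ks
    chains⁺ k a b zero    p = [] , here refl , tt
    chains⁺ k a b (suc l) p with ks , ks∈ , c ← chains⁺ k a b l (p ∘ ℕ.m<n⇒m<1+n) =
      ks ∷ʳ k l ,
      ∈-concatMap⁺′ (λ ks → map (ks ∷ʳ_) (diffs Φ l a b)) ks∈ (∈-map⁺ (ks ∷ʳ_) (diffs⁺ l a b (p ℕ.≤-refl))) ,
      Chain-∷ʳ ks c refl

-- Soundness of the added formulae in an arbitrary model

module Soundness (em : ExcludedMiddle 0ℓ) (T : IndexTheory)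
  (M : Card.CardModel (IndexTheory.theory T)) (ρ : Card.CardModel.Assignment M) where
  open IndexTheory T using (theory; signature)
  open Signature signature
  open Syntax signature using (Tm; var; con; fn; _≐_; _≼_; rel; termsᴬ)
  open CardSyntax signature
  open Separated signature
  open Algorithm signature
  open Naming signature
  open Instances signature
  open Card.CardModel M
  open IndexOrder em T indexModel
  open IteratedDiff em T M

  -- Each constant denotes the term it names. Reading back then preserves truth, and the properties
  -- of the black-box interpolant are evaluated at this one model.
  reduct : EUF.EUFModel theory Name
  reduct = record
    { indexModel = indexModel
    ; elemSetoid = elemSetoid
    ; botᴹ = botᴹ
    ; elᴹ = elᴹ
    ; bot≉el = bot≉el
    ; indexᴹ = λ x → ⟦ term x ⟧ ρ
    ; elemᴹ = λ x → ⟦ term x ⟧ ρ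
    ; funᴹ = λ a → rdᴹ (⟦ term a ⟧ ρ)
    ; fun-cong = λ a → rd-cong A.refl
    }

  open EUF.EUFModel reduct using (Holdsᵉ; ⊨_; ⟦_⟧ᵉ; indexᴹ)

  mutual
    ⟦readTm⟧ : ∀ t → I.⟦ t ⟧ indexᴹ ≡ ⟦ readTm t ⟧ ρ
    ⟦readTm⟧ (var x)   = refl
    ⟦readTm⟧ (con c)   = refl
    ⟦readTm⟧ (fn f ts) = cong (I.fnᴹ f) (⟦readTm*⟧ ts)

    ⟦readTm*⟧ : ∀ {n} (ts : Vec (Tm (Name INDEX)) n) → I.⟦ ts ⟧* indexᴹ ≡ ⟦ readTm* ts ⟧* ρ
    ⟦readTm*⟧ []       = refl
    ⟦readTm*⟧ (t ∷ ts) = cong₂ _∷_ (⟦readTm⟧ t) (⟦readTm*⟧ ts)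

  ⟦readETm⟧ : ∀ e → ⟦ e ⟧ᵉ ≡ ⟦ readETm e ⟧ ρ
  ⟦readETm⟧ (var x) = refl
  ⟦readETm⟧ bot     = refl
  ⟦readETm⟧ el      = refl
  ⟦readETm⟧ (a · t) = cong (rdᴹ (⟦ term a ⟧ ρ)) (⟦readTm⟧ t)

  readAtom-holds : ∀ α → Holdsᵉ α ⇔ Holdsᶜ ρ (readAtom α)
  readAtom-holds (index α) = Holdsᴬ-map I.structure readTm α (λ {t} _ → I.reflexive (⟦readTm⟧ t))
  readAtom-holds (d ≐ᴱ e) rewrite ⟦readETm⟧ d | ⟦readETm⟧ e = mk⇔ id id

  readBack-holds : ∀ φ → (⊨ φ) ⇔ (ρ ⊨ readBack φ)
  readBack-holds φ = Holds-bind _ φ (λ {α} _ → readAtom-holds α)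

  den : ICst → I.Carrier
  den i = I.⟦ ⟨ i ⟩ ⟧ indexᴹ

  denᴱ : ECst → E.Carrier
  denᴱ e = ⟦ ⟨ e ⟩ᴱ ⟧ᵉ

  den-cst : ∀ t → den (cstᴵ t) ≡ ⟦ t ⟧ ρ
  den-cst (var x)    = refl
  den-cst (con c)    = refl
  den-cst (fn f ts)  = refl
  den-cst (len a)    = refl
  den-cst (diff a b) = refl

  denᴱ-cst : ∀ t → denᴱ (cstᴱ t) ≡ ⟦ t ⟧ ρ
  denᴱ-cst (var x)  = refl
  denᴱ-cst (rd a i) = refl
  denᴱ-cst bot      = refl
  denᴱ-cst el       = refl

  flatten-holds : ∀ φ → (ρ ⊨ φ) ⇔ (⊨ flatten φ)
  flatten-holds φ = Holds-bind flattenᵃ φ (λ {α} _ → atom-holds α)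
    where
    atom-holds : ∀ α → Holdsᶜ ρ α ⇔ (⊨ flattenᵃ α)
    atom-holds (index α) = Holdsᴬ-map I.structure _ α (λ {t} _ → I.reflexive (sym (den-cst t)))
    atom-holds (array≐ a b) = mk⇔
      (λ a≈b → diff-≈ a≈b , rd-cong a≈b I.refl)
      -- Unequal arrays would differ at their difference, which is 0, and there they agree.
      (λ (d≈0 , eq) → decidable-stable em λ a≉b →
        rd-diff _ _ a≉b (E.trans (rd-cong A.refl d≈0) (E.trans eq (rd-cong A.refl (I.sym d≈0)))))
    atom-holds (elem≐ d e) rewrite denᴱ-cst d | denᴱ-cst e = mk⇔ id id

  -- The array-theoretic content of the first component, which is not part of the formulae handed to
  -- the interpolation algorithm.
  Meant : Atom₁ → Set
  Meant (len≡ a i)      = ∣ ⟦ term a ⟧ ρ ∣ I.≈ den i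
  Meant (diff≡ n a b i) = den i I.≈ ⟦ diffᵗ (term a) (term b) n ⟧ ρ
  Meant (wr≡ a b i e)   = ⟦ term a ⟧ ρ A.≈ wrᴹ (⟦ term b ⟧ ρ) (den i) (denᴱ e)

  den-csts : ∀ {n} (ts : Vec (Term INDEX) n) → ⟦ ts ⟧* ρ ≡ I.⟦ Vec.map (λ t → ⟨ cstᴵ t ⟩) ts ⟧* indexᴹ
  den-csts []       = refl
  den-csts (t ∷ ts) = cong₂ _∷_ (sym (den-cst t)) (den-csts ts)

  naming-sound : ∀ t → All Meant (Φ₁ (naming t)) × All ⊨_ (Φ₂ (naming t))
  naming-sound (INDEX , var x)    = [] , []
  naming-sound (INDEX , con c)    = [] , []
  naming-sound (INDEX , fn f ts)  = [] , I.reflexive (cong (I.fnᴹ f) (den-csts ts)) ∷ []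
  naming-sound (INDEX , len a)    = I.refl ∷ [] , []
  naming-sound (INDEX , diff a b) = I.refl ∷ [] , []
  naming-sound (ARRAY , var x)    = [] , []
  naming-sound (ARRAY , wr b i e) =
    wr-cong A.refl (I.reflexive (sym (den-cst i))) (E.reflexive (sym (denᴱ-cst e))) ∷ [] , []
  naming-sound (ELEM  , var x)    = [] , []
  naming-sound (ELEM  , rd a i)   = [] , rd-cong A.refl (I.reflexive (den-cst i)) ∷ []
  naming-sound (ELEM  , bot)      = [] , []
  naming-sound (ELEM  , el)       = [] , []

  module _ (𝓘 : List ICst) where

    wrInstances-sound : ∀ {a b i e lb} → Meant (wr≡ a b i e) → Meant (len≡ b lb) → All ⊨_ (wrInstances 𝓘 a b i e lb)
    wrInstances-sound a≈ lb≈ =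
        (λ (e≉⊥ , 0≤i , i≤lb) → E.trans (rd-cong a≈ I.refl)
          (rd-wr-same _ _ _ (e≉⊥ , 0≤i , ≤-trans i≤lb (≤-reflexive (I.sym lb≈)))))
      ∷ (λ out → E.trans (rd-cong a≈ I.refl) (rd-wr-out (λ (e≉⊥ , 0≤i , i≤l) →
          [ (λ i<0 → <⇒≱ i<0 0≤i) , [ (λ lb<i → <⇒≱ lb<i (≤-trans i≤l (≤-reflexive lb≈))) , e≉⊥ ]′ ]′ out)))
      ∷ All.map⁺ (All.tabulate (λ _ h≉i → E.trans (rd-cong a≈ I.refl) (rd-wr-other h≉i)))

    lenInstances-sound : ∀ {a i} → Meant (len≡ a i) → All ⊨_ (lenInstances 𝓘 a i)
    lenInstances-sound l≈ =
        ≤-trans (len-nonneg _) (≤-reflexive l≈)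
      ∷ All.map⁺ (All.tabulate (λ _ →
          (λ ≉⊥ → let 0≤h , h≤l = rd-defined _ _ ≉⊥ in 0≤h , ≤-trans h≤l (≤-reflexive l≈)) ,
          (λ (0≤h , h≤i) → defined-rd _ _ (0≤h , ≤-trans h≤i (≤-reflexive (I.sym l≈))))))

    diffInstances-sound : ∀ {a b n la lb} (ks : Vec ICst (suc n)) →
      Chain (λ k j → den k I.≈ κ (⟦ term a ⟧ ρ) (⟦ term b ⟧ ρ) j) ks →
      Meant (len≡ a la) → Meant (len≡ b lb) → All ⊨_ (diffInstances 𝓘 a b ks la lb)
    diffInstances-sound {a} {b} {n} {la} {lb} ks ch la≈ lb≈ =
        (⋀⁺ (All.map⁺ (All.tabulate λ s∈ → let j , p , q = consecutive-Chain⁻ R ks ch s∈ in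
          I.≤-resp (I.sym q) (I.sym p) (κ-mono _ _ j))) ,
         ≤-trans (κ-nonneg _ _ n) (≤-reflexive (I.sym last≈)))
      ∷ ⋀-map⁺ (λ (k , k′) → k′ <ᴵ k ⇒̇ ¬̇ (a ‼ k ≡ᴱ b ‼ k)) (consecutive ks)
          (All.tabulate (λ s∈ (le , neq) eq → let j , p , q = consecutive-Chain⁻ R ks ch s∈ in
          κ-step _ _ j (I.≤-resp q p le , λ r → neq (I.trans q (I.trans r (I.sym p)))) (at p eq)))
      ∷ ⋀-map⁺ (λ (k , k′) → la ≡ᴵ lb ∧̇ k ≡ᴵ k′ ⇒̇ k ≡ᴵ 𝟘) (consecutive ks)
          (All.tabulate (λ s∈ (l≈l , eq) → let j , p , q = consecutive-Chain⁻ R ks ch s∈ in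
          I.trans p (κ-stable _ _ j (I.trans la≈ (I.trans l≈l (I.sym lb≈))) (I.trans (I.sym p) (I.trans eq q)))))
      ∷ ⋀⁺ (All.map⁺ (All.tabulate λ k∈ eq → let j , _ , p = Chain-∈⁻ R ks ch k∈ in
          I.trans p (κ-zero _ _ j (at p eq))))
      ∷ (λ (le , neq) → let l<l = I.≤-resp (I.sym lb≈) (I.sym la≈) le , λ r → neq (I.trans (I.sym lb≈) (I.trans r la≈)) in
          ends (λ j → κ-length-left _ _ j l<l) la≈)
      ∷ (λ (le , neq) → let l<l = I.≤-resp (I.sym la≈) (I.sym lb≈) le , λ r → neq (I.trans (I.sym la≈) (I.trans r lb≈)) in
          ends (λ j → κ-length-right _ _ j l<l) lb≈)
      ∷ All.map⁺ (All.tabulate λ _ (le , neq) → Sum.map₂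
          (λ (j , j<n , eq) → let k , k∈ , p = Chain-∈⁺ R (Vec.init ks) (Chain-init R ks ch) j<n in
            ⋁⁺ (Any.map⁺ (lose k∈ (I.trans eq (I.sym p)))))
          (κ-above _ _ n (I.≤-resp last≈ I.refl le , λ r → neq (I.trans last≈ r))))
      where
      R : ICst → ℕ → Set
      R k j = den k I.≈ κ (⟦ term a ⟧ ρ) (⟦ term b ⟧ ρ) j

      last≈ : den (Vec.last ks) I.≈ κ (⟦ term a ⟧ ρ) (⟦ term b ⟧ ρ) n
      last≈ = Chain-last R ks ch

      at : ∀ {k h} → k I.≈ h → rdᴹ (⟦ term a ⟧ ρ) k E.≈ rdᴹ (⟦ term b ⟧ ρ) k → rdᴹ (⟦ term a ⟧ ρ) h E.≈ rdᴹ (⟦ term b ⟧ ρ) h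
      at k≈h eq = E.trans (rd-cong A.refl (I.sym k≈h)) (E.trans eq (rd-cong A.refl k≈h))

      ends : ∀ {l l′} → (∀ j → κ (⟦ term a ⟧ ρ) (⟦ term b ⟧ ρ) j I.≈ l) → l I.≈ l′ →
        den (Vec.head ks) I.≈ den (Vec.last ks) × den (Vec.last ks) I.≈ l′
      ends κ≈ l≈ =
        I.trans (Chain-head R ks ch) (I.trans (κ≈ 0) (I.sym (I.trans last≈ (κ≈ n)))) ,
        I.trans last≈ (I.trans (κ≈ n) l≈)

    instances-sound : ∀ {Φ} → (∀ {α} → α ∈ Φ → Meant α) → ∀ {α} → α ∈ Φ → All ⊨_ (instances 𝓘 Φ α)
    instances-sound m {len≡ a i} α∈ = lenInstances-sound {a} {i} (m α∈)
    instances-sound m {wr≡ a b i e} α∈ = concatMap-All λ {lb} lb∈ →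
      wrInstances-sound {a} {b} {i} {e} {lb} (m α∈) (m (lengths⁻ b lb∈))
    instances-sound m {diff≡ n a b _} α∈ = concatMap-All λ {ks} ks∈ → concatMap-All λ {la} la∈ → concatMap-All λ {lb} lb∈ →
      diffInstances-sound {a} {b} {n} {la} {lb} ks
        -- `Meant` speaks of the value of the term `diffᵗ`, the lemmas on `κ` of the iteration
        -- inside the model.
        (chains⁻ a b (suc n) (λ {j} α∈ → I.trans (m α∈) (I.reflexive (cong (diffᴹ _) (⟦iterate⟧ (term a) (term b) j ρ)))) ks∈)
        (m (lengths⁻ a la∈)) (m (lengths⁻ b lb∈))

  step2-sound : ∀ 𝓘 X Y D → (∀ {α} → α ∈ D → Meant α) → ρ ⊨ X →
    ⊨ ⋀ (Φ₂ (instantiate 𝓘 (preprocess X Y ∪ (D ∣ []))))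
  step2-sound 𝓘 X Y D mD ρ⊨X = ⋀⁺ (All.++⁺ base (concatMap-All (instances-sound 𝓘 meant)))
    where
    named₂ : ∀ {φ} → φ ∈ Φ₂ (⋃ (map naming (namedTerms X Y))) → ⊨ φ
    named₂ φ∈ with t , _ , p ← Φ₂-⋃⁻ naming (namedTerms X Y) φ∈ = All.lookup (proj₂ (naming-sound t)) p

    meant : ∀ {α} → α ∈ Φ₁ (preprocess X Y ∪ (D ∣ [])) → Meant α
    meant α∈ with ∈-++⁻ (Φ₁ (preprocess X Y)) α∈
    ... | inj₂ p = mD p
    ... | inj₁ p with t , _ , q ← Φ₁-⋃⁻ naming (namedTerms X Y) p = All.lookup (proj₁ (naming-sound t)) q

    base : All ⊨_ (Φ₂ (preprocess X Y ∪ (D ∣ [])))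
    base = All.++⁺ (_∷_ {P = ⊨_} (to (flatten-holds X) ρ⊨X) (All.tabulate (λ {φ} → named₂ {φ}))) []

-- The model of finitely deviating arrays

module FiniteArrays (em : ExcludedMiddle 0ℓ) (T : IndexTheory)
  (indexModel : IndexTheory.Model T) (elemSetoid : Setoid 0ℓ 0ℓ)
  (bot el : Setoid.Carrier elemSetoid) (bot≉el : ¬ Setoid._≈_ elemSetoid bot el) where
  open IndexTheory T using (theory; module Model)
  private
    module I = Model indexModel
    module E = Setoid elemSetoid
  open IndexOrder em T indexModel

  InRange : I.Carrier → I.Carrier → Set
  InRange l h = I.0ᴹ I.≤ h × h I.≤ l

  InRange-resp : ∀ {l l′ h h′} → l I.≈ l′ → h I.≈ h′ → InRange l h → InRange l′ h′
  InRange-resp l≈ h≈ (0≤h , h≤l) = I.≤-resp I.refl h≈ 0≤h , I.≤-resp h≈ l≈ h≤l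

  -- Arrays that take the value el at all but finitely many indices of their
  -- range; any two of them that differ do so at a largest index.
  record Array : Set where
    field
      fun        : I.Carrier → E.Carrier
      fun-cong   : ∀ {h h′} → h I.≈ h′ → fun h E.≈ fun h′
      len        : I.Carrier
      len-nonneg : I.0ᴹ I.≤ len
      defined    : ∀ h → ¬ (fun h E.≈ bot) → InRange len h
      inRange    : ∀ h → InRange len h → ¬ (fun h E.≈ bot)
      support    : List I.Carrier
      generic    : ∀ h → ¬ Any (h I.≈_) support → InRange len h → fun h E.≈ el

    out : ∀ {h} → ¬ InRange len h → fun h E.≈ bot
    out {h} ¬r = decidable-stable em (¬r ∘ defined h)

  open Array

  infix 4 _≋_

  _≋_ : Array → Array → Set
  x ≋ y = ∀ h → fun x h E.≈ fun y h

  arraySetoid : Setoid 0ℓ 0ℓ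
  arraySetoid = record
    { Carrier = Array
    ; _≈_ = _≋_
    ; isEquivalence = record
      { refl = λ _ → E.refl
      ; sym = λ p h → E.sym (p h)
      ; trans = λ p q h → E.trans (p h) (q h)
      }
    }

  -- Extensional equality does not mention lengths; they are recovered as the greatest indices with
  -- a value other than bottom.
  len-≤ : ∀ x y → x ≋ y → len x I.≤ len y
  len-≤ x y x≋y = proj₂ (defined y (len x) λ y≈⊥ →
    inRange x (len x) (len-nonneg x , ≤-refl) (E.trans (x≋y (len x)) y≈⊥))

  len-≈ : ∀ x y → x ≋ y → len x I.≈ len y
  len-≈ x y x≋y = ≤-antisym (len-≤ x y x≋y) (len-≤ y x (λ h → E.sym (x≋y h)))

  -- The decision is an argument, here and in `write′` and `diff′`, so that proofs can replace the
  -- call of `em` by its two outcomes.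
  update : {P : Set} → Dec P → E.Carrier → E.Carrier → E.Carrier
  update (yes _) e d = e
  update (no _)  e d = d

  writeAt : (y : Array) (i : I.Carrier) (e : E.Carrier) → ¬ (e E.≈ bot) → InRange (len y) i → Array
  writeAt y i e e≉⊥ i∈ = record
    { fun = λ h → update (em {h I.≈ i}) e (fun y h)
    ; fun-cong = cong′
    ; len = len y
    ; len-nonneg = len-nonneg y
    ; defined = defined′
    ; inRange = inRange′
    ; support = i ∷ support y
    ; generic = generic′
    }
    where
    cong′ : ∀ {h h′} → h I.≈ h′ → update (em {h I.≈ i}) e (fun y h) E.≈ update (em {h′ I.≈ i}) e (fun y h′)
    cong′ {h} {h′} h≈ with em {h I.≈ i} | em {h′ I.≈ i}
    ... | yes _ | yes _ = E.refl
    ... | yes p | no ¬q = contradiction (I.trans (I.sym h≈) p) ¬q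
    ... | no ¬p | yes q = contradiction (I.trans h≈ q) ¬p
    ... | no _  | no _  = fun-cong y h≈

    defined′ : ∀ h → ¬ (update (em {h I.≈ i}) e (fun y h) E.≈ bot) → InRange (len y) h
    defined′ h ≉⊥ with em {h I.≈ i}
    ... | yes p = InRange-resp I.refl (I.sym p) i∈
    ... | no _  = defined y h ≉⊥

    inRange′ : ∀ h → InRange (len y) h → ¬ (update (em {h I.≈ i}) e (fun y h) E.≈ bot)
    inRange′ h r with em {h I.≈ i}
    ... | yes _ = e≉⊥
    ... | no _  = inRange y h r

    generic′ : ∀ h → ¬ Any (h I.≈_) (i ∷ support y) → InRange (len y) h → update (em {h I.≈ i}) e (fun y h) E.≈ el
    generic′ h h∉ r with em {h I.≈ i}
    ... | yes p = contradiction (here p) h∉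
    ... | no _  = generic y h (h∉ ∘ there) r

  Writable : Array → I.Carrier → E.Carrier → Set
  Writable y i e = ¬ (e E.≈ bot) × InRange (len y) i

  -- Refusing all other writes is forced: the length must be kept, writing bottom must change
  -- nothing, and entries out of range are bottom.
  write′ : ∀ y i e → Dec (Writable y i e) → Array
  write′ y i e (yes (e≉⊥ , i∈)) = writeAt y i e e≉⊥ i∈
  write′ y i e (no _)           = y

  write : Array → I.Carrier → E.Carrier → Array
  write y i e = write′ y i e em

  fun-write-same : ∀ y i e → Writable y i e → fun (write y i e) i E.≈ e
  fun-write-same y i e w with em {Writable y i e}
  ... | no ¬w = contradiction w ¬w
  ... | yes _ with em {i I.≈ i}
  ...   | yes _ = E.refl
  ...   | no ¬p = contradiction I.refl ¬p

  fun-write-other : ∀ y i e {h} → ¬ (h I.≈ i) → fun (write y i e) h E.≈ fun y h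
  fun-write-other y i e {h} h≉i with em {Writable y i e}
  ... | no _  = E.refl
  ... | yes _ with em {h I.≈ i}
  ...   | yes p = contradiction p h≉i
  ...   | no _  = E.refl

  fun-write-out : ∀ y i e → ¬ Writable y i e → write y i e ≋ y
  fun-write-out y i e ¬w with em {Writable y i e}
  ... | no _  = λ _ → E.refl
  ... | yes w = contradiction w ¬w

  len-write : ∀ y i e → len (write y i e) I.≈ len y
  len-write y i e with em {Writable y i e}
  ... | no _  = I.refl
  ... | yes _ = I.refl

  -- Serves both for the congruence of `write` and to recognise the array glued for `wr b i e` as a
  -- write into the array glued for `b`.
  write-unique : ∀ {x} y i e → (∀ {h} → ¬ (h I.≈ i) → fun x h E.≈ fun y h) →
    (Writable y i e → fun x i E.≈ e) → (¬ Writable y i e → fun x i E.≈ fun y i) → x ≋ write y i e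
  write-unique {x} y i e other same unchanged h with em {h I.≈ i}
  ... | no h≉i  = E.trans (other h≉i) (E.sym (fun-write-other y i e h≉i))
  ... | yes h≈i = E.trans (fun-cong x h≈i) (E.trans at (fun-cong (write y i e) (I.sym h≈i)))
    where
    at : fun x i E.≈ fun (write y i e) i
    at with em {Writable y i e}
    ... | no ¬w = unchanged ¬w
    ... | yes w with em {i I.≈ i}
    ...   | yes _ = same w
    ...   | no ¬p = contradiction I.refl ¬p

  write-cong : ∀ {x y i j d e} → x ≋ y → i I.≈ j → d E.≈ e → write x i d ≋ write y j e
  write-cong {x} {y} {i} {j} {d} {e} x≋y i≈j d≈e = write-unique {write x i d} y j e
    (λ {h} h≉j → E.trans (fun-write-other x i d (λ p → h≉j (I.trans p i≈j))) (x≋y h))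
    (λ (e≉⊥ , r) → E.trans (fun-cong (write x i d) (I.sym i≈j)) (E.trans
      (fun-write-same x i d ((λ p → e≉⊥ (E.trans (E.sym d≈e) p)) , InRange-resp (len-≈ y x (λ h → E.sym (x≋y h))) (I.sym i≈j) r)) d≈e))
    (λ ¬w → E.trans (fun-write-out x i d
      (λ (d≉⊥ , r) → ¬w ((λ p → d≉⊥ (E.trans d≈e p)) , InRange-resp (len-≈ x y x≋y) i≈j r)) j) (x≋y j))

  maximal : (P : I.Carrier → Set) (hs : List I.Carrier) → Any P hs →
    ∃ λ m → P m × All (λ h → P h → h I.≤ m) hs
  maximal P (h ∷ hs) p with em {Any P hs}
  maximal P (h ∷ hs) (here p)  | no ¬q = h , p , (λ _ → ≤-refl) ∷ All.tabulate (λ g∈ pg → contradiction (lose g∈ pg) ¬q)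
  maximal P (h ∷ hs) (there q) | no ¬q = contradiction q ¬q
  maximal P (h ∷ hs) _         | yes q with m , pm , ub ← maximal P hs q with em {h I.≤ m}
  ... | yes h≤m = m , pm , (λ _ → h≤m) ∷ ub
  ... | no h≰m with em {P h}
  ...   | yes ph = h , ph , (λ _ → ≤-refl) ∷ All.map (λ le pg → ≤-trans (le pg) (proj₁ (≰⇒> h≰m))) ub
  ...   | no ¬ph = m , pm , (λ ph → contradiction ph ¬ph) ∷ ub

  module _ (x y : Array) where

    Differ : I.Carrier → Set
    Differ h = ¬ (fun x h E.≈ fun y h)

    IsDiff : I.Carrier → Set
    IsDiff d = Differ d × (∀ {h} → d I.< h → fun x h E.≈ fun y h)

    candidates : List I.Carrier
    candidates = len x ∷ len y ∷ support x ++ support y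

    -- Outside the supports both arrays are el in their range and bottom elsewhere, so if they
    -- differ at `h` then `h` is in the range of exactly one. The length of that one is at least `h`
    -- and beyond the other range, so they differ there as well.
    candidate-above : ∀ h → Differ h → ∃ λ g → g ∈ candidates × h I.≤ g × Differ g
    candidate-above h h≠ with em {Any (h I.≈_) candidates}
    ... | yes h∈ with g , g∈ , h≈g ← find h∈ = g , g∈ , ≤-reflexive h≈g ,
      λ eq → h≠ (E.trans (fun-cong x h≈g) (E.trans eq (fun-cong y (I.sym h≈g))))
    ... | no h∉ with em {InRange (len x) h} | em {InRange (len y) h}
    ...   | yes p | yes q = contradiction (E.trans (generic x h (h∉ ∘ there ∘ there ∘ Any.++⁺ˡ) p)
              (E.sym (generic y h (h∉ ∘ there ∘ there ∘ Any.++⁺ʳ (support x)) q))) h≠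
    ...   | no ¬p | no ¬q = contradiction (E.trans (out x ¬p) (E.sym (out y ¬q))) h≠
    ...   | yes p | no ¬q = len x , here refl , proj₂ p , λ eq → inRange x (len x) (len-nonneg x , ≤-refl)
              (E.trans eq (out y (λ r → ¬q (proj₁ p , ≤-trans (proj₂ p) (proj₂ r)))))
    ...   | no ¬p | yes q = len y , there (here refl) , proj₂ q , λ eq → inRange y (len y) (len-nonneg y , ≤-refl)
              (E.trans (E.sym eq) (out x (λ r → ¬p (proj₁ q , ≤-trans (proj₂ q) (proj₂ r)))))

    isDiff-exists : ¬ (x ≋ y) → ∃ IsDiff
    isDiff-exists x≇y with m , m≠ , ub ← maximal Differ candidates
      (decidable-stable em (λ none → x≇y (λ h → decidable-stable em (λ h≠ →
        let g , g∈ , _ , g≠ = candidate-above h h≠ in none (lose g∈ g≠))))) =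
      m , m≠ , λ {h} m<h → decidable-stable em (λ h≠ →
        let g , g∈ , h≤g , g≠ = candidate-above h h≠ in <⇒≱ m<h (≤-trans h≤g (All.lookup ub g∈ g≠)))

    isDiff-unique : ∀ {d d′} → IsDiff d → IsDiff d′ → d I.≈ d′
    isDiff-unique (d≠ , above) (d′≠ , above′) =
      ≤-antisym (≮⇒≥ (λ lt → d≠ (above′ lt))) (≮⇒≥ (λ lt → d′≠ (above lt)))

    diff′ : Dec (x ≋ y) → I.Carrier
    diff′ (yes _)  = I.0ᴹ
    diff′ (no x≇y) = proj₁ (isDiff-exists x≇y)

    diffᴹ : I.Carrier
    diffᴹ = diff′ em

    diff-≋ : x ≋ y → diffᴹ I.≈ I.0ᴹ
    diff-≋ x≋y with em {x ≋ y}
    ... | yes _  = I.refl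
    ... | no x≇y = contradiction x≋y x≇y

    diff-isDiff : ¬ (x ≋ y) → IsDiff diffᴹ
    diff-isDiff x≇y with em {x ≋ y}
    ... | yes x≋y = contradiction x≋y x≇y
    ... | no x≇y  = proj₂ (isDiff-exists x≇y)

  diffᴹ-cong : ∀ {x x′ y y′} → x ≋ x′ → y ≋ y′ → diffᴹ x y I.≈ diffᴹ x′ y′
  diffᴹ-cong {x} {x′} {y} {y′} x≋ y≋ with em {x ≋ y}
  ... | yes x≋y = I.sym (diff-≋ x′ y′ (λ h → E.trans (E.sym (x≋ h)) (E.trans (x≋y h) (y≋ h))))
  ... | no x≇y with d≠ , above ← proj₂ (isDiff-exists x y x≇y) = isDiff-unique x′ y′
    ((λ eq → d≠ (E.trans (x≋ _) (E.trans eq (E.sym (y≋ _))))) ,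
     (λ lt → E.trans (E.sym (x≋ _)) (E.trans (above lt) (y≋ _))))
    (diff-isDiff x′ y′ (λ x′≋y′ → x≇y (λ h → E.trans (x≋ h) (E.trans (x′≋y′ h) (E.sym (y≋ h))))))

  -- The second premise also covers equal arrays, whose difference is 0 by convention. If the arrays
  -- agree at `d`, then `d` is 0 and all indices below are negative, where both are bottom; so they
  -- are equal.
  diff-unique : ∀ x y {d} → (∀ {h} → d I.< h → fun x h E.≈ fun y h) →
    (fun x d E.≈ fun y d → d I.≈ I.0ᴹ) → diffᴹ x y I.≈ d
  diff-unique x y {d} above zeroAt with em {x ≋ y}
  ... | yes x≋y = I.sym (zeroAt (x≋y d))
  ... | no x≇y = isDiff-unique x y (proj₂ (isDiff-exists x y x≇y)) ((λ eq → x≇y (all eq)) , above)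
    where
    all : fun x d E.≈ fun y d → x ≋ y
    all eq h with em {d I.< h}
    ... | yes d<h = above d<h
    ... | no d≮h with em {d I.≈ h}
    ...   | yes d≈h = E.trans (fun-cong x (I.sym d≈h)) (E.trans eq (fun-cong y d≈h))
    ...   | no d≉h = E.trans (out x negative) (E.sym (out y negative))
      where
      negative : ∀ {l} → ¬ InRange l h
      negative (0≤h , _) = d≉h (≤-antisym (≤-trans (≤-reflexive (zeroAt eq)) 0≤h) (≮⇒≥ d≮h))

  model : Card.CardModel theory
  model = record
    { indexModel = indexModel
    ; arraySetoid = arraySetoid
    ; elemSetoid = elemSetoid
    ; rdᴹ = fun
    ; wrᴹ = write
    ; diffᴹ = diffᴹ
    ; ∣_∣ = len
    ; botᴹ = bot
    ; elᴹ = el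
    ; rd-cong = λ {x} {y} {i} {j} x≋y i≈j → E.trans (x≋y i) (fun-cong y i≈j)
    ; wr-cong = λ {x} {y} → write-cong {x} {y}
    ; diff-cong = λ {x} {x′} {y} {y′} → diffᴹ-cong {x} {x′} {y} {y′}
    ; len-cong = λ {x} {y} → len-≈ x y
    ; len-wr = len-write
    ; wr-bot = λ y i → fun-write-out y i bot (λ (⊥≉⊥ , _) → ⊥≉⊥ E.refl)
    ; rd-wr-same = fun-write-same
    ; rd-wr-diff = λ y i j e i≉j → fun-write-other y i e (i≉j ∘ I.sym)
    ; rd-defined = defined
    ; defined-rd = inRange
    ; len-nonneg = len-nonneg
    ; diff-refl = λ y → diff-≋ y y (λ _ → E.refl)
    ; rd-diff = λ x y x≇y → proj₁ (diff-isDiff x y x≇y)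
    ; diff-max = diff-max
    ; bot≉el = bot≉el
    }
    where
    diff-max : ∀ x y i → diffᴹ x y I.< i → fun x i E.≈ fun y i
    diff-max x y i lt with em {x ≋ y}
    ... | yes x≋y = x≋y i
    ... | no x≇y  = proj₂ (proj₂ (isDiff-exists x y x≇y)) lt

-- Gluing the two sides

module Gluing (em : ExcludedMiddle 0ℓ) (T : IndexTheory)
  (M : EUF.EUFModel (IndexTheory.theory T) (Separated.Name (IndexTheory.signature T))) where
  open IndexTheory T using (theory; signature)
  open CardSyntax signature
  open Separated signature using (⌜_⌝; diffₖ; ⟨_⟩; ⟨_⟩ᴱ)
  open Algorithm signature using (cstᴵ; cstᴱ; flatten; flattenᵃ)
  open Naming signature using (_◁_; fn-arg; len-array; diff-left; diff-right; wr-array; wr-index; wr-value;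
    rd-array; rd-index; index-terms; array-terms; elem-terms)
  open EUF.EUFModel M
  open IndexOrder em T indexModel
  open FiniteArrays em T indexModel elemSetoid botᴹ elᴹ bot≉el using
    (Array; InRange; InRange-resp; model; len-≈; write-cong; write-unique; diffᴹ; diff-≋; diff-isDiff; diff-unique)

  ι : Term INDEX → I.Carrier
  ι t = I.⟦ ⟨ cstᴵ t ⟩ ⟧ indexᴹ

  ε : Term ELEM → E.Carrier
  ε e = ⟦ ⟨ cstᴱ e ⟩ᴱ ⟧ᵉ

  ℓ : Term ARRAY → I.Carrier
  ℓ a = indexᴹ ⌜ len a ⌝

  δ : Term ARRAY → Term ARRAY → I.Carrier
  δ a b = indexᴹ ⌜ diff a b ⌝

  κ : Term ARRAY → Term ARRAY → ℕ → I.Carrier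
  κ a b n = indexᴹ (diffₖ n ⌜ a ⌝ ⌜ b ⌝)

  infix 9 _at_

  _at_ : Term ARRAY → I.Carrier → E.Carrier
  a at h = funᴹ ⌜ a ⌝ h

  -- What remains of equal lengths across a difference below `h`: the lengths may differ, but `h` is
  -- in the range of both or of neither.
  SameLength : I.Carrier → Term ARRAY → Term ARRAY → Set
  SameLength h a b = ℓ a I.≈ ℓ b ⊎ (ℓ a I.< h × ℓ b I.< h)

  SameLength-isEquivalence : ∀ {h} → IsEquivalence (SameLength h)
  SameLength-isEquivalence {h} = record
    { refl = inj₁ I.refl
    ; sym = Sum.map I.sym (λ (p , q) → q , p)
    ; trans = trans-length
    }
    where
    trans-length : ∀ {a b c} → SameLength h a b → SameLength h b c → SameLength h a c
    trans-length (inj₁ p)       (inj₁ q)       = inj₁ (I.trans p q)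
    trans-length (inj₁ p)       (inj₂ (q , r)) = inj₂ (≤-<-trans (≤-reflexive p) q , r)
    trans-length (inj₂ (p , q)) (inj₁ r)       = inj₂ (p , ≤-<-trans (≤-reflexive (I.sym r)) q)
    trans-length (inj₂ (p , _)) (inj₂ (_ , q)) = inj₂ (p , q)

  SameLength-InRange : ∀ {h a b} → SameLength h a b → InRange (ℓ a) h → InRange (ℓ b) h
  SameLength-InRange (inj₁ eq)      r         = InRange-resp eq I.refl r
  SameLength-InRange (inj₂ (p , _)) (_ , h≤l) = contradiction h≤l (<⇒≱ p)

  record DiffChain (Covered : I.Carrier → Set) (N : ℕ) (a b : Term ARRAY) : Set where
    field
      κ-covered : ∀ {j} → j ℕ.≤ N → Covered (κ a b j)
      κ-mono    : ∀ {j} → j ℕ.< N → κ a b (suc j) I.≤ κ a b j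
      κ-stable  : ∀ {j} → j ℕ.< N → ℓ a I.≈ ℓ b → κ a b j I.≈ κ a b (suc j) → κ a b j I.≈ I.0ᴹ
      κ-zero    : ∀ {j} → j ℕ.≤ N → a at κ a b j E.≈ b at κ a b j → κ a b j I.≈ I.0ᴹ
      κ-left    : ℓ b I.< ℓ a → κ a b N I.≈ ℓ a
      κ-right   : ℓ a I.< ℓ b → κ a b N I.≈ ℓ b
      κ-above   : ∀ {h} → Covered h → κ a b N I.< h →
                  a at h E.≈ b at h ⊎ (∃ λ j → j ℕ.< N × h I.≈ κ a b j)

  -- What the instances for one of the two formulae say about M at the finitely
  -- many covered indices.  N is one less than in the paper, so that the iterated
  -- differences are κ a b 0, …, κ a b N.
  record Side (N : ℕ) (Common : Term ARRAY → Set) : Set₁ where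
    field
      Named      : ∃ Term → Set
      covered    : List I.Carrier
      writes     : List I.Carrier
      few-writes : length writes ℕ.≤ N

    Covered : I.Carrier → Set
    Covered h = Any (h I.≈_) covered

    field
      named-closed : ∀ {c t} → c ◁ t → Named t → Named c

      zero-covered : Covered I.0ᴹ
      len-covered  : ∀ {a} → Named (ARRAY , a) → Covered (ℓ a)
      diff-covered : ∀ {a b} → Named (INDEX , diff a b) → Covered (δ a b)
      wr-covered   : ∀ {b i e} → Named (ARRAY , wr b i e) → Covered (ι i)
      rd-covered   : ∀ {a i} → Named (ELEM , rd a i) → Covered (ι i)
      wr-counted   : ∀ {b i e} → Named (ARRAY , wr b i e) → Any (ι i I.≈_) writes

      fn-value : ∀ {f ts} → Named (INDEX , fn f ts) → indexᴹ ⌜ fn f ts ⌝ I.≈ I.fnᴹ f (Vec.map ι ts)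
      rd-value : ∀ {a i} → Named (ELEM , rd a i) → a at ι i E.≈ ε (rd a i)

      len-nonneg : ∀ {a} → Named (ARRAY , a) → I.0ᴹ I.≤ ℓ a
      defined    : ∀ {a h} → Named (ARRAY , a) → Covered h → (¬ (a at h E.≈ botᴹ)) ⇔ InRange (ℓ a) h

      wr-same  : ∀ {b i e} → Named (ARRAY , wr b i e) →
                 ¬ (ε e E.≈ botᴹ) × InRange (ℓ b) (ι i) → wr b i e at ι i E.≈ ε e
      wr-out   : ∀ {b i e} → Named (ARRAY , wr b i e) →
                 ¬ (¬ (ε e E.≈ botᴹ) × InRange (ℓ b) (ι i)) → wr b i e at ι i E.≈ b at ι i
      wr-other : ∀ {b i e h} → Named (ARRAY , wr b i e) → Covered h → ¬ (h I.≈ ι i) →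
                 wr b i e at h E.≈ b at h

      diff-zero   : ∀ {a b} → Named (INDEX , diff a b) → a at δ a b E.≈ b at δ a b → δ a b I.≈ I.0ᴹ
      diff-above  : ∀ {a b h} → Named (INDEX , diff a b) → Covered h → δ a b I.< h → a at h E.≈ b at h
      δ-left      : ∀ {a b} → Named (INDEX , diff a b) → ℓ b I.< ℓ a → δ a b I.≈ ℓ a
      δ-right  : ∀ {a b} → Named (INDEX , diff a b) → ℓ a I.< ℓ b → δ a b I.≈ ℓ b

      diff-chain : ∀ {a b} → Common a → Common b → ¬ (a ≡ b) → DiffChain Covered N a b

    covered-resp : ∀ {h h′} → h I.≈ h′ → Covered h → Covered h′
    covered-resp h≈h′ = Any.map (I.trans (I.sym h≈h′))

    -- A step at an index h that is not covered forces a and b to agree at h.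
    data Step (h : I.Carrier) : Term ARRAY → Term ARRAY → Set where
      by-wr   : ∀ {b i e} → Named (ARRAY , wr b i e) → Step h (wr b i e) b
      by-diff : ∀ {a b} → Named (INDEX , diff a b) → δ a b I.< h → Step h a b

    Step-resp : ∀ {h h′ a b} → h I.≈ h′ → Step h a b → Step h′ a b
    Step-resp h≈h′ (by-wr n)                = by-wr n
    Step-resp h≈h′ (by-diff n (le , neq))   = by-diff n (I.≤-resp I.refl h≈h′ le , λ eq → neq (I.trans eq (I.sym h≈h′)))

    wr-at : ∀ {b i e h} → Named (ARRAY , wr b i e) → Covered h →
      wr b i e at h E.≈ b at h ⊎ (InRange (ℓ b) h × ¬ (wr b i e at h E.≈ botᴹ))
    wr-at {b} {i} {e} {h} n c with em {h I.≈ ι i}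
    ... | no h≉i = inj₁ (wr-other n c h≉i)
    ... | yes h≈i with em {¬ (ε e E.≈ botᴹ) × InRange (ℓ b) (ι i)}
    ...   | yes p@(e≉⊥ , r) = inj₂ (InRange-resp I.refl (I.sym h≈i) r ,
              λ eq → e≉⊥ (E.trans (E.sym (wr-same n p)) (E.trans (fun-cong _ (I.sym h≈i)) eq)))
    ...   | no ¬p = inj₁ (E.trans (fun-cong _ h≈i) (E.trans (wr-out n ¬p) (fun-cong _ (I.sym h≈i))))

    -- No instance equates these lengths. Each is a covered index at which its own array is defined,
    -- and `wr-at` carries this over to the other array.
    len-wr : ∀ {b i e} → Named (ARRAY , wr b i e) → ℓ (wr b i e) I.≈ ℓ b
    len-wr {b} {i} {e} n = ≤-antisym ≤b b≤
      where
      a = wr b i e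
      nb = named-closed wr-array n

      a-def : ¬ (a at ℓ a E.≈ botᴹ)
      a-def = from (defined n (len-covered n)) (len-nonneg n , ≤-refl)

      b-def : ¬ (b at ℓ b E.≈ botᴹ)
      b-def = from (defined nb (len-covered nb)) (len-nonneg nb , ≤-refl)

      ≤b : ℓ a I.≤ ℓ b
      ≤b with wr-at n (len-covered n)
      ... | inj₁ eq = proj₂ (to (defined nb (len-covered n)) (a-def ∘ E.trans eq))
      ... | inj₂ (r , _) = proj₂ r

      b≤ : ℓ b I.≤ ℓ a
      b≤ with wr-at n (len-covered nb)
      ... | inj₁ eq = proj₂ (to (defined n (len-covered nb)) (b-def ∘ E.trans (E.sym eq)))
      ... | inj₂ (_ , def) = proj₂ (to (defined n (len-covered nb)) def)

    -- For unequal lengths the difference is the greater one, so `δ a b < h` puts both below `h`.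
    step-length : ∀ {h a b} → Step h a b → SameLength h a b
    step-length (by-wr n) = inj₁ (len-wr n)
    step-length {h} {a} {b} (by-diff n δ<h) with em {ℓ a I.≈ ℓ b}
    ... | yes eq = inj₁ eq
    ... | no neq with ≉⇒<> neq
    ...   | inj₁ la<lb with lb<h ← ≤-<-trans (≤-reflexive (I.sym (δ-right n la<lb))) δ<h =
            inj₂ (≤-<-trans (proj₁ la<lb) lb<h , lb<h)
    ...   | inj₂ lb<la with la<h ← ≤-<-trans (≤-reflexive (I.sym (δ-left n lb<la))) δ<h =
            inj₂ (la<h , ≤-<-trans (proj₁ lb<la) la<h)

    -- Exempting one fixed set, all write indices of the side, makes the relation transitive: a path
    -- of any length has no further exceptions.
    AgreeAbove : I.Carrier → Term ARRAY → Term ARRAY → Set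
    AgreeAbove h a b = ∀ {m} → Covered m → h I.< m → a at m E.≈ b at m ⊎ Any (m I.≈_) writes

    step-agree : ∀ {h a b} → Step h a b → AgreeAbove h a b
    step-agree (by-wr {i = i} n) {m} c _ with em {m I.≈ ι i}
    ... | yes m≈i = inj₂ (Any.map (I.trans m≈i) (wr-counted n))
    ... | no m≉i  = inj₁ (wr-other n c m≉i)
    step-agree (by-diff n δ<h) c h<m = inj₁ (diff-above n c (<-≤-trans δ<h (proj₁ h<m)))

    -- An empty path tells nothing about naming; the first alternative is there for reflexivity.
    SameOrNamed : Term ARRAY → Term ARRAY → Set
    SameOrNamed a b = a ≡ b ⊎ (Named (ARRAY , a) × Named (ARRAY , b))

    step-named : ∀ {h a b} → Step h a b → SameOrNamed a b
    step-named (by-wr n)     = inj₂ (n , named-closed wr-array n)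
    step-named (by-diff n _) = inj₂ (named-closed diff-left n , named-closed diff-right n)

    Linked : I.Carrier → Term ARRAY → Term ARRAY → Set
    Linked h a b = SameOrNamed a b × SameLength h a b × AgreeAbove h a b

    Linked-isEquivalence : ∀ {h} → IsEquivalence (Linked h)
    Linked-isEquivalence = record
      { refl = inj₁ refl , L.refl , λ _ _ → inj₁ E.refl
      ; sym = λ (n , l , v) →
          Sum.map sym (λ (p , q) → q , p) n ,
          L.sym l ,
          λ c h<m → Sum.map₁ E.sym (v c h<m)
      ; trans = λ (n , l , v) (n′ , l′ , v′) →
          trans-named n n′ , L.trans l l′ ,
          λ c h<m → [ (λ p → Sum.map₁ (E.trans p) (v′ c h<m)) , inj₂ ]′ (v c h<m)
      }
      where
      module L = IsEquivalence SameLength-isEquivalence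

      trans-named : ∀ {a b c} → SameOrNamed a b → SameOrNamed b c → SameOrNamed a c
      trans-named (inj₁ refl)    q              = q
      trans-named p              (inj₁ refl)    = p
      trans-named (inj₂ (p , _)) (inj₂ (_ , q)) = inj₂ (p , q)

    linked : ∀ {h a b} → EqClosure (Step h) a b → Linked h a b
    linked = EqC.fold Linked-isEquivalence λ s → step-named s , step-length s , step-agree s

  module _ {N : ℕ} {Common : Term ARRAY → Set} (𝓐 𝓑 : Side N Common) where
    private
      module 𝓐 = Side 𝓐
      module 𝓑 = Side 𝓑

    -- If a and b differ at h, then h lies below all iterated differences κ a b j,
    -- which are then N + 1 distinct write indices of 𝓐; but 𝓐 has at most N.
    consistent-across : (∀ {a} → 𝓐.Named (ARRAY , a) → 𝓑.Named (ARRAY , a) → Common a) →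
      ∀ {h a b} → ¬ 𝓐.Covered h → 𝓑.Covered h → 𝓑.Named (ARRAY , a) → 𝓑.Named (ARRAY , b) →
      EqClosure (𝓐.Step h) a b → a at h E.≈ b at h
    consistent-across common {h} {a} {b} ¬ch ch na nb path with 𝓐.linked path
    ... | inj₁ refl , _ = E.refl
    ... | inj₂ (na′ , nb′) , sameLength , agreeAbove with em {a ≡ b}
    ...   | yes refl = E.refl
    ...   | no a≢b = decidable-stable em impossible
      where
      module CA = DiffChain (𝓐.diff-chain (common na′ na) (common nb′ nb) a≢b)
      module CB = DiffChain (𝓑.diff-chain (common na′ na) (common nb′ nb) a≢b)
      k : ℕ → I.Carrier
      k = κ a b

      impossible : ¬ ¬ (a at h E.≈ b at h)
      impossible a≉b = clash sameLength
        where
        k-covered : ∀ {j} → j ℕ.≤ N → 𝓐.Covered (k j)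
        k-covered = CA.κ-covered

        -- `𝓑` covers `h`, and its instance at `h` excludes `k N < h` unless `h` is an earlier
        -- `k j`. But every `k j` is covered by `𝓐`, and `h` is not.
        h<kN : h I.< k N
        h<kN = ≮⇒≥ (λ lt → [ a≉b , (λ (j , j<N , eq) →
            ¬ch (𝓐.covered-resp (I.sym eq) (k-covered (ℕ.<⇒≤ j<N)))) ]′ (CB.κ-above ch lt)) ,
          (λ eq → ¬ch (𝓐.covered-resp (I.sym eq) (k-covered ℕ.≤-refl)))

        -- Otherwise both arrays are bottom at `h`. It follows that the `k j`, lying above `h`, are
        -- not 0.
        0≤h : I.0ᴹ I.≤ h
        0≤h = decidable-stable em λ neg → a≉b (E.trans
          (decidable-stable em (λ d → neg (proj₁ (to (𝓑.defined na ch) d))))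
          (E.sym (decidable-stable em (λ d → neg (proj₁ (to (𝓑.defined nb ch) d))))))

        k-anti : ∀ {i j} → i ℕ.≤′ j → j ℕ.≤ N → k j I.≤ k i
        k-anti ℕ.≤′-refl       _   = ≤-refl
        k-anti (ℕ.≤′-step i≤j) j<N = ≤-trans (CA.κ-mono j<N) (k-anti i≤j (ℕ.<⇒≤ j<N))

        h<k : ∀ {j} → j ℕ.≤ N → h I.< k j
        h<k j≤N = <-≤-trans h<kN (k-anti (ℕ.≤⇒≤′ j≤N) ℕ.≤-refl)

        k≉0 : ∀ {j} → j ℕ.≤ N → ¬ (k j I.≈ I.0ᴹ)
        k≉0 j≤N eq = <⇒≱ (h<k j≤N) (≤-trans (≤-reflexive eq) 0≤h)

        -- As `k j` is not 0, the arrays differ there, and `agreeAbove` leaves only a write index.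
        k-written : ∀ {j} → j ℕ.≤ N → Any (k j I.≈_) 𝓐.writes
        k-written j≤N = [ (λ eq → contradiction (CA.κ-zero j≤N eq) (k≉0 j≤N)) , id ]′
          (agreeAbove (k-covered j≤N) (h<k j≤N))

        -- If two members of a non-increasing sequence coincide, so do two consecutive ones, and for
        -- equal lengths their value is then 0.
        k-strict : ℓ a I.≈ ℓ b → ∀ {i j} → i ℕ.< j → j ℕ.≤ N → ¬ (k i I.≈ k j)
        k-strict la≈lb {i} {j} i<j j≤N eq =
          k≉0 (ℕ.<⇒≤ i<N) (CA.κ-stable i<N la≈lb (≤-antisym
            (≤-trans (≤-reflexive eq) (k-anti (ℕ.≤⇒≤′ i<j) j≤N)) (CA.κ-mono i<N)))
          where i<N = ℕ.<-≤-trans i<j j≤N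

        bound : (i : Fin (suc N)) → toℕ i ℕ.≤ N
        bound = Fin.toℕ≤pred[n]

        clash : ¬ SameLength h a b
        clash (inj₁ la≈lb)
          -- The N + 1 indices `k 0`, ..., `k N` are mapped to at most N positions in `writes`.
          with i , j , i<j , eq ← Fin.pigeonhole (s≤s 𝓐.few-writes) (λ i → Any.index (k-written (bound i))) =
          k-strict la≈lb i<j (bound j) (I.trans (Any.lookup-index (k-written (bound i)))
            (I.trans (I.reflexive (cong (lookup 𝓐.writes) eq)) (I.sym (Any.lookup-index (k-written (bound j))))))
        -- For unequal lengths `k N` is the greater length, which is below `h`, against `h < k N`.
        clash (inj₂ (la<h , lb<h)) with em {ℓ a I.≈ ℓ b}
        ... | yes la≈lb = clash (inj₁ la≈lb)
        ... | no la≉lb with ≉⇒<> la≉lb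
        ...   | inj₁ la<lb = <⇒≱ (<-≤-trans lb<h (proj₁ h<kN)) (≤-reflexive (CA.κ-right la<lb))
        ...   | inj₂ lb<la = <⇒≱ (<-≤-trans la<h (proj₁ h<kN)) (≤-reflexive (CA.κ-left lb<la))

  -- The glued arrays and the values of terms

  module _ {N : ℕ} {Common : Term ARRAY → Set} (𝓐 𝓑 : Side N Common)
    (common : ∀ {a} → Side.Named 𝓐 (ARRAY , a) → Side.Named 𝓑 (ARRAY , a) → Common a) where
    private
      module 𝓐 = Side 𝓐
      module 𝓑 = Side 𝓑

    -- A side contributes steps only at indices it does not cover; at the others `M` itself
    -- satisfies the constraints of that side.
    data Link (h : I.Carrier) (a b : Term ARRAY) : Set where
      linkᴬ : ¬ 𝓐.Covered h → 𝓐.Step h a b → Link h a b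
      linkᴮ : ¬ 𝓑.Covered h → 𝓑.Step h a b → Link h a b

    Link-resp : ∀ {h h′ a b} → h I.≈ h′ → Link h a b → Link h′ a b
    Link-resp h≈h′ (linkᴬ ¬c s) = linkᴬ (¬c ∘ 𝓐.covered-resp (I.sym h≈h′)) (𝓐.Step-resp h≈h′ s)
    Link-resp h≈h′ (linkᴮ ¬c s) = linkᴮ (¬c ∘ 𝓑.covered-resp (I.sym h≈h′)) (𝓑.Step-resp h≈h′ s)

    link-length : ∀ {h a b} → Link h a b → SameLength h a b
    link-length (linkᴬ _ s) = 𝓐.step-length s
    link-length (linkᴮ _ s) = 𝓑.step-length s

    Path : I.Carrier → Term ARRAY → Term ARRAY → Set
    Path h = EqClosure (Link h)

    path-length : ∀ {h a b} → Path h a b → SameLength h a b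
    path-length = EqC.fold SameLength-isEquivalence link-length

    data Anchor (h : I.Carrier) (a : Term ARRAY) : Set where
      anchorᴬ : 𝓐.Named (ARRAY , a) → 𝓐.Covered h → Anchor h a
      anchorᴮ : 𝓑.Named (ARRAY , a) → 𝓑.Covered h → Anchor h a

    Anchor-resp : ∀ {h h′ a} → h I.≈ h′ → Anchor h a → Anchor h′ a
    Anchor-resp h≈h′ (anchorᴬ n c) = anchorᴬ n (𝓐.covered-resp h≈h′ c)
    Anchor-resp h≈h′ (anchorᴮ n c) = anchorᴮ n (𝓑.covered-resp h≈h′ c)

    anchor-defined : ∀ {h a} → Anchor h a → (¬ (a at h E.≈ botᴹ)) ⇔ InRange (ℓ a) h
    anchor-defined (anchorᴬ n c) = 𝓐.defined n c
    anchor-defined (anchorᴮ n c) = 𝓑.defined n c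

    -- Covered by both sides: there are no links and the path is empty. Covered by neither: there
    -- are no anchors. Covered by one: the anchors belong to that side and the links to the other,
    -- as `consistent-across` requires.
    consistent : ∀ {h a b} → Anchor h a → Anchor h b → Path h a b → a at h E.≈ b at h
    consistent {h} anc-a anc-b path with em {𝓐.Covered h} | em {𝓑.Covered h}
    ... | yes p | yes q
      with refl ← EqC.fold {S = _≡_} ≡.isEquivalence
        (λ { (linkᴬ ¬p _) → contradiction p ¬p ; (linkᴮ ¬q _) → contradiction q ¬q }) path = E.refl
    consistent (anchorᴬ _ p) _ path | no ¬p | _ = contradiction p ¬p
    consistent _ (anchorᴬ _ p) path | no ¬p | _ = contradiction p ¬p
    consistent (anchorᴮ _ q) _ path | _ | no ¬q = contradiction q ¬q
    consistent _ (anchorᴮ _ q) path | _ | no ¬q = contradiction q ¬q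
    consistent (anchorᴮ na _) (anchorᴮ nb _) path | no ¬p | yes q =
      consistent-across 𝓐 𝓑 common ¬p q na nb
        (EqC.map (λ { (linkᴬ _ s) → s ; (linkᴮ ¬q _) → contradiction q ¬q }) path)
    consistent (anchorᴬ na _) (anchorᴬ nb _) path | yes p | no ¬q =
      consistent-across 𝓑 𝓐 (λ n m → common m n) ¬q p na nb
        (EqC.map (λ { (linkᴮ _ s) → s ; (linkᴬ ¬p _) → contradiction p ¬p }) path)

    Anchored : I.Carrier → Term ARRAY → Set
    Anchored h a = ∃ λ b → Anchor h b × Path h a b

    Anchored-resp : ∀ {h h′ a b} → h I.≈ h′ → Path h a b → Anchored h b → Anchored h′ a
    Anchored-resp h≈h′ path (c , anc , path′) =
      c , Anchor-resp h≈h′ anc , EqC.map (Link-resp h≈h′) (EqC.transitive _ path path′)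

    default : ∀ {l h} → Dec (InRange l h) → E.Carrier
    default (yes _) = elᴹ
    default (no _)  = botᴹ

    default-cong : ∀ {l h l′ h′} → (InRange l h → InRange l′ h′) → (InRange l′ h′ → InRange l h) →
      (d : Dec (InRange l h)) (d′ : Dec (InRange l′ h′)) → default d E.≈ default d′
    default-cong f g (yes _) (yes _) = E.refl
    default-cong f g (yes p) (no ¬q) = contradiction (f p) ¬q
    default-cong f g (no ¬p) (yes q) = contradiction (g q) ¬p
    default-cong f g (no _)  (no _)  = E.refl

    default-defined : ∀ {l h} (d : Dec (InRange l h)) → (¬ (default d E.≈ botᴹ)) ⇔ InRange l h
    default-defined (yes p) = mk⇔ (λ _ → p) (λ _ eq → bot≉el (E.sym eq))
    default-defined (no ¬p) = mk⇔ (λ ≉⊥ → contradiction E.refl ≉⊥) (λ p → contradiction p ¬p)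

    -- By `consistent` the choice of the anchored array does not matter. The default respects paths
    -- because membership in the range does.
    value′ : ∀ {a h} → Dec (Anchored h a) → E.Carrier
    value′ {a} {h} (yes (b , _)) = b at h
    value′ {a} {h} (no _)        = default (em {InRange (ℓ a) h})

    value : Term ARRAY → I.Carrier → E.Carrier
    value a h = value′ {a} {h} em

    value-anchor : ∀ {a h} → Anchor h a → value a h E.≈ a at h
    value-anchor {a} {h} anc with em {Anchored h a}
    ... | yes (b , anc′ , path) = E.sym (consistent anc anc′ path)
    ... | no ¬anc = contradiction (a , anc , EqC.reflexive _) ¬anc

    -- With the empty path this gives functions that respect equality of indices; with `h` fixed it
    -- gives the agreement demanded by steps at uncovered indices.
    value-cong : ∀ {a b h h′} → h I.≈ h′ → Path h a b → value a h E.≈ value b h′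
    value-cong {a} {b} {h} {h′} h≈h′ path with em {Anchored h a} | em {Anchored h′ b}
    ... | yes (c , anc , p) | yes (d , anc′ , q) = E.trans
      (consistent anc (Anchor-resp (I.sym h≈h′) anc′)
        (EqC.transitive _ (EqC.symmetric _ p) (EqC.transitive _ path (EqC.map (Link-resp (I.sym h≈h′)) q))))
      (fun-cong ⌜ d ⌝ h≈h′)
    ... | yes anc | no ¬anc = contradiction (Anchored-resp h≈h′ (EqC.symmetric _ path) anc) ¬anc
    ... | no ¬anc | yes (d , anc , q) = contradiction
      (Anchored-resp I.refl path (Anchored-resp (I.sym h≈h′) (EqC.reflexive _) (d , anc , q))) ¬anc
    ... | no _ | no _ = default-cong
      (InRange-resp I.refl h≈h′ ∘ SameLength-InRange (path-length path))
      (SameLength-InRange (path-length (EqC.symmetric _ path)) ∘ InRange-resp I.refl (I.sym h≈h′)) em em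

    value-defined : ∀ {a h} → (¬ (value a h E.≈ botᴹ)) ⇔ InRange (ℓ a) h
    value-defined {a} {h} with em {Anchored h a}
    ... | no _ = default-defined em
    ... | yes (b , anc , path) = mk⇔
      (SameLength-InRange (path-length (EqC.symmetric _ path)) ∘ to (anchor-defined anc))
      (from (anchor-defined anc) ∘ SameLength-InRange (path-length path))

    value-generic : ∀ {a h} → ¬ Any (h I.≈_) (𝓐.covered ++ 𝓑.covered) → InRange (ℓ a) h → value a h E.≈ elᴹ
    value-generic {a} {h} h∉ r with em {Anchored h a}
    ... | yes (_ , anchorᴬ _ c , _) = contradiction (Any.++⁺ˡ c) h∉
    ... | yes (_ , anchorᴮ _ c , _) = contradiction (Any.++⁺ʳ 𝓐.covered c) h∉
    ... | no _ with em {InRange (ℓ a) h}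
    ...   | yes _ = E.refl
    ...   | no ¬r = contradiction r ¬r

    array : ∀ a → I.0ᴹ I.≤ ℓ a → Array
    array a 0≤l = record
      { fun = value a
      ; fun-cong = λ h≈h′ → value-cong h≈h′ (EqC.reflexive _)
      ; len = ℓ a
      ; len-nonneg = 0≤l
      ; defined = λ h → to value-defined
      ; inRange = λ h → from value-defined
      ; support = 𝓐.covered ++ 𝓑.covered
      ; generic = λ h → value-generic
      }

    -- A filler for array variables with a negative length constant in `M`. The instances exclude
    -- this for named arrays, so neither formula mentions such a variable.
    constant : ∀ l → I.0ᴹ I.≤ l → Array
    constant l 0≤l = record
      { fun = λ h → default (em {InRange l h})
      ; fun-cong = λ h≈h′ → default-cong (InRange-resp I.refl h≈h′) (InRange-resp I.refl (I.sym h≈h′)) em em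
      ; len = l
      ; len-nonneg = 0≤l
      ; defined = λ h → to (default-defined em)
      ; inRange = λ h → from (default-defined em)
      ; support = []
      ; generic = λ h _ → generic em
      }
      where
      generic : ∀ {h} (d : Dec (InRange l h)) → InRange l h → default d E.≈ elᴹ
      generic (yes _) _ = E.refl
      generic (no ¬p) p = contradiction p ¬p

    module C = Card.CardModel model

    arrayOr : ∀ {a} → Dec (I.0ᴹ I.≤ ℓ a) → Array
    arrayOr {a} (yes 0≤l) = array a 0≤l
    arrayOr (no _)        = constant I.0ᴹ ≤-refl

    ρ : C.Assignment
    ρ INDEX x = indexᴹ ⌜ var x ⌝
    ρ ARRAY x = arrayOr {var x} em
    ρ ELEM  x = elemᴹ ⌜ var x ⌝

    open Array using (fun; len)

    -- One argument for both sides: the two premises are all that it uses of the gluing.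
    module Evaluation (𝓢 : Side N Common)
      (value-covered : ∀ {a h} → Side.Named 𝓢 (ARRAY , a) → Side.Covered 𝓢 h → value a h E.≈ a at h)
      (value-step : ∀ {a b h} → ¬ Side.Covered 𝓢 h → Side.Step 𝓢 h a b → value a h E.≈ value b h) where
      open Side 𝓢

      mutual
        ⟦_⟧-index : ∀ t → Named (INDEX , t) → C.⟦ t ⟧ ρ I.≈ ι t
        ⟦ var x ⟧-index    n = I.refl
        ⟦ con c ⟧-index    n = I.refl
        ⟦ fn f ts ⟧-index  n = I.trans (I.fn-cong f (⟦ ts ⟧-indices (λ t∈ → named-closed (fn-arg t∈) n))) (I.sym (fn-value n))
        ⟦ len a ⟧-index    n with na ← named-closed len-array n =
          len-≈ (C.⟦ a ⟧ ρ) (array a (len-nonneg na)) (⟦ a ⟧-array na)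
        -- Above `δ a b` an instance gives agreement at covered indices and a step at the others.
        -- The index `δ a b` is covered, so the values there are those of `M`.
        ⟦ diff a b ⟧-index n = diff-unique (C.⟦ a ⟧ ρ) (C.⟦ b ⟧ ρ) {δ a b}
          (λ {h} lt → E.trans (⟦ a ⟧-array na h) (E.trans (above h lt) (E.sym (⟦ b ⟧-array nb h))))
          (λ eq → diff-zero n (E.trans (E.sym (at-δ {x = C.⟦ a ⟧ ρ} (⟦ a ⟧-array na) na)) (E.trans eq (at-δ {x = C.⟦ b ⟧ ρ} (⟦ b ⟧-array nb) nb))))
          where
          na = named-closed diff-left n
          nb = named-closed diff-right n

          at-δ : ∀ {c x} → (∀ h → fun x h E.≈ value c h) → Named (ARRAY , c) → fun x (δ a b) E.≈ c at δ a b
          at-δ x≈ nc = E.trans (x≈ (δ a b)) (value-covered nc (diff-covered n))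

          above : ∀ h → δ a b I.< h → value a h E.≈ value b h
          above h lt with em {Covered h}
          ... | yes c = E.trans (value-covered na c) (E.trans (diff-above n c lt) (E.sym (value-covered nb c)))
          ... | no ¬c = value-step ¬c (by-diff n lt)

        ⟦_⟧-indices : ∀ {n} (ts : Vec (Term INDEX) n) → (∀ {t} → t Vec.∈ ts → Named (INDEX , t)) →
          Pointwise I._≈_ (C.⟦ ts ⟧* ρ) (Vec.map ι ts)
        ⟦ [] ⟧-indices     n = []
        ⟦ t ∷ ts ⟧-indices n = ⟦ t ⟧-index (n (VecAny.here refl)) ∷ ⟦ ts ⟧-indices (n ∘ VecAny.there)

        ⟦_⟧-array : ∀ t → Named (ARRAY , t) → ∀ h → fun (C.⟦ t ⟧ ρ) h E.≈ value t h
        ⟦ var x ⟧-array    n h with em {I.0ᴹ I.≤ ℓ (var x)}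
        ... | yes _  = E.refl
        ... | no neg = contradiction (len-nonneg n) neg
        ⟦ wr b i e ⟧-array n h = E.trans
          (write-cong {C.⟦ b ⟧ ρ} {b̄} (⟦ b ⟧-array nb) (⟦ i ⟧-index (named-closed wr-index n)) (⟦ e ⟧-elem (named-closed wr-value n)) h)
          -- The index written to is covered, so the conditions on the entry there are the instances
          -- that hold in `M`.
          (E.sym (write-unique {array (wr b i e) (len-nonneg n)} b̄ (ι i) (ε e) other
            (λ w → E.trans (value-covered n c) (wr-same n w))
            (λ ¬w → E.trans (value-covered n c) (E.trans (wr-out n ¬w) (E.sym (value-covered nb c)))) h))
          where
          nb = named-closed wr-array n
          b̄ = array b (len-nonneg nb)
          c = wr-covered n

          other : ∀ {h} → ¬ (h I.≈ ι i) → value (wr b i e) h E.≈ value b h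
          other {h} h≉i with em {Covered h}
          ... | yes c = E.trans (value-covered n c) (E.trans (wr-other n c h≉i) (E.sym (value-covered nb c)))
          ... | no ¬c = value-step ¬c (by-wr n)

        ⟦_⟧-elem : ∀ t → Named (ELEM , t) → C.⟦ t ⟧ ρ E.≈ ε t
        ⟦ var x ⟧-elem  n = E.refl
        ⟦ bot ⟧-elem    n = E.refl
        ⟦ el ⟧-elem     n = E.refl
        ⟦ rd a i ⟧-elem n with na ← named-closed rd-array n = E.trans
          (Array.fun-cong (C.⟦ a ⟧ ρ) (⟦ i ⟧-index (named-closed rd-index n)))
          (E.trans (⟦ a ⟧-array na (ι i)) (E.trans (value-covered na (rd-covered n)) (rd-value n)))

      ⟦_⟧-covered : ∀ a {h} → Named (ARRAY , a) → Covered h → fun (C.⟦ a ⟧ ρ) h E.≈ a at h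
      ⟦ a ⟧-covered n c = E.trans (⟦ a ⟧-array n _) (value-covered n c)

      flatten-holds : ∀ X → (∀ {t} → t ∈ Algorithm.terms signature X → Named t) → (ρ C.⊨ X) ⇔ (⊨ flatten X)
      flatten-holds X named = Holds-bind flattenᵃ X (λ {α} → atom-holds α)
        where
        atom-holds : ∀ α → α ∈ atoms X → C.Holdsᶜ ρ α ⇔ (⊨ flattenᵃ α)
        atom-holds (index α) α∈ = Holdsᴬ-map I.structure _ α (λ {t} t∈ → ⟦ t ⟧-index (named (index-terms X α∈ t∈)))
        atom-holds (elem≐ d e) α∈ with nd , ne ← elem-terms X α∈
          with d≈ ← ⟦ d ⟧-elem (named nd) | e≈ ← ⟦ e ⟧-elem (named ne) = mk⇔
          (λ eq → E.trans (E.sym d≈) (E.trans eq e≈))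
          (λ eq → E.trans d≈ (E.trans eq (E.sym e≈)))
        atom-holds (array≐ a b) α∈ = mk⇔
          (λ eq → I.trans (I.sym diff≈) (diff-≋ ā b̄ eq) ,
                  E.trans (E.sym a₀) (E.trans (eq I.0ᴹ) b₀))
          -- Unequal arrays would differ at their difference 0. As 0 is covered, their values there
          -- are those of `M`, which agree.
          (λ (δ≈0 , eq) → decidable-stable em λ a≇b →
            proj₁ (diff-isDiff ā b̄ a≇b) (move (I.trans diff≈ δ≈0) (E.trans a₀ (E.trans eq (E.sym b₀)))))
          where
          n = named (array-terms X α∈)
          ā = C.⟦ a ⟧ ρ
          b̄ = C.⟦ b ⟧ ρ
          diff≈ : diffᴹ ā b̄ I.≈ δ a b
          diff≈ = ⟦ diff a b ⟧-index n

          a₀ : fun ā I.0ᴹ E.≈ a at I.0ᴹ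
          a₀ = ⟦ a ⟧-covered (named-closed diff-left n) zero-covered

          b₀ : fun b̄ I.0ᴹ E.≈ b at I.0ᴹ
          b₀ = ⟦ b ⟧-covered (named-closed diff-right n) zero-covered

          move : ∀ {h h′} → h I.≈ h′ → fun ā h′ E.≈ fun b̄ h′ → fun ā h E.≈ fun b̄ h
          move h≈ eq = E.trans (Array.fun-cong ā h≈) (E.trans eq (E.sym (Array.fun-cong b̄ h≈)))

    value-coveredᴬ : ∀ {a h} → 𝓐.Named (ARRAY , a) → 𝓐.Covered h → value a h E.≈ a at h
    value-coveredᴬ n c = value-anchor (anchorᴬ n c)

    value-coveredᴮ : ∀ {a h} → 𝓑.Named (ARRAY , a) → 𝓑.Covered h → value a h E.≈ a at h
    value-coveredᴮ n c = value-anchor (anchorᴮ n c)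

    value-stepᴬ : ∀ {a b h} → ¬ 𝓐.Covered h → 𝓐.Step h a b → value a h E.≈ value b h
    value-stepᴬ ¬c s = value-cong I.refl (EqC.return (linkᴬ ¬c s))

    value-stepᴮ : ∀ {a b h} → ¬ 𝓑.Covered h → 𝓑.Step h a b → value a h E.≈ value b h
    value-stepᴮ ¬c s = value-cong I.refl (EqC.return (linkᴮ ¬c s))

    private
      module Evalᴬ = Evaluation 𝓐 value-coveredᴬ value-stepᴬ
      module Evalᴮ = Evaluation 𝓑 value-coveredᴮ value-stepᴮ

    glue : ∀ X Y → (∀ {t} → t ∈ Algorithm.terms signature X → 𝓐.Named t) →
      (∀ {t} → t ∈ Algorithm.terms signature Y → 𝓑.Named t) →
      ⊨ flatten X → ⊨ flatten Y → ρ C.⊨ (X ∧̇ Y)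
    glue X Y nX nY hX hY = from (Evalᴬ.flatten-holds X nX) hX , from (Evalᴮ.flatten-holds Y nY) hY

-- The constraints imposed by Step 2

concatMap-All⁻ : {A B : Set} {P : B → Set} (f : A → List B) {xs : List A} {x : A} →
  All P (concatMap f xs) → x ∈ xs → All P (f x)
concatMap-All⁻ f ps x∈ = All.tabulate (λ y∈ → All.lookup ps (∈-concatMap⁺′ f x∈ y∈))

module Occurrences (S : Signature) where
  open CardSyntax S
  open Separated S
  open Algorithm S
  open Naming S

  naming-Φ₁ : ∀ X Y {t α} → t ∈ namedTerms X Y → α ∈ Φ₁ (naming t) → α ∈ Φ₁ (preprocess X Y)
  naming-Φ₁ X Y = Φ₁-⋃⁺ naming

  naming-Φ₂ : ∀ X Y {t φ} → t ∈ namedTerms X Y → φ ∈ Φ₂ (naming t) → φ ∈ Φ₂ (preprocess X Y)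
  naming-Φ₂ X Y t∈ φ∈ = there (Φ₂-⋃⁺ naming t∈ φ∈)

  symbols₁-∈ : ∀ Φ {α s} → α ∈ Φ₁ Φ → s ∈ symbols₁ α → s ∈ symbolsˢ Φ
  symbols₁-∈ Φ α∈ s∈ = ∈-++⁺ˡ (∈-concatMap⁺′ symbols₁ α∈ s∈)

  symbols₂-∈ : ∀ Φ {φ s} → φ ∈ Φ₂ Φ → s ∈ symbols φ → s ∈ symbolsˢ Φ
  symbols₂-∈ Φ φ∈ s∈ = ∈-++⁺ʳ (concatMap symbols₁ (Φ₁ Φ)) (∈-concatMap⁺′ symbols φ∈ s∈)

  symbolsˢ⁻ : ∀ Φ {s} → s ∈ symbolsˢ Φ →
    (∃ λ α → α ∈ Φ₁ Φ × s ∈ symbols₁ α) ⊎ (∃ λ φ → φ ∈ Φ₂ Φ × s ∈ symbols φ)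
  symbolsˢ⁻ Φ s∈ = Sum.map (∈-concatMap⁻′ symbols₁ (Φ₁ Φ)) (∈-concatMap⁻′ symbols (Φ₂ Φ))
    (∈-++⁻ (concatMap symbols₁ (Φ₁ Φ)) s∈)

  symbolsˢ-∪ˡ : ∀ Φ Ψ {s} → s ∈ symbolsˢ Φ → s ∈ symbolsˢ (Φ ∪ Ψ)
  symbolsˢ-∪ˡ Φ Ψ s∈ with symbolsˢ⁻ Φ s∈
  ... | inj₁ (_ , α∈ , p) = symbols₁-∈ (Φ ∪ Ψ) (∈-++⁺ˡ α∈) p
  ... | inj₂ (_ , φ∈ , p) = symbols₂-∈ (Φ ∪ Ψ) (∈-++⁺ˡ φ∈) p

  symbolsˢ-∪ʳ : ∀ Φ Ψ {s} → s ∈ symbolsˢ Ψ → s ∈ symbolsˢ (Φ ∪ Ψ)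
  symbolsˢ-∪ʳ Φ Ψ s∈ with symbolsˢ⁻ Ψ s∈
  ... | inj₁ (_ , α∈ , p) = symbols₁-∈ (Φ ∪ Ψ) (∈-++⁺ʳ (Φ₁ Φ) α∈) p
  ... | inj₂ (_ , φ∈ , p) = symbols₂-∈ (Φ ∪ Ψ) (∈-++⁺ʳ (Φ₂ Φ) φ∈) p

  symbolᵢ : ∀ i → ∃ λ s → s ∈ symbolsᵢ i × asIndex s ≡ just i
  symbolᵢ (name x) = free x , here refl , refl
  symbolᵢ (con c)  = const c , here refl , refl

  indexConstants⁺ : ∀ Φ i → (∀ {s} → s ∈ symbolsᵢ i → s ∈ symbolsˢ Φ) → i ∈ indexConstants Φ
  indexConstants⁺ Φ i p with s , s∈ , eq ← symbolᵢ i = ∈-mapMaybe⁺ asIndex (p s∈) eq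

  module _ {X : Formula} {a b : Term ARRAY} (la : Local X a) (lb : Local X b) where

    mutual
      iterate-local : ∀ n → Local X (iterate a b n)
      iterate-local zero    = lb
      iterate-local (suc n) = All.++⁺ (iterate-local n) (All.++⁺ (diffᵗ-local n) (All.++⁺ la (diffᵗ-local n)))

      diffᵗ-local : ∀ n → Local X (diffᵗ a b n)
      diffᵗ-local n = All.++⁺ la (iterate-local n)

module Sides (em : ExcludedMiddle 0ℓ) (T : IndexTheory)
  (M : EUF.EUFModel (IndexTheory.theory T) (Separated.Name (IndexTheory.signature T))) where
  open IndexTheory T using (theory; signature)
  open CardSyntax signature
  open Separated signature
  open Algorithm signature hiding (𝓘; N)
  open Naming signature
  open Instances signature
  open Occurrences signature
  open EUF.EUFModel M
  open IndexOrder em T indexModel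
  open Gluing em T M using (ι; ε; ℓ; δ; κ; _at_; DiffChain; Side)
  open FiniteArrays em T indexModel elemSetoid botᴹ elᴹ bot≉el using (InRange; InRange-resp)

  den : ICst → I.Carrier
  den i = I.⟦ ⟨ i ⟩ ⟧ indexᴹ

  ⟦csts⟧ : ∀ {n} (ts : Vec (Term INDEX) n) → I.⟦ Vec.map (λ t → ⟨ cstᴵ t ⟩) ts ⟧* indexᴹ ≡ Vec.map ι ts
  ⟦csts⟧ []       = refl
  ⟦csts⟧ (t ∷ ts) = cong (ι t ∷_) (⟦csts⟧ ts)

  -- `Q` stands for the union of both pairs after Step 1: instantiation draws on the constants of
  -- both formulae, filtered by locality to `X`.
  module _ (X Y : Formula) (D : List Atom₁) (Q : SepPair) where

    private
      step1 : SepPair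
      step1 = preprocess X Y ∪ (D ∣ [])

      𝓘 : List ICst
      𝓘 = 𝟘 ∷ filter (λ i → local? X (termᴵ i)) (indexConstants Q)

      Named : ∃ Term → Set
      Named t = t ∈ namedTerms X Y

      writeIndices′ : List ICst
      writeIndices′ = deduplicate _≟ᴵ_ (filter (λ i → local? X (termᴵ i)) (writeIndices (preprocess X Y)))

    module _ {N : ℕ} {Common : Term ARRAY → Set}
      (few : writeCount X Y ℕ.≤ N)
      (Q⊇ : ∀ {s} → s ∈ symbolsˢ step1 → s ∈ symbolsˢ Q)
      (common-named : ∀ {a} → Common a → Named (ARRAY , a))
      (D∋ : ∀ {a b n} → Common a → Common b → ¬ (a ≡ b) → n ℕ.≤ N →
        diff≡ n ⌜ a ⌝ ⌜ b ⌝ (name (diffₖ n ⌜ a ⌝ ⌜ b ⌝)) ∈ D)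
      (holds : ⊨ ⋀ (Φ₂ (instantiate 𝓘 step1))) where

      private
        covered : List I.Carrier
        covered = map den 𝓘

        Covered : I.Carrier → Set
        Covered h = Any (h I.≈_) covered

        covered⁺ : ∀ i → Local X (termᴵ i) → (∀ {s} → s ∈ symbolsᵢ i → s ∈ symbolsˢ step1) → Covered (den i)
        covered⁺ i l occ = Any.map⁺ {xs = 𝓘} (lose {P = λ j → den i I.≈ den j}
          (there (∈-filter⁺ (λ i → local? X (termᴵ i)) (indexConstants⁺ Q i (Q⊇ ∘ occ)) l)) I.refl)

        covered⁻ : ∀ {h} → Covered h → ∃ λ i → i ∈ 𝓘 × h I.≈ den i
        covered⁻ c = find (Any.map⁻ c)

        base : ∀ {φ} → φ ∈ Φ₂ step1 → ⊨ φ
        base φ∈ = All.lookup (⋀⁻ (Φ₂ (instantiate 𝓘 step1)) holds) (∈-++⁺ˡ φ∈)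

        instance-holds : ∀ {α} → α ∈ Φ₁ step1 → All ⊨_ (instances 𝓘 (Φ₁ step1) α)
        instance-holds = concatMap-All⁻ (instances 𝓘 (Φ₁ step1))
          (All.++⁻ʳ (Φ₂ step1) (⋀⁻ (Φ₂ (instantiate 𝓘 step1)) holds))

        atom₁ : ∀ {t α} → Named t → α ∈ Φ₁ (naming t) → α ∈ Φ₁ step1
        atom₁ n α∈ = ∈-++⁺ˡ (naming-Φ₁ X Y n α∈)

        atom₂ : ∀ {t φ} → Named t → φ ∈ Φ₂ (naming t) → φ ∈ Φ₂ step1
        atom₂ n φ∈ = ∈-++⁺ˡ (naming-Φ₂ X Y n φ∈)

        len∈ : ∀ {a} → Named (ARRAY , a) → len≡ ⌜ a ⌝ (name ⌜ len a ⌝) ∈ Φ₁ step1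
        len∈ n = atom₁ (named-len X Y n) (here refl)

        local : ∀ {t} → Named t → Local X (proj₂ t)
        local = named-local X Y

        local-cst : ∀ {t} → Named (INDEX , t) → Local X (termᴵ (cstᴵ t))
        local-cst {t} n = subst (Local X) (sym (termᴵ-cstᴵ t)) (local n)

        len-holds : ∀ {a} → Named (ARRAY , a) → All ⊨_ (lenInstances 𝓘 ⌜ a ⌝ (name ⌜ len a ⌝))
        len-holds n = instance-holds (len∈ n)

        defined : ∀ {a h} → Named (ARRAY , a) → Covered h → (¬ (a at h E.≈ botᴹ)) ⇔ InRange (ℓ a) h
        defined {a} n c =
          let i , i∈ , h≈ = covered⁻ c
              f , g = All.lookup (All.map⁻ (All.tail (len-holds n))) i∈ in mk⇔
          (λ ≉⊥ → InRange-resp I.refl (I.sym h≈) (f (λ eq → ≉⊥ (E.trans (fun-cong ⌜ a ⌝ h≈) eq))))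
          (λ r eq → g (InRange-resp I.refl h≈ r) (E.trans (fun-cong ⌜ a ⌝ (I.sym h≈)) eq))

        wr-holds : ∀ {b i e} → Named (ARRAY , wr b i e) →
          All ⊨_ (wrInstances 𝓘 ⌜ wr b i e ⌝ ⌜ b ⌝ (cstᴵ i) (cstᴱ e) (name ⌜ len b ⌝))
        wr-holds {b} {i} {e} n = concatMap-All⁻ (wrInstances 𝓘 ⌜ wr b i e ⌝ ⌜ b ⌝ (cstᴵ i) (cstᴱ e))
          (instance-holds (atom₁ n (here refl)))
          (lengths⁺ ⌜ b ⌝ (len∈ (named-closed X Y wr-array n)))

        -- For chains of any length: `n` is 0 for a term `diff a b`, and N for the iterated
        -- differences of two common arrays.
        record Facts (a b : Term ARRAY) (n : ℕ) (k : ℕ → I.Carrier) : Set where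
          field
            mono   : ∀ {j} → j ℕ.< n → k (suc j) I.≤ k j
            stable : ∀ {j} → j ℕ.< n → ℓ a I.≈ ℓ b → k j I.≈ k (suc j) → k j I.≈ I.0ᴹ
            zero′  : ∀ {j} → j ℕ.≤ n → a at k j E.≈ b at k j → k j I.≈ I.0ᴹ
            left   : ℓ b I.< ℓ a → k n I.≈ ℓ a
            right  : ℓ a I.< ℓ b → k n I.≈ ℓ b
            above  : ∀ {h} → Covered h → k n I.< h → a at h E.≈ b at h ⊎ (∃ λ j → j ℕ.< n × h I.≈ k j)

        facts-from : ∀ {a b} n (k : ℕ → ICst) (ks : Vec ICst (suc n)) → Chain (λ i j → i ≡ k j) ks →
          All ⊨_ (diffInstances 𝓘 ⌜ a ⌝ ⌜ b ⌝ ks (name ⌜ len a ⌝) (name ⌜ len b ⌝)) → Facts a b n (den ∘ k)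
        facts-from {a} {b} n k ks ch ((monos , _) ∷ _ ∷ stables ∷ zeros ∷ lefts ∷ rights ∷ aboves) = record
          { mono = mono
          ; stable = stable
          ; zero′ = zero′
          ; left = λ lt → I.trans (I.reflexive (cong den (sym last≡))) (proj₂ (lefts lt))
          ; right = λ lt → I.trans (I.reflexive (cong den (sym last≡))) (proj₂ (rights lt))
          ; above = above
          }
          where
          R : ICst → ℕ → Set
          R i j = i ≡ k j

          last≡ : Vec.last ks ≡ k n
          last≡ = Chain-last R ks ch

          mono : ∀ {j} → j ℕ.< n → den (k (suc j)) I.≤ den (k j)
          mono j<n with _ , _ , s∈ , refl , refl ← consecutive-Chain⁺ R ks ch j<n =
            All.lookup (All.map⁻ (⋀⁻ (map (λ (k , k′) → k′ ≤ᴵ k) (consecutive ks)) monos)) s∈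

          stable : ∀ {j} → j ℕ.< n → ℓ a I.≈ ℓ b → den (k j) I.≈ den (k (suc j)) → den (k j) I.≈ I.0ᴹ
          stable j<n la≈lb eq with _ , _ , s∈ , refl , refl ← consecutive-Chain⁺ R ks ch j<n =
            All.lookup (All.map⁻ (⋀⁻ (map (λ (k , k′) → name ⌜ len a ⌝ ≡ᴵ name ⌜ len b ⌝ ∧̇ k ≡ᴵ k′ ⇒̇ k ≡ᴵ 𝟘)
              (consecutive ks)) stables)) s∈ (la≈lb , eq)

          zero′ : ∀ {j} → j ℕ.≤ n → a at den (k j) E.≈ b at den (k j) → den (k j) I.≈ I.0ᴹ
          zero′ j≤n eq with _ , k∈ , refl ← Chain-∈⁺ R ks ch (s≤s j≤n) =
            All.lookup (All.map⁻ (⋀⁻ (map (λ k → ⌜ a ⌝ ‼ k ≡ᴱ ⌜ b ⌝ ‼ k ⇒̇ k ≡ᴵ 𝟘) (Vec.toList ks)) zeros)) k∈ eq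

          above : ∀ {h} → Covered h → den (k n) I.< h → a at h E.≈ b at h ⊎ (∃ λ j → j ℕ.< n × h I.≈ den (k j))
          above {h} c (le , neq) with i , i∈ , h≈ ← covered⁻ c
            with All.lookup (All.map⁻ aboves) i∈
              (I.≤-resp (I.reflexive (cong den (sym last≡))) h≈ le ,
               λ eq → neq (I.trans (I.reflexive (cong den (sym last≡))) (I.trans eq (I.sym h≈))))
          ... | inj₁ eq = inj₁ (E.trans (fun-cong ⌜ a ⌝ h≈) (E.trans eq (fun-cong ⌜ b ⌝ (I.sym h≈))))
          ... | inj₂ or
            with i′ , i′∈ , eq ← find (Any.map⁻ (⋁⁻ (map (i ≡ᴵ_) (Vec.toList (Vec.init ks))) or))
            with j , j<n , refl ← Chain-∈⁻ R (Vec.init ks) (Chain-init R ks ch) i′∈ =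
            inj₂ (j , j<n , I.trans h≈ eq)

        facts : ∀ {a b} n (k : ℕ → ICst) → Named (ARRAY , a) → Named (ARRAY , b) →
          (∀ {j} → j ℕ.≤ n → diff≡ j ⌜ a ⌝ ⌜ b ⌝ (k j) ∈ Φ₁ step1) → Facts a b n (den ∘ k)
        facts {a} {b} n k na nb k∈ =
          let ks , ks∈ , ch = chains⁺ k ⌜ a ⌝ ⌜ b ⌝ (suc n) (λ j<sn → k∈ (ℕ.s≤s⁻¹ j<sn)) in
          facts-from n k ks ch (concatMap-All⁻
            (diffInstances 𝓘 ⌜ a ⌝ ⌜ b ⌝ ks (name ⌜ len a ⌝))
            (concatMap-All⁻ (λ la → concatMap (diffInstances 𝓘 ⌜ a ⌝ ⌜ b ⌝ ks la) (lengths (Φ₁ step1) ⌜ b ⌝))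
              (concatMap-All⁻ (λ ks → concatMap (λ la → concatMap (diffInstances 𝓘 ⌜ a ⌝ ⌜ b ⌝ ks la)
                  (lengths (Φ₁ step1) ⌜ b ⌝)) (lengths (Φ₁ step1) ⌜ a ⌝))
                (instance-holds (k∈ ℕ.≤-refl)) ks∈)
              (lengths⁺ ⌜ a ⌝ (len∈ na)))
            (lengths⁺ ⌜ b ⌝ (len∈ nb)))

        diff-facts : ∀ {a b} → Named (INDEX , diff a b) → Facts a b 0 (λ _ → δ a b)
        diff-facts {a} {b} n = facts 0 (λ _ → name ⌜ diff a b ⌝)
          (named-closed X Y diff-left n) (named-closed X Y diff-right n) (λ { z≤n → atom₁ n (here refl) })

        diff-chain : ∀ {a b} → Common a → Common b → ¬ (a ≡ b) → DiffChain Covered N a b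
        diff-chain {a} {b} ca cb a≢b = record
          { κ-covered = λ {j} j≤N → covered⁺ (name (diffₖ j ⌜ a ⌝ ⌜ b ⌝)) (diffᵗ-local {X} {a} {b} (local na) (local nb) j)
              (λ { (here refl) → symbols₁-∈ step1 (diff∈ j≤N) (there (there (here refl))) })
          ; κ-mono = mono
          ; κ-stable = stable
          ; κ-zero = zero′
          ; κ-left = left
          ; κ-right = right
          ; κ-above = above
          }
          where
          na = common-named ca
          nb = common-named cb

          diff∈ : ∀ {j} → j ℕ.≤ N → diff≡ j ⌜ a ⌝ ⌜ b ⌝ (name (diffₖ j ⌜ a ⌝ ⌜ b ⌝)) ∈ Φ₁ step1
          diff∈ j≤N = ∈-++⁺ʳ (Φ₁ (preprocess X Y)) (D∋ ca cb a≢b j≤N)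

          open Facts (facts N (λ j → name (diffₖ j ⌜ a ⌝ ⌜ b ⌝)) na nb diff∈)

        wr-out : ∀ {b i e} → Named (ARRAY , wr b i e) →
          ¬ (¬ (ε e E.≈ botᴹ) × InRange (ℓ b) (ι i)) → wr b i e at ι i E.≈ b at ι i
        wr-out {b} {i} {e} n ¬w = All.head (All.tail (wr-holds n)) out
          where
          out : ι i I.< I.0ᴹ ⊎ ℓ b I.< ι i ⊎ ε e E.≈ botᴹ
          out with em {ε e E.≈ botᴹ} | em {I.0ᴹ I.≤ ι i}
          ... | yes e≈⊥ | _       = inj₂ (inj₂ e≈⊥)
          ... | no e≉⊥  | no neg  = inj₁ (≰⇒> neg)
          ... | no e≉⊥  | yes 0≤i = inj₂ (inj₁ (≰⇒> (λ i≤l → ¬w (e≉⊥ , 0≤i , i≤l))))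

        wr-other : ∀ {b i e h} → Named (ARRAY , wr b i e) → Covered h → ¬ (h I.≈ ι i) →
          wr b i e at h E.≈ b at h
        wr-other {b} {i} {e} n c h≉i = let j , j∈ , h≈ = covered⁻ c in
          E.trans (fun-cong ⌜ wr b i e ⌝ h≈) (E.trans
            (All.lookup (All.map⁻ (All.tail (All.tail (wr-holds n)))) j∈ (λ eq → h≉i (I.trans h≈ eq)))
            (fun-cong ⌜ b ⌝ (I.sym h≈)))

        wr-counted : ∀ {b i e} → Named (ARRAY , wr b i e) → Any (ι i I.≈_) (map den writeIndices′)
        wr-counted {b} {i} n = Any.map⁺ {xs = writeIndices′} (lose {P = λ j → ι i I.≈ den j} (∈-deduplicate⁺ _≟ᴵ_ (∈-filter⁺ (λ i → local? X (termᴵ i))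
          (∈-mapMaybe⁺ writeIndex (naming-Φ₁ X Y n (here refl)) refl)
          (local-cst {i} (named-closed X Y wr-index n)))) I.refl)

      side : Side N Common
      side = record
        { Named = Named
        ; covered = covered
        ; writes = map den writeIndices′
        ; few-writes = ℕ.≤-trans (ℕ.≤-reflexive (List.length-map den writeIndices′)) few
        ; named-closed = named-closed X Y
        ; zero-covered = here I.refl
        ; len-covered = λ {a} n → covered⁺ (name ⌜ len a ⌝) (local (named-len X Y n))
            (λ { (here refl) → symbols₁-∈ step1 (len∈ n) (there (here refl)) })
        ; diff-covered = λ {a} {b} n → covered⁺ (name ⌜ diff a b ⌝) (local n)
            (λ { (here refl) → symbols₁-∈ step1 (atom₁ n (here refl)) (there (there (here refl))) })
        ; wr-covered = λ {b} {i} n → covered⁺ (cstᴵ i) (local-cst {i} (named-closed X Y wr-index n))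
            (λ s∈ → symbols₁-∈ step1 (atom₁ n (here refl)) (there (there (∈-++⁺ˡ s∈))))
        ; rd-covered = λ {a} {i} n → covered⁺ (cstᴵ i) (local-cst {i} (named-closed X Y rd-index n))
            (λ s∈ → symbols₂-∈ step1 (atom₂ n (here refl)) (there (∈-++⁺ˡ (∈-++⁺ˡ s∈))))
        ; wr-counted = wr-counted
        ; fn-value = λ {f} {ts} n → I.trans (base (atom₂ n (here refl))) (I.reflexive (cong (I.fnᴹ f) (⟦csts⟧ ts)))
        ; rd-value = λ n → base (atom₂ n (here refl))
        ; len-nonneg = λ n → All.head (len-holds n)
        ; defined = defined
        ; wr-same = λ n → All.head (wr-holds n)
        ; wr-out = wr-out
        ; wr-other = wr-other
          ; diff-zero = λ n → Facts.zero′ (diff-facts n) z≤n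
        -- A single difference has no predecessors in its chain, so the second alternative is empty.
        ; diff-above = λ n c lt → [ id , (λ { (_ , () , _) }) ]′ (Facts.above (diff-facts n) c lt)
        ; δ-left = λ n → Facts.left (diff-facts n)
        ; δ-right = λ n → Facts.right (diff-facts n)
        ; diff-chain = diff-chain
        }

      side-flatten : ⊨ flatten X
      side-flatten = base (here refl)

-- Colors

module Locality (S : Signature) where
  open Signature S
  open Syntax S
  open CardSyntax S
  open Separated S
  open Algorithm S
  open Naming S
  open Instances S
  open Occurrences S

  module _ (X : Formula) where

    LocalSymbol : Symbol → Set
    LocalSymbol (free x)  = Local X (term x)
    LocalSymbol (const c) = ⊤

    LocalAtom : EUFAtom → Set
    LocalAtom α = All LocalSymbol (symbolsᵃ α)

    Localᶠ : EUFFormula → Set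
    Localᶠ = EveryAtom LocalAtom

    Localᴵ : ICst → Set
    Localᴵ i = All LocalSymbol (symbolsᵢ i)

    Localᴱ : ETm → Set
    Localᴱ e = All LocalSymbol (symbolsᵉ e)

    termᴵ-local : ∀ i → Local X (termᴵ i) → Localᴵ i
    termᴵ-local (name x) l = l ∷ []
    termᴵ-local (con c)  l = tt ∷ []

    cstᴵ-local : ∀ {t} → Local X t → Localᴵ (cstᴵ t)
    cstᴵ-local {t} l = termᴵ-local (cstᴵ t) (subst (Local X) (sym (termᴵ-cstᴵ t)) l)

    cstᴱ-local : ∀ {e} → Local X e → Localᴱ ⟨ cstᴱ e ⟩ᴱ
    cstᴱ-local {var x}  l = l ∷ []
    cstᴱ-local {rd a i} l = l ∷ []
    cstᴱ-local {bot}    l = []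
    cstᴱ-local {el}     l = []

    csts-local : ∀ {n} (ts : Vec (Term INDEX) n) → All (_∈ vars X) (varsᵗ* ts) →
      All LocalSymbol (symbolsᵗ* (Vec.map (λ t → ⟨ cstᴵ t ⟩) ts))
    csts-local []       l = []
    csts-local (t ∷ ts) l = All.++⁺ (cstᴵ-local {t} (All.++⁻ˡ (varsᵗ t) l)) (csts-local ts (All.++⁻ʳ (varsᵗ t) l))

    -- The shape in which `concatMap` lists the symbols of an index atom with two terms.
    ++[]-local : ∀ {ss ss′} → All LocalSymbol ss → All LocalSymbol ss′ → All LocalSymbol (ss ++ ss′ ++ [])
    ++[]-local p q = All.++⁺ p (All.++⁺ q [])

    flatten-local : Localᶠ (flatten X)
    flatten-local = bind-EveryAtom {P = λ α → All (_∈ vars X) (varsᵃ α)} X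
      (λ {α} → atom-local α) (EveryAtom⁺ X (atom-vars {X}))
      where
      atom-local : ∀ α → All (_∈ vars X) (varsᵃ α) → Localᶠ (flattenᵃ α)
      atom-local (index α) l = concatMap-All local-term
        where
        local-term : ∀ {u} → u ∈ termsᴬ (mapᴬ (λ t → ⟨ cstᴵ t ⟩) α) → All LocalSymbol (symbolsᵗ u)
        local-term u∈ with t , t∈ , refl ← termsᴬ-map S (λ t → ⟨ cstᴵ t ⟩) α u∈ =
          cstᴵ-local {t} (concatMap-All⁻ varsᵗ l t∈)
      atom-local (array≐ a b) l =
        (l ∷ tt ∷ []) , (All.++⁻ˡ (varsᵗ a) l ∷ tt ∷ All.++⁻ʳ (varsᵗ a) l ∷ tt ∷ [])
      atom-local (elem≐ d e) l =
        All.++⁺ (cstᴱ-local {d} (All.++⁻ˡ (varsᵗ d) l)) (cstᴱ-local {e} (All.++⁻ʳ (varsᵗ d) l))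

    Local₁ : Atom₁ → Set
    Local₁ α = All LocalSymbol (symbols₁ α)

    naming-local : ∀ t → Local X (proj₂ t) → All Local₁ (Φ₁ (naming t)) × All Localᶠ (Φ₂ (naming t))
    naming-local (INDEX , var x)    l = [] , []
    naming-local (INDEX , con c)    l = [] , []
    naming-local (INDEX , fn f ts)  l = [] , (l ∷ All.++⁺ (csts-local ts l) []) ∷ []
    naming-local (INDEX , len a)    l = (l ∷ l ∷ []) ∷ [] , []
    naming-local (INDEX , diff a b) l = (All.++⁻ˡ (varsᵗ a) l ∷ All.++⁻ʳ (varsᵗ a) l ∷ l ∷ []) ∷ [] , []
    naming-local (ARRAY , var x)    l = [] , []
    naming-local (ARRAY , wr b i e) l =
      (l ∷ ◁-local {X} (wr-array {b} {i} {e}) l ∷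
        All.++⁺ (cstᴵ-local {i} (◁-local {X} (wr-index {b} {i} {e}) l)) (cstᴱ-local {e} (◁-local {X} (wr-value {b} {i} {e}) l))) ∷ [] , []
    naming-local (ELEM  , var x)    l = [] , []
    naming-local (ELEM  , rd a i)   l =
      [] , (All.++⁺ (◁-local {X} (rd-array {a} {i}) l ∷ cstᴵ-local {i} (◁-local {X} (rd-index {a} {i}) l)) (l ∷ [])) ∷ []
    naming-local (ELEM  , bot)      l = [] , []
    naming-local (ELEM  , el)       l = [] , []

    preprocess-local₁ : ∀ Y {α} → α ∈ Φ₁ (preprocess X Y) → Local₁ α
    preprocess-local₁ Y α∈ with t , t∈ , p ← Φ₁-⋃⁻ naming (namedTerms X Y) α∈ =
      All.lookup (proj₁ (naming-local t (named-local X Y t∈))) p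

    preprocess-local₂ : ∀ Y {φ} → φ ∈ Φ₂ (preprocess X Y) → Localᶠ φ
    preprocess-local₂ Y (here refl) = flatten-local
    preprocess-local₂ Y (there φ∈) with t , t∈ , p ← Φ₂-⋃⁻ naming (namedTerms X Y) φ∈ =
      All.lookup (proj₂ (naming-local t (named-local X Y t∈))) p

    module _ {𝓘 : List ICst} (l𝓘 : ∀ {i} → i ∈ 𝓘 → Localᴵ i) where

      zero-local : Localᴵ 𝟘
      zero-local = tt ∷ []

      rd-local : ∀ (a b : Name ARRAY) {ss} → Local X (term a) → Local X (term b) → All LocalSymbol ss →
        All LocalSymbol ((free a ∷ ss) ++ free b ∷ ss)
      rd-local a b la lb li = All.++⁺ (la ∷ li) (lb ∷ li)

      wrInstances-local : ∀ {a b i e lb} → Local₁ (wr≡ a b i e) → Localᴵ lb → All Localᶠ (wrInstances 𝓘 a b i e lb)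
      wrInstances-local {a} {b} {i} (la ∷ lb ∷ l) ll
        with li ← All.++⁻ˡ (symbolsᵢ i) l | le ← All.++⁻ʳ (symbolsᵢ i) l =
          (((All.++⁺ le [] , tt) , ++[]-local zero-local li , ++[]-local li ll) , All.++⁺ (la ∷ li) le)
        ∷ (((++[]-local li zero-local , ++[]-local li zero-local , tt) ,
            (++[]-local ll li , ++[]-local ll li , tt) , All.++⁺ le []) , rd-local a b la lb li)
        ∷ All.map⁺ (All.tabulate λ h∈ → (++[]-local (l𝓘 h∈) li , tt) , rd-local a b la lb (l𝓘 h∈))

      lenInstances-local : ∀ {a i} → Local₁ (len≡ a i) → All Localᶠ (lenInstances 𝓘 a i)
      lenInstances-local (la ∷ li) =
          ++[]-local zero-local li
        ∷ All.map⁺ (All.tabulate λ h∈ →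
            let lh = l𝓘 h∈
                def = All.++⁺ (la ∷ lh) [] , tt
                range = ++[]-local zero-local lh , ++[]-local lh li
            in (def , range) , (range , def))

      diffInstances-local : ∀ {a b n la lb} (ks : Vec ICst (suc n)) → Local X (term a) → Local X (term b) →
        Chain (λ k _ → Localᴵ k) ks → Localᴵ la → Localᴵ lb → All Localᶠ (diffInstances 𝓘 a b ks la lb)
      diffInstances-local {a} {b} {n} {la} {lb} ks a-local b-local ch lla llb =
          (⋀-EveryAtom (All.map⁺ (All.tabulate λ s∈ → let _ , p , q = step s∈ in ++[]-local q p)) ,
            ++[]-local zero-local last-local)
        ∷ ⋀-EveryAtom (All.map⁺ (All.tabulate λ s∈ → let _ , p , q = step s∈ in
            (++[]-local q p , ++[]-local q p , tt) , rd-local a b a-local b-local p , tt))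
        ∷ ⋀-EveryAtom (All.map⁺ (All.tabulate λ s∈ → let _ , p , q = step s∈ in
            (++[]-local lla llb , ++[]-local p q) , ++[]-local p zero-local))
        ∷ ⋀-EveryAtom (All.map⁺ (All.tabulate λ k∈ → let _ , _ , p = Chain-∈⁻ R ks ch k∈ in
            rd-local a b a-local b-local p , ++[]-local p zero-local))
        ∷ ((++[]-local llb lla , ++[]-local llb lla , tt) , ++[]-local head-local last-local , ++[]-local last-local lla)
        ∷ ((++[]-local lla llb , ++[]-local lla llb , tt) , ++[]-local head-local last-local , ++[]-local last-local llb)
        ∷ All.map⁺ (All.tabulate λ h∈ → let lh = l𝓘 h∈ in
            (++[]-local last-local lh , ++[]-local last-local lh , tt) , rd-local a b a-local b-local lh ,
            ⋁-EveryAtom (All.map⁺ (All.tabulate λ k∈ →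
              let _ , _ , p = Chain-∈⁻ R (Vec.init ks) (Chain-init R ks ch) k∈ in ++[]-local lh p)))
        where
        R : ICst → ℕ → Set
        R k _ = Localᴵ k

        step : ∀ {k k′} → (k , k′) ∈ consecutive ks → ∃ λ j → R k j × R k′ (suc j)
        step = consecutive-Chain⁻ R ks ch

        head-local = Chain-head R ks ch
        last-local = Chain-last R ks ch

      instances-local : ∀ {Φ} → (∀ {α} → α ∈ Φ → Local₁ α) → ∀ {α} → α ∈ Φ → All Localᶠ (instances 𝓘 Φ α)
      instances-local l {len≡ a i} α∈ = lenInstances-local {a} {i} (l α∈)
      instances-local l {wr≡ a b i e} α∈ = concatMap-All λ {lb} lb∈ →
        wrInstances-local {a} {b} {i} {e} {lb} (l α∈) (All.tail (l (lengths⁻ b lb∈)))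
      instances-local l {diff≡ n a b i} α∈ with la ∷ lb ∷ _ ← l α∈ =
        concatMap-All λ {ks} ks∈ → concatMap-All λ i∈ → concatMap-All λ j∈ →
          diffInstances-local {a} {b} ks la lb
            (chains⁻ a b (suc n) (λ α∈ → All.tail (All.tail (l α∈))) ks∈)
            (All.tail (l (lengths⁻ a i∈))) (All.tail (l (lengths⁻ b j∈)))

    -- Instantiating constants may stem from the other formula, but the filter keeps only those
    -- local to `X`, so no foreign symbol enters.
    step2-local : ∀ Y D Q → (∀ {α} → α ∈ D → Local₁ α) →
      Localᶠ (⋀ (Φ₂ (instantiate (𝟘 ∷ filter (λ i → local? X (termᴵ i)) (indexConstants Q)) (preprocess X Y ∪ (D ∣ [])))))
    step2-local Y D Q lD = ⋀-EveryAtom (All.++⁺ (All.++⁺ (All.tabulate (λ {φ} → preprocess-local₂ Y {φ})) [])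
      (concatMap-All (instances-local 𝓘-local local₁)))
      where
      local₁ : ∀ {α} → α ∈ Φ₁ (preprocess X Y ∪ (D ∣ [])) → Local₁ α
      local₁ α∈ = [ preprocess-local₁ Y , lD ]′ (∈-++⁻ (Φ₁ (preprocess X Y)) α∈)

      𝓘-local : ∀ {i} → i ∈ 𝟘 ∷ filter (λ i → local? X (termᴵ i)) (indexConstants Q) → Localᴵ i
      𝓘-local (here refl) = tt ∷ []
      𝓘-local {i} (there i∈) =
        termᴵ-local i (proj₂ (∈-filter⁻ (λ i → local? X (termᴵ i)) {xs = indexConstants Q} i∈))

    symbols-local : ∀ φ {s} → Localᶠ φ → s ∈ symbols φ → LocalSymbol s
    symbols-local φ lφ s∈ with α , α∈ , p ← ∈-concatMap⁻′ symbolsᵃ (atoms φ) s∈ =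
      All.lookup (All.lookup (EveryAtom⁻ φ lφ) α∈) p

  -- Reading back turns a name into a whole term; this records the name from which a variable stems,
  -- so that the color of the name passes to the variable.
  Reads : List Symbol → Variable → Set
  Reads ss v = ∃₂ λ s (x : Name s) → free x ∈ ss × v ∈ varsᵗ (term x)

  Reads-++ : ∀ ss ss′ {v} → Reads ss v ⊎ Reads ss′ v → Reads (ss ++ ss′) v
  Reads-++ ss ss′ (inj₁ (s , x , x∈ , v∈)) = s , x , ∈-++⁺ˡ x∈ , v∈
  Reads-++ ss ss′ (inj₂ (s , x , x∈ , v∈)) = s , x , ∈-++⁺ʳ ss x∈ , v∈

  mutual
    readTm-vars : ∀ t {v} → v ∈ varsᵗ (readTm t) → Reads (symbolsᵗ t) v
    readTm-vars (var x)   v∈ = INDEX , x , here refl , v∈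
    readTm-vars (fn f ts) v∈ = readTm*-vars ts v∈

    readTm*-vars : ∀ {n} (ts : Vec (Tm (Name INDEX)) n) {v} → v ∈ varsᵗ* (readTm* ts) → Reads (symbolsᵗ* ts) v
    readTm*-vars (t ∷ ts) v∈ = Reads-++ (symbolsᵗ t) (symbolsᵗ* ts)
      (Sum.map (readTm-vars t) (readTm*-vars ts) (∈-++⁻ (varsᵗ (readTm t)) v∈))

  readETm-vars : ∀ e {v} → v ∈ varsᵗ (readETm e) → Reads (symbolsᵉ e) v
  readETm-vars (var x) v∈ = ELEM , x , here refl , v∈
  readETm-vars (a · t) v∈ = Reads-++ [ free a ] (symbolsᵗ t)
    (Sum.map (λ v∈a → ARRAY , a , here refl , v∈a) (readTm-vars t) (∈-++⁻ (varsᵗ (term a)) v∈))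

  readAtom-vars : ∀ α {v} → v ∈ varsᵃ (readAtom α) → Reads (symbolsᵃ α) v
  readAtom-vars (index α) v∈
    with u , u∈ , v∈u ← ∈-concatMap⁻′ varsᵗ (termsᴬ (mapᴬ readTm α)) v∈
    with t , t∈ , refl ← termsᴬ-map S readTm α u∈
    with s , x , x∈ , v∈x ← readTm-vars t v∈u =
    s , x , ∈-concatMap⁺′ symbolsᵗ t∈ x∈ , v∈x
  readAtom-vars (d ≐ᴱ e) v∈ = Reads-++ (symbolsᵉ d) (symbolsᵉ e)
    (Sum.map (readETm-vars d) (readETm-vars e) (∈-++⁻ (varsᵗ (readETm d)) v∈))

  atoms-readBack : ∀ φ {β} → β ∈ atoms (readBack φ) → ∃ λ α → α ∈ atoms φ × β ≡ readAtom α
  atoms-readBack φ = All.lookup (EveryAtom⁻ {P = λ β → ∃ λ α → α ∈ atoms φ × β ≡ readAtom α} (readBack φ)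
    (bind-EveryAtom {P = _∈ atoms φ} φ (λ {α} α∈ → α , α∈ , refl) (EveryAtom⁺ φ id)))

  readBack-vars : ∀ φ {v} → v ∈ vars (readBack φ) → Reads (symbols φ) v
  readBack-vars φ v∈
    with β , β∈ , v∈β ← ∈-concatMap⁻′ varsᵃ (atoms (readBack φ)) v∈
    with α , α∈ , refl ← atoms-readBack φ β∈
    with s , x , x∈ , v∈x ← readAtom-vars α v∈β =
    s , x , ∈-concatMap⁺′ symbolsᵃ α∈ x∈ , v∈x

-- Common arrays and the differences added in Step 1

module IteratedDiffs (S : Signature) where
  open CardSyntax S
  open Separated S
  open Algorithm S
  open Naming S
  open Occurrences S

  module _ (A B : Formula) where

    D : List Atom₁
    D = Φ₁ (iteratedDiffs A B)

    common? : ∀ (c : Name ARRAY) → Dec (Local A (term c) × Local B (term c))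
    common? c = local? A (term c) ×-dec local? B (term c)

    pairs : List (Name ARRAY × Name ARRAY)
    pairs = cartesianProduct (commonArrays A B) (commonArrays A B)

    diffsOf : Name ARRAY × Name ARRAY → List Atom₁
    diffsOf (c₁ , c₂) = map (λ n → diff≡ n c₁ c₂ (name (diffₖ n c₁ c₂))) (upTo (N A B))

    D⁻ : ∀ {α} → α ∈ D → ∃ λ n → ∃₂ λ c₁ c₂ → α ≡ diff≡ n c₁ c₂ (name (diffₖ n c₁ c₂)) ×
      (Local A (term c₁) × Local B (term c₁)) × (Local A (term c₂) × Local B (term c₂))
    D⁻ α∈
      with (c₁ , c₂) , p∈ , q ← ∈-concatMap⁻′ diffsOf (distinctPairs A B) α∈
      with n , _ , refl ← ∈-map⁻ (λ n → diff≡ n c₁ c₂ (name (diffₖ n c₁ c₂))) q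
      with p∈′ , _ ← ∈-filter⁻ (λ (c₁ , c₂) → ¬? (c₁ ≟ᴺ c₂)) {xs = pairs} p∈
      with c₁∈ , c₂∈ ← ∈-cartesianProduct⁻ (commonArrays A B) (commonArrays A B) p∈′ =
      n , c₁ , c₂ , refl ,
      proj₂ (∈-filter⁻ common? {xs = arrayConstants (preprocess A B ∪ preprocess B A)} c₁∈) ,
      proj₂ (∈-filter⁻ common? {xs = arrayConstants (preprocess A B ∪ preprocess B A)} c₂∈)

    -- Formulated by naming on both sides, since this is what the gluing knows about the two ends of
    -- a path.
    Common : Term ARRAY → Set
    Common a = (ARRAY , a) ∈ namedTerms A B × (ARRAY , a) ∈ namedTerms B A

    -- A variable has no naming equation of its own, but every named array occurs in the equation
    -- for its length.
    Common⇒∈ : ∀ {a} → Common a → ⌜ a ⌝ ∈ commonArrays A B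
    Common⇒∈ {a} (nA , nB) = ∈-filter⁺ common?
      (∈-mapMaybe⁺ asArray {x = free ⌜ a ⌝}
        (symbolsˢ-∪ˡ (preprocess A B) (preprocess B A)
          (symbols₁-∈ (preprocess A B) (naming-Φ₁ A B (named-len A B nA) (here refl)) (here refl))) refl)
      (named-local A B nA , named-local B A nB)

    -- `upTo` starts from 0 and `N A B` is the successor of the greater write count, so `n` may
    -- equal that count.
    D∋ : ∀ {a b n} → Common a → Common b → ¬ (a ≡ b) → n ℕ.≤ writeCount A B ⊔ writeCount B A →
      diff≡ n ⌜ a ⌝ ⌜ b ⌝ (name (diffₖ n ⌜ a ⌝ ⌜ b ⌝)) ∈ D
    D∋ {a} {b} ca cb a≢b n≤ = ∈-concatMap⁺′ diffsOf
      (∈-filter⁺ (λ (c₁ , c₂) → ¬? (c₁ ≟ᴺ c₂)) {x = ⌜ a ⌝ , ⌜ b ⌝}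
        (∈-cartesianProduct⁺ (Common⇒∈ ca) (Common⇒∈ cb)) (λ { refl → a≢b refl }))
      (∈-map⁺ (λ n → diff≡ n ⌜ a ⌝ ⌜ b ⌝ (name (diffₖ n ⌜ a ⌝ ⌜ b ⌝))) (∈-upTo⁺ (s≤s n≤)))

-- Unsatisfiability after Step 2 and the interpolant

module Correctness (em : ExcludedMiddle 0ℓ) (T : IndexTheory) (A B : CARD.Formula T) where
  open IndexTheory T using (theory; signature)
  open CardSyntax signature
  open Separated signature
  open Algorithm signature
  open Naming signature
  open Locality signature
  open Occurrences signature using (diffᵗ-local; symbolsˢ-∪ˡ; symbolsˢ-∪ʳ)
  open IteratedDiffs signature
  open Card theory using (Unsatisfiable; IsInterpolant; module CardModel)
  open EUF theory Name using (EUFModel; Unsatisfiableᴱ; InterpolationAlgorithm; IsInterpolantᴱ)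

  private
    Q : SepPair
    Q = step1A A B ∪ step1B A B

  step2-unsatisfiable : Unsatisfiable (A ∧̇ B) → Unsatisfiableᴱ (A₂ A B ∧̇ B₂ A B)
  -- `Common A B a` is by definition the pair of both namings, hence the pairing `_,_` as the proof
  -- that doubly named arrays are common.
  step2-unsatisfiable unsat M (hA , hB) = unsat model (ρ sideA sideB _,_) (glue sideA sideB _,_ A B
    (∈-++⁺ˡ {ys = filter (λ t → local? A (proj₂ t)) (terms B)})
    (∈-++⁺ˡ {ys = filter (λ t → local? B (proj₂ t)) (terms A)}) flatA flatB)
    where
    open EUFModel M using (indexModel; elemSetoid; botᴹ; elᴹ; bot≉el; ⊨_)
    open FiniteArrays em T indexModel elemSetoid botᴹ elᴹ bot≉el using (model)
    open Gluing em T M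
    open Sides em T M

    sideA : Side (writeCount A B ⊔ writeCount B A) (Common A B)
    sideA = side A B (D A B) Q (ℕ.m≤m⊔n _ _) (symbolsˢ-∪ˡ (step1A A B) (step1B A B)) proj₁ (D∋ A B) hA

    sideB : Side (writeCount A B ⊔ writeCount B A) (Common A B)
    sideB = side B A (D A B) Q (ℕ.m≤n⊔m _ _) (symbolsˢ-∪ʳ (step1A A B) (step1B A B)) proj₂ (D∋ A B) hB

    flatA : ⊨ flatten A
    flatA = side-flatten A B (D A B) Q (ℕ.m≤m⊔n _ _) (symbolsˢ-∪ˡ (step1A A B) (step1B A B)) proj₁ (D∋ A B) hA

    flatB : ⊨ flatten B
    flatB = side-flatten B A (D A B) Q (ℕ.m≤n⊔m _ _) (symbolsˢ-∪ʳ (step1A A B) (step1B A B)) proj₂ (D∋ A B) hB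

  interpolant : (θ : InterpolationAlgorithm) → Unsatisfiableᴱ (A₂ A B ∧̇ B₂ A B) →
    IsInterpolant A B (cardInterpolant (InterpolationAlgorithm.interpolate θ) A B)
  interpolant θ unsat = record
    { left = λ M ρ hA → let open Soundness em T M ρ in
        to (readBack-holds C) (Θ.left reduct (step2-sound (𝓘 A B A) A B (D A B) (D-meant M ρ) hA))
    ; right = λ M ρ (hC , hB) → let open Soundness em T M ρ in
        Θ.right reduct (from (readBack-holds C) hC , step2-sound (𝓘 A B B) B A (D A B) (D-meant M ρ) hB)
    -- A free constant or `f_a` of the black-box interpolant occurs in `A₂` and in `B₂`, so the term
    -- it names is local to both formulae, and so are the variables of that term.
    ; common = λ v v∈ → let s , x , x∈ , v∈x = readBack-vars C v∈
                            x∈A , x∈B = Θ.common x x∈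
                        in All.lookup (symbols-local A (A₂ A B) (step2-local A B (D A B) Q D-localA) x∈A) v∈x ,
                           All.lookup (symbols-local B (B₂ A B) (step2-local B A (D A B) Q D-localB) x∈B) v∈x
    }
    where
    open InterpolationAlgorithm θ
    C : EUFFormula
    C = interpolate (A₂ A B) (B₂ A B)
    module Θ = IsInterpolantᴱ (correct (A₂ A B) (B₂ A B) unsat)

    D-meant : ∀ M ρ {α} → α ∈ D A B → Soundness.Meant em T M ρ α
    D-meant M ρ α∈ with _ , _ , _ , refl , _ ← D⁻ A B α∈ = CardModel.I.refl M

    D-localA : ∀ {α} → α ∈ D A B → Local₁ A α
    D-localA α∈ with n , _ , _ , refl , (l₁ , _) , (l₂ , _) ← D⁻ A B α∈ = l₁ ∷ l₂ ∷ diffᵗ-local {A} l₁ l₂ n ∷ []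

    D-localB : ∀ {α} → α ∈ D A B → Local₁ B α
    D-localB α∈ with n , _ , _ , refl , (_ , l₁) , (_ , l₂) ← D⁻ A B α∈ = l₁ ∷ l₂ ∷ diffᵗ-local {B} l₁ l₂ n ∷ []

theorem7 : ExcludedMiddle 0ℓ →
    (T : IndexTheory) →
    (θ : CARD.InterpolationAlgorithm T) →
    (A⁰ B⁰ : CARD.Formula T) →
    CARD.Unsatisfiable T (A⁰ ∧̇ B⁰) →
    CARD.Unsatisfiableᴱ T (CARD.A₂ T A⁰ B⁰ ∧̇ CARD.B₂ T A⁰ B⁰) ×
    CARD.IsInterpolant T A⁰ B⁰ (CARD.cardInterpolant T (EUF.InterpolationAlgorithm.interpolate θ) A⁰ B⁰)
theorem7 em T θ A⁰ B⁰ unsat = unsat₂ , interpolant θ unsat₂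
  where
  open Correctness em T A⁰ B⁰
  unsat₂ = step2-unsatisfiable unsat
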